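{- Let $\mathcal G$ be a family of graphs and let $M$ be a function of the input size with $O(M)\supseteq O(n+m)$. The following are equivalent: (1) there is an algorithm with running time in $O(M)$ that decides, for any graph $G\in\mathcal G$, any vertex $s$ and any given vertex order of $G$ beginning with $s$, whether this order is a LexDFS order of $G$; (2) there is an algorithm with running time in $O(M)$ that decides, for any graph $G\in\mathcal G$, any vertex $s$ and any given spanning tree of $G$ rooted in $s$, whether this tree is an $\mathcal L$-tree of LexDFS on $G$.
   Context: Graphs are finite, simple, undirected and connected, with $n$ vertices and $m$ edges. LexDFS started at $s$: label $s$ with $(0)$, all others with the empty label; for $i=1,\dots,n$ pick an unnumbered vertex $v$ with lexicographically largest label, set $\sigma(i)=v$ and prepend $i$ to the label of each unnumbered neighbor of $v$; a LexDFS order is any possible output. The $\mathcal L$-tree of a vertex order $(v_1,\dots,v_n)$ is the spanning tree rooted at $v_1$ with an edge from each $v_i$ ($i>1$) to its rightmost neighbor $v_j$ with $j<i$. A spanning tree $T$ rooted at $s$ is an $\mathcal L$-tree of LexDFS on $G$ if some LexDFS order of $G$ starting at $s$ has $\mathcal L$-tree $T$ (same edge set and same root). -}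

module Defs where

open import Level using (Level; 0ℓ) renaming (suc to lsuc)
open import Data.Bool.Base using (if_then_else_)
open import Data.Nat.Base as ℕ using (ℕ; zero; suc; _+_; _∸_; _*_)
import Data.Nat.Properties as ℕ
open import Data.Fin.Base as Fin using (Fin; zero; suc; toℕ; fromℕ; inject₁)
import Data.Fin.Properties as Fin
open import Data.Fin.Permutation using (Permutation′; _⟨$⟩ʳ_; _⟨$⟩ˡ_)
open import Data.List.Base
  using (List; []; _∷_; length; map; concat; sum; take; filter; upTo; allFin;
         tabulate; cartesianProduct)
open import Data.List.Membership.Propositional using (_∈_)
open import Data.List.Relation.Binary.Lex.Strict using (Lex-≤)
open import Data.List.Relation.Unary.Unique.Propositional using (Unique)
open import Data.Product.Base using (∃; ∃-syntax; _×_; _,_)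
open import Data.Sum.Base using (_⊎_)
open import Function.Bundles using (_⇔_)
open import Function.Definitions using (Injective)
open import Relation.Binary.Core using (Rel)
open import Relation.Binary.Definitions using (Decidable; Symmetric)
open import Relation.Binary.Construct.Closure.ReflexiveTransitive using (Star)
open import Relation.Binary.PropositionalEquality.Core using (_≡_; _≢_)
open import Relation.Nullary using (¬_; does; _×-dec_)
open import Relation.Unary using (Pred)

------------------------------------------------------------------------
-- Graphs

record SimpleGraph (n : ℕ) : Set₁ where
  infix 4 _~_ _~?_
  field
    _~_      : Rel (Fin n) 0ℓ
    _~?_     : Decidable _~_
    ~-sym    : Symmetric _~_
    ~-irrefl : ∀ {v} → ¬ (v ~ v)

module _ {n : ℕ} (G : SimpleGraph n) where
  open SimpleGraph G

  Connected : Set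
  Connected = ∀ u v → Star _~_ u v

  record Cycle : Set where
    field
      {k}      : ℕ
      at       : Fin (3 + k) → Fin n
      distinct : Injective _≡_ _≡_ at
      step     : ∀ (i : Fin (2 + k)) → at (inject₁ i) ~ at (suc i)
      close    : at (fromℕ (2 + k)) ~ at zero

  edgeCount : ℕ
  edgeCount =
    length (filter (λ (u , v) → (u Fin.<? v) ×-dec (u ~? v))
                   (cartesianProduct (allFin n) (allFin n)))

record Graph : Set₁ where
  field
    n         : ℕ
    graph     : SimpleGraph n
    connected : Connected graph

  m : ℕ
  m = edgeCount graph

  Vertex : Set
  Vertex = Fin n

  open SimpleGraph graph public

-- Since the vertex set is shared, a spanning tree is determined by its edges.
record SpanningTree (G : Graph) : Set₁ where
  open Graph G using (n; _~_)
  field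
    tree      : SimpleGraph n
    ⊆G        : ∀ {u v} → SimpleGraph._~_ tree u v → u ~ v
    connected : Connected tree
    acyclic   : ¬ Cycle tree

  open SimpleGraph tree public using () renaming (_~_ to _~ₜ_)

------------------------------------------------------------------------
-- Vertex orders, LexDFS and ℒ-trees

-- σ ⟨$⟩ʳ i is the vertex at position i, and σ ⟨$⟩ˡ v is the position of v.
-- Positions are counted from 0.
Order : Graph → Set
Order G = Permutation′ (Graph.n G)

BeginsWith : (G : Graph) → Order G → Graph.Vertex G → Set
BeginsWith G σ s = toℕ (σ ⟨$⟩ˡ s) ≡ 0

Label : Set
Label = List ℕ

-- A proper prefix of a label is smaller than the label.
infix 4 _≤ₗₑₓ_
_≤ₗₑₓ_ : Rel Label 0ℓ
_≤ₗₑₓ_ = Lex-≤ _≡_ ℕ._<_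

module _ (G : Graph) where
  open Graph G

  initialLabel : Vertex → Vertex → Label
  initialLabel s v = if does (v Fin.≟ s) then 0 ∷ [] else []

  -- A run of LexDFS from s with output σ.  Here label i is the labelling
  -- after i rounds; position i is filled in round i + 1, which is therefore
  -- the number prepended.  A vertex u is unnumbered at the start of that round
  -- iff i ≤ σ ⟨$⟩ˡ u, and still unnumbered after the choice iff i < σ ⟨$⟩ˡ u.
  record LexDFSRun (s : Vertex) (σ : Order G) : Set where
    field
      label  : Fin (suc n) → Vertex → Label
      init   : ∀ v → label zero v ≡ initialLabel s v
      choose : ∀ (i : Fin n) u → i Fin.≤ σ ⟨$⟩ˡ u →
               label (inject₁ i) u ≤ₗₑₓ label (inject₁ i) (σ ⟨$⟩ʳ i)
      update : ∀ (i : Fin n) v →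
               label (suc i) v ≡
               (if does ((i Fin.<? σ ⟨$⟩ˡ v) ×-dec (σ ⟨$⟩ʳ i ~? v))
                then suc (toℕ i) ∷ label (inject₁ i) v
                else label (inject₁ i) v)

  IsLexDFSOrder : Vertex → Order G → Set
  IsLexDFSOrder = LexDFSRun

  RightmostEarlierNeighbour : Order G → Vertex → Vertex → Set
  RightmostEarlierNeighbour σ v w =
    w ~ v × pos w Fin.< pos v ×
    (∀ u → u ~ v → pos u Fin.< pos v → pos u Fin.≤ pos w)
    where
    pos : Vertex → Fin n
    pos = σ ⟨$⟩ˡ_

  IsLTree : Order G → Vertex → SpanningTree G → Set
  IsLTree σ s T =
    BeginsWith G σ s ×
    (∀ u v → u ~ₜ v ⇔
      (RightmostEarlierNeighbour σ u v ⊎ RightmostEarlierNeighbour σ v u))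
    where open SpanningTree T

  IsLTreeOfLexDFS : Vertex → SpanningTree G → Set
  IsLTreeOfLexDFS s T = ∃[ σ ] (IsLexDFSOrder s σ × IsLTree σ s T)

------------------------------------------------------------------------
-- Machine model: the unit-cost RAM with addition and truncated subtraction,
-- presented as structured programs over natural-number registers and
-- arrays.  A program mentions only finitely many names and its expressions
-- have bounded size, so charging 1 per assignment and per test agrees with
-- counting single RAM instructions up to a constant factor.

Name : Set
Name = ℕ

infixl 6 _⊕_ _⊖_
data Exp : Set where
  lit     : ℕ → Exp
  var     : Name → Exp
  read    : Name → Exp → Exp
  _⊕_ _⊖_ : Exp → Exp → Exp

infixr 4 _⨾_
data Program : Set where
  skip      : Program
  assign    : Name → Exp → Program
  write     : Name → Exp → Exp → Program
  _⨾_       : Program → Program → Program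
  ifNonZero : Exp → Program → Program → Program
  while     : Exp → Program → Program

record State : Set where
  constructor mkState
  field
    vars   : Name → ℕ
    arrays : Name → ℕ → ℕ

open State

_[_↦_] : ∀ {a} {A : Set a} → (ℕ → A) → ℕ → A → (ℕ → A)
(f [ k ↦ x ]) j = if does (j ℕ.≟ k) then x else f j

⟦_⟧ : Exp → State → ℕ
⟦ lit k ⟧    st = k
⟦ var x ⟧    st = vars st x
⟦ read a e ⟧ st = arrays st a (⟦ e ⟧ st)
⟦ e ⊕ e′ ⟧   st = ⟦ e ⟧ st + ⟦ e′ ⟧ st
⟦ e ⊖ e′ ⟧   st = ⟦ e ⟧ st ∸ ⟦ e′ ⟧ st

setVar : Name → ℕ → State → State
setVar x k st = mkState (vars st [ x ↦ k ]) (arrays st)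

setCell : Name → ℕ → ℕ → State → State
setCell a i k st = mkState (vars st) (arrays st [ a ↦ arrays st a [ i ↦ k ] ])

-- p ∣ st ⇓ st′ ∣ t : started in st, p halts in st′ after t steps.
infix 3 _∣_⇓_∣_
data _∣_⇓_∣_ : Program → State → State → ℕ → Set where
  ⇓skip   : ∀ {st} → skip ∣ st ⇓ st ∣ 0
  ⇓assign : ∀ {x e st} → assign x e ∣ st ⇓ setVar x (⟦ e ⟧ st) st ∣ 1
  ⇓write  : ∀ {a e e′ st} →
            write a e e′ ∣ st ⇓ setCell a (⟦ e ⟧ st) (⟦ e′ ⟧ st) st ∣ 1
  ⇓seq    : ∀ {p q st st′ st″ t t′} →
            p ∣ st ⇓ st′ ∣ t → q ∣ st′ ⇓ st″ ∣ t′ → p ⨾ q ∣ st ⇓ st″ ∣ t + t′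
  ⇓then   : ∀ {e p q st st′ t} → ⟦ e ⟧ st ≢ 0 →
            p ∣ st ⇓ st′ ∣ t → ifNonZero e p q ∣ st ⇓ st′ ∣ suc t
  ⇓else   : ∀ {e p q st st′ t} → ⟦ e ⟧ st ≡ 0 →
            q ∣ st ⇓ st′ ∣ t → ifNonZero e p q ∣ st ⇓ st′ ∣ suc t
  ⇓loop   : ∀ {e p st st′ st″ t t′} → ⟦ e ⟧ st ≢ 0 →
            p ∣ st ⇓ st′ ∣ t → while e p ∣ st′ ⇓ st″ ∣ t′ →
            while e p ∣ st ⇓ st″ ∣ suc (t + t′)
  ⇓exit   : ∀ {e p st} → ⟦ e ⟧ st ≡ 0 → while e p ∣ st ⇓ st ∣ 1

-- The answer is left in register 2.
DecidesWithin : Program → State → ℕ → Set → Set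
DecidesWithin p st b P =
  ∃[ st′ ] ∃[ t ] (p ∣ st ⇓ st′ ∣ t × t ℕ.≤ b × (vars st′ 2 ≡ 1 ⇔ P))

------------------------------------------------------------------------
-- Inputs

-- Neighbours may be listed in any order.
record AdjacencyLists (G : Graph) : Set where
  open Graph G
  field
    neighbours : Vertex → List Vertex
    unique     : ∀ v → Unique (neighbours v)
    complete   : ∀ u v → v ∈ neighbours u ⇔ u ~ v

contents : List ℕ → ℕ → ℕ
contents []       _       = 0
contents (x ∷ xs) zero    = x
contents (x ∷ xs) (suc i) = contents xs i

-- Registers 0 and 1 hold n and s.  The adjacency lists are stored one after
-- another in array 1, and entry v of array 0 is the index at which the list of
-- v starts (entry n is the total length).  Array 2 holds the vertex order or
-- the tree.  All remaining memory is zero.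
inputState : (G : Graph) → AdjacencyLists G → Graph.Vertex G → List ℕ → State
inputState G adj s xs = mkState
  ((((λ _ → 0) [ 0 ↦ n ]) [ 1 ↦ toℕ s ]))
  ((((λ _ _ → 0) [ 0 ↦ contents offsets ]) [ 1 ↦ contents targets ])
                 [ 2 ↦ contents xs ])
  where
  open Graph G
  open AdjacencyLists adj

  lists : List (List Vertex)
  lists = map neighbours (allFin n)

  offsets : List ℕ
  offsets = map (λ i → sum (take i (map length lists))) (upTo (suc n))

  targets : List ℕ
  targets = map toℕ (concat lists)

orderInput : (G : Graph) → AdjacencyLists G → Graph.Vertex G → Order G → State
orderInput G adj s σ =
  inputState G adj s (tabulate (λ i → toℕ (σ ⟨$⟩ʳ i)))

-- A rooted spanning tree is given by its parent pointers, the root pointing to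
-- itself.  Orienting the n − 1 edges of a tree so that every vertex other
-- than s has exactly one outgoing edge forces all edges to point towards s.
record ParentArray (G : Graph) (s : Graph.Vertex G) (T : SpanningTree G) : Set where
  open Graph G using (Vertex)
  open SpanningTree T using (_~ₜ_)
  field
    parent : Vertex → Vertex
    root   : parent s ≡ s
    edges  : ∀ u v → u ~ₜ v ⇔ ((u ≢ s × parent u ≡ v) ⊎ (v ≢ s × parent v ≡ u))

treeInput : (G : Graph) → AdjacencyLists G → (s : Graph.Vertex G) →
            (T : SpanningTree G) → ParentArray G s T → State
treeInput G adj s T par =
  inputState G adj s (tabulate (λ v → toℕ (ParentArray.parent par v)))

------------------------------------------------------------------------
-- Running times

GraphFamily : (ℓ : Level) → Set (lsuc 0ℓ Level.⊔ lsuc ℓ)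
GraphFamily ℓ = Pred Graph ℓ

-- f ∈O[ 𝒢 ] g : as functions of the input size (n , m), where only the sizes
-- of members of 𝒢 matter.
_∈O[_]_ : ∀ {ℓ} → (ℕ → ℕ → ℕ) → GraphFamily ℓ → (ℕ → ℕ → ℕ) → Set (lsuc 0ℓ Level.⊔ ℓ)
f ∈O[ 𝒢 ] g =
  ∃[ c ] ∃[ N ] (∀ G → 𝒢 G → let open Graph G in
    N ℕ.≤ n + m → f n m ℕ.≤ c * g n m)

LexDFSOrderDecidableInTime :
  ∀ {ℓ} → GraphFamily ℓ → (ℕ → ℕ → ℕ) → Set (lsuc 0ℓ Level.⊔ ℓ)
LexDFSOrderDecidableInTime 𝒢 M =
  ∃[ p ] ∃[ time ] (time ∈O[ 𝒢 ] M ×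
    (∀ G → 𝒢 G → (adj : AdjacencyLists G) →
     ∀ s (σ : Order G) → BeginsWith G σ s →
     DecidesWithin p (orderInput G adj s σ) (time (Graph.n G) (Graph.m G))
       (IsLexDFSOrder G s σ)))

LexDFSTreeDecidableInTime :
  ∀ {ℓ} → GraphFamily ℓ → (ℕ → ℕ → ℕ) → Set (lsuc 0ℓ Level.⊔ ℓ)
LexDFSTreeDecidableInTime 𝒢 M =
  ∃[ p ] ∃[ time ] (time ∈O[ 𝒢 ] M ×
    (∀ G → 𝒢 G → (adj : AdjacencyLists G) →
     ∀ s (T : SpanningTree G) (par : ParentArray G s T) →
     DecidesWithin p (treeInput G adj s T par) (time (Graph.n G) (Graph.m G))
       (IsLTreeOfLexDFS G s T)))

{-# OPTIONS --safe #-}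

-- An order is a LexDFS order iff for all a < b < c with a ~ c and a ≁ b some d between a and b has d ~ b and
-- d ≁ c.  From this one reads off which orders are LexDFS orders with ℒ-tree T, once there is one at all:
-- all edges of the graph then join ancestors and descendants in T, and the orders in question are the
-- preorders of T in which siblings are sorted decreasingly by the sets of their neighbours among their
-- ancestors, these sets being compared lexicographically with the deepest ancestor first.
--
-- Sorting the siblings takes linear time by partition refinement: the vertices act as pivots, from the
-- last to the first in any order in which parents precede children, and each pivot moves its later
-- neighbours from their classes to fresh classes placed directly behind these.  Sorted in this way, the
-- parents still come before their children, so that inserting every vertex directly behind its parent
-- builds the preorder.  To recognize a tree, compute the sorted preorder, compare its ℒ-tree with the given
-- tree and test the order.  To recognize an order, compute its ℒ-tree, test this tree, and compare the
-- given order with the sorted preorder in which ties are resolved by the given order.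

module Submission where

open import Defs
open State
open import Data.Bool.Base using (Bool; true; false; _∧_; _∨_; if_then_else_)
import Data.Bool.Properties as Bool
open import Data.Empty using (⊥)
open import Data.Fin.Base as Fin using (Fin; zero; suc; toℕ; fromℕ; fromℕ<; inject₁)
open import Data.Fin.Induction using (<-weakInduction)
open import Data.Fin.Permutation using (permutation; _⟨$⟩ʳ_; _⟨$⟩ˡ_; inverseʳ; inverseˡ)
import Data.Fin.Properties as Fin
open import Data.Fin.Relation.Unary.Top using (view; ‵fromℕ; ‵inject₁)
open import Data.List.Base
  using (List; []; _∷_; _++_; length; map; concat; take; filter; allFin; tabulate; applyUpTo; cartesianProduct)
open import Data.List.Membership.Propositional using (_∈_)
open import Data.List.Membership.Propositional.Properties
  using (∈-∃++; ∈-map⁺; ∈-map⁻; ∈-filter⁺; ∈-filter⁻; ∈-cartesianProduct⁺; ∈-allFin; ∈-++⁺ˡ; ∈-++⁺ʳ; ∈-++⁻)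
import Data.List.Properties as List
import Data.List.Relation.Binary.Lex.Core as Lex
import Data.List.Relation.Unary.All as All
open import Data.List.Relation.Unary.AllPairs using ([]; _∷_)
open import Data.List.Relation.Unary.Any using (here; there)
open import Data.List.Relation.Unary.Unique.Propositional using (Unique)
import Data.List.Relation.Unary.Unique.Propositional.Properties as Unique
open import Data.Nat.Base using (ℕ; zero; suc; _+_; _*_; _∸_; _⊔_; _≤_; _<_; z≤n; s≤s)
open import Data.Nat.Induction using (<-wellFounded)
open import Data.Nat.ListAction using (sum)
import Data.Nat.Properties as ℕ
open import Data.Nat.Tactic.RingSolver using (solve-∀)
open import Data.Product.Base using (∃-syntax; _×_; _,_; proj₁; proj₂; swap)
open import Data.Sum.Base using (_⊎_; inj₁; inj₂; [_,_]′)
open import Data.Unit.Base using (tt)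
open import Function.Base using (_∘_; _$_; id)
open import Function.Bundles using (_⇔_; mk⇔; Equivalence)
open import Function.Definitions using (Injective)
open import Induction.WellFounded using (Acc; acc)
open import Level using (Level)
import Relation.Binary.Construct.Closure.ReflexiveTransitive as Star
open Star using (Star; ε; _◅_; _◅◅_)
open import Relation.Binary.Definitions using (Decidable; DecidableEquality; Symmetric; tri<; tri≈; tri>)
open import Relation.Binary.PropositionalEquality
open import Relation.Nullary using (¬_; Dec; does; yes; no; contradiction; ¬?; _×-dec_; _⊎-dec_)
open import Relation.Nullary.Decidable using (dec-true; dec-false)

-- Graph search trees

-- The given tree need not belong to any LexDFS order, and in that case nothing is claimed about the
-- result of the sort. The sort runs as soon as every parent is the latest earlier neighbour in the
-- order supplying the pivots, and the algorithm assumed to exist has the last word: an accepted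
-- order whose ℒ-tree is the given tree is itself a witness, and a rejected tree rules out the order
-- from which it was computed. Any pivot order with parents before children serves, because once a
-- LexDFS order exists, the earlier neighbours of siblings are common ancestors, and these lie on
-- one path, where all such orders agree. The keys of the classes are binary numbers with one digit
-- per pivot, far too large to be computed with in good conscience. They live in invariants only:
-- the programs know a class by its place in a linked list. Emptied classes are never removed, since
-- each scanned arc creates at most one class and the list stays linear anyway.

module Search
  {V : Set} (_≟_ : DecidableEquality V)
  {E : V → V → Set} (E? : Decidable E) (E-sym : Symmetric E)
  (root : V) (par : V → V) where

  infix 4 _⊑_
  -- The ancestor relation. Climbing stops at `root`, so the value of `par root` has no influence on
  -- it.
  data _⊑_ (a : V) : V → Set where
    here : a ⊑ a
    up   : ∀ {b} → b ≢ root → a ⊑ par b → a ⊑ b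

  ⊑-trans : ∀ {a b c} → a ⊑ b → b ⊑ c → a ⊑ c
  ⊑-trans p here     = p
  ⊑-trans p (up n q) = up n (⊑-trans p q)

  ⊑-chain : ∀ {a b c} → a ⊑ c → b ⊑ c → a ⊑ b ⊎ b ⊑ a
  ⊑-chain here     q        = inj₂ q
  ⊑-chain (up n p) here     = inj₁ (up n p)
  ⊑-chain (up n p) (up _ q) = ⊑-chain p q

  ⊑-proper : ∀ {a b} → a ⊑ b → a ≢ b → b ≢ root × a ⊑ par b
  ⊑-proper here     a≢b = contradiction refl a≢b
  ⊑-proper (up n p) _   = n , p

  ⊑-child : ∀ {a b} → a ⊑ b → a ≡ b ⊎ ∃[ d ] (d ≢ root × par d ≡ a × d ⊑ b)
  ⊑-child here = inj₁ refl
  ⊑-child (up {b} n p) with ⊑-child p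
  ... | inj₁ a≡pb          = inj₂ (b , n , sym a≡pb , here)
  ... | inj₂ (d , m , e , q) = inj₂ (d , m , e , up n q)

  record Diverging (b c : V) : Set where
    field
      {b′ c′} : V
      b′≢root : b′ ≢ root
      c′≢root : c′ ≢ root
      same    : par b′ ≡ par c′
      b′≢c′   : b′ ≢ c′
      b′⊑b    : b′ ⊑ b
      c′⊑c    : c′ ⊑ c

  -- Induction along the path to `c`. If `par c` lies above `b`, then the child of `par c` on the
  -- way to `b` is either `c` itself or the sibling at which the two paths part.
  compare-tree : ∀ {b c} → root ⊑ b → root ⊑ c → b ⊑ c ⊎ c ⊑ b ⊎ Diverging b c
  compare-tree p here = inj₂ (inj₁ p)
  compare-tree {b} p (up {c} n q) with compare-tree p q
  ... | inj₁ b⊑pc = inj₁ (up n b⊑pc)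
  ... | inj₂ (inj₂ d) = inj₂ (inj₂ record { Diverging d ; c′⊑c = up n (Diverging.c′⊑c d) })
  ... | inj₂ (inj₁ pc⊑b) with ⊑-child pc⊑b
  ...   | inj₁ refl = inj₁ (up n here)
  ...   | inj₂ (b′ , m , e , b′⊑b) with b′ ≟ c
  ...     | yes refl = inj₂ (inj₁ b′⊑b)
  ...     | no b′≢c  = inj₂ (inj₂ record
    { b′≢root = m ; c′≢root = n ; same = e ; b′≢c′ = b′≢c ; b′⊑b = b′⊑b ; c′⊑c = here })

  Rightmost : (V → ℕ) → V → V → Set
  Rightmost r v w = E w v × r w < r v × (∀ u → E u v → r u < r v → r u ≤ r w)

  LTree : (V → ℕ) → Set
  LTree r = ∀ v → v ≢ root → Rightmost r v (par v)

  FourPoint : (V → ℕ) → Set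
  FourPoint r = ∀ a b c → r a < r b → r b < r c → E a c → ¬ E a b →
    ∃[ d ] (r a < r d × r d < r b × E d b × ¬ E d c)

  record Topological (r : V → ℕ) : Set where
    field
      injective : Injective _≡_ _≡_ r
      parent<   : ∀ v → v ≢ root → r (par v) < r v

    ⊑⇒≤ : ∀ {a b} → a ⊑ b → r a ≤ r b
    ⊑⇒≤ here       = ℕ.≤-refl
    ⊑⇒≤ (up {b} n p) = ℕ.≤-trans (⊑⇒≤ p) (ℕ.<⇒≤ (parent< b n))

    ⊑⇒< : ∀ {a b} → a ⊑ b → a ≢ b → r a < r b
    ⊑⇒< p a≢b = ℕ.≤∧≢⇒< (⊑⇒≤ p) (λ e → a≢b (injective e))

    ⊏-of-< : ∀ {a b} → a ⊑ b ⊎ b ⊑ a → r a < r b → a ⊑ b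
    ⊏-of-< (inj₁ p) _ = p
    ⊏-of-< (inj₂ p) l = contradiction (⊑⇒≤ p) (ℕ.<⇒≱ l)

    <⇒≢ : ∀ {a b} → r a < r b → a ≢ b
    <⇒≢ l refl = ℕ.<-irrefl refl l

    root⊑ : ∀ v → root ⊑ v
    root⊑ v = go v (<-wellFounded (r v))
      where
      go : ∀ v → Acc _<_ (r v) → root ⊑ v
      go v (acc rec) with v ≟ root
      ... | yes refl = here
      ... | no n     = up n (go (par v) (rec (parent< v n)))

    siblings-incomparable : ∀ {b c} → b ≢ root → c ≢ root → par b ≡ par c → b ≢ c → ¬ b ⊑ c
    siblings-incomparable {b} {c} m n e b≢c p =
      ℕ.<⇒≱ (parent< b m) (subst (λ w → r b ≤ r w) (sym e) (⊑⇒≤ (proj₂ (⊑-proper p b≢c))))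

    diverging-incomparable : ∀ {b c} → Diverging b c → ¬ b ⊑ c × ¬ c ⊑ b
    diverging-incomparable d = (λ p → no-common (⊑-trans b′⊑b p) c′⊑c) , (λ p → no-common b′⊑b (⊑-trans c′⊑c p))
      where
      open Diverging d
      no-common : ∀ {x} → b′ ⊑ x → ¬ c′ ⊑ x
      no-common p q with ⊑-chain p q
      ... | inj₁ l = siblings-incomparable b′≢root c′≢root same b′≢c′ l
      ... | inj₂ l = siblings-incomparable c′≢root b′≢root (sym same) (λ e → b′≢c′ (sym e)) l

  -- Together with Topological this says that r is a preorder of the tree.
  Nested : (V → ℕ) → Set
  Nested r = ∀ x y → x ≢ root → y ≢ root → r (par x) < r y → r y < r x → r (par x) ≤ r (par y)

  module Interval {r} (top : Topological r) (nested : Nested r) where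
    open Topological top

    -- By nestedness the climb from `y` cannot jump over `par x`, so it stays between `par x` and
    -- `x` until it hits `par x`.
    below-parent : ∀ {x y} → x ≢ root → r (par x) ≤ r y → r y < r x → par x ⊑ y
    below-parent {x} n l l′ = go _ (<-wellFounded _) l l′
      where
      go : ∀ y → Acc _<_ (r y) → r (par x) ≤ r y → r y < r x → par x ⊑ y
      go y (acc rec) l l′ with par x ≟ y
      ... | yes refl = here
      ... | no px≢y  = up y≢root
            (go (par y) (rec (parent< y y≢root)) (nested x y n y≢root px<y l′)
                (ℕ.<-trans (parent< y y≢root) l′))
        where
        px<y : r (par x) < r y
        px<y = ℕ.≤∧≢⇒< l (λ e → px≢y (injective e))
        y≢root : y ≢ root
        y≢root refl = ℕ.<⇒≱ px<y (⊑⇒≤ (root⊑ (par x)))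

    -- In a preorder every subtree is an interval: on the climb from `c` some step passes from a
    -- vertex at or after `b` to a parent at or before `b`, and `below-parent` puts `b` below that
    -- parent.
    interval : ∀ {a b c} → a ⊑ c → r a ≤ r b → r b ≤ r c → a ⊑ b
    interval {b = b} here l l′ = subst (_⊑ b) (injective (ℕ.≤-antisym l′ l)) here
    interval {b = b} (up {c} n p) l l′ with ℕ.≤-total (r b) (r (par c))
    ... | inj₁ b≤pc = interval p l b≤pc
    ... | inj₂ pc≤b with b ≟ c
    ...   | yes refl = up n p
    ...   | no b≢c   = ⊑-trans p (below-parent n pc≤b (ℕ.≤∧≢⇒< l′ (λ e → b≢c (injective e))))

    -- Otherwise `b` would lie between `c′` and its descendant `c`, hence in the subtree of `c′`.
    diverging-< : ∀ {b c} (d : Diverging b c) → let open Diverging d in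
                  r b < r c → r b < r c′
    diverging-< d b<c = ℕ.≰⇒> λ c′≤b → proj₁ (diverging-incomparable d′) (interval c′⊑c c′≤b (ℕ.<⇒≤ b<c))
      where
      open Diverging d
      d′ : Diverging c′ _
      d′ = record { b′≢root = c′≢root ; c′≢root = b′≢root ; same = sym same ; b′≢c′ = λ e → b′≢c′ (sym e)
                  ; b′⊑b = here ; c′⊑c = b′⊑b }

    diverging-siblings : ∀ {b c} (d : Diverging b c) → let open Diverging d in
                         r b′ < r c′ → r b < r c
    diverging-siblings d l = ℕ.≰⇒> λ c≤b → proj₂ (diverging-incomparable d″)
      (interval b′⊑b (ℕ.<⇒≤ (ℕ.<-≤-trans l (⊑⇒≤ c′⊑c))) c≤b)
      where
      open Diverging d
      d″ : Diverging _ b′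
      d″ = record { b′≢root = c′≢root ; c′≢root = b′≢root ; same = sym same ; b′≢c′ = λ e → b′≢c′ (sym e)
                  ; b′⊑b = c′⊑c ; c′⊑c = here }

  -- The neighbours of c that precede c in ρ are lexicographically at least those of d.
  Dominates : (V → ℕ) → V → V → Set
  Dominates ρ c d = ∀ a → E a d → ρ a < ρ d → ¬ E a c →
    ∃[ e ] (E e c × ρ e < ρ c × ¬ E e d × ρ a < ρ e)

  Sorted : (V → ℕ) → (V → ℕ) → Set
  Sorted ρ r = ∀ c d → c ≢ root → d ≢ root → par c ≡ par d → r c < r d → Dominates ρ c d

  -- By the four-point condition, a vertex without earlier neighbours would separate the vertices
  -- before it from the others.
  earlier-neighbour : ∀ {r} → Injective _≡_ _≡_ r → FourPoint r → ∀ {b} → Star E root b → r root < r b →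
                      ¬ (∀ d → E d b → ¬ r d < r b)
  earlier-neighbour {r} inj four {b} path root<b isolated = ℕ.<-irrefl refl (stays-before path root<b)
    where
    stays-before : ∀ {u v} → Star E u v → r u < r b → r v < r b
    stays-before ε u<b = u<b
    stays-before (_◅_ {i = u} {j = w} u~w rest) u<b with ℕ.<-cmp (r w) (r b)
    ... | tri< w<b _ _ = stays-before rest w<b
    ... | tri≈ _ e _ = contradiction u<b (isolated u (subst (E u) (inj e) u~w))
    ... | tri> _ _ b<w with four u b w u<b b<w u~w (λ u~b → isolated u u~b u<b)
    ...   | d , _ , d<b , d~b , _ = contradiction d<b (isolated d d~b)

  LTree⇒Topological : ∀ {r} → Injective _≡_ _≡_ r → LTree r → Topological r
  LTree⇒Topological inj lt = record { injective = inj ; parent< = λ v n → proj₁ (proj₂ (lt v n)) }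

  module LexDFS {t} (inj : Injective _≡_ _≡_ t) (lt : LTree t) (root-first : ∀ v → t root ≤ t v) (four : FourPoint t) where
    t-top : Topological t
    t-top = LTree⇒Topological inj lt
    open Topological t-top using ()
      renaming (⊑⇒≤ to t-≤; ⊑⇒< to t-<; ⊏-of-< to t-⊏; <⇒≢ to t-≢)

    private
      not-root : ∀ {a b} → t a < t b → b ≢ root
      not-root {a} l refl = ℕ.<⇒≱ l (root-first a)

    -- If `a` is not adjacent to `b`, the four-point condition supplies a neighbour of `b` behind
    -- `a`; either way the latest earlier neighbour of `b` is not before `a`. Hence climbing from
    -- `b` never passes `a`, which makes `t` a preorder of the tree and makes every edge join an
    -- ancestor to a descendant.
    rightmost≥ : ∀ {a b c} → t a < t b → t b ≤ t c → E a c → t a ≤ t (par b)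
    rightmost≥ {a} {b} {c} a<b b≤c a~c with E? a b
    ... | yes a~b = proj₂ (proj₂ (lt b (not-root a<b))) a a~b a<b
    ... | no a≁b with ℕ.m≤n⇒m<n∨m≡n b≤c
    ...   | inj₂ b≡c = contradiction (subst (E a) (sym (inj b≡c)) a~c) a≁b
    ...   | inj₁ b<c with four a b c a<b b<c a~c a≁b
    ...     | d , a<d , d<b , d~b , _ =
              ℕ.≤-trans (ℕ.<⇒≤ a<d) (proj₂ (proj₂ (lt b (not-root a<b))) d d~b d<b)

    nested : Nested t
    nested x y n _ px<y y<x = rightmost≥ px<y (ℕ.<⇒≤ y<x) (proj₁ (lt x n))

    private
      ancestor : ∀ {a b c} → Acc _<_ (t b) → t a ≤ t b → t b ≤ t c → E a c → a ⊑ b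
      ancestor {a} {b} (acc rec) a≤b b≤c a~c with ℕ.m≤n⇒m<n∨m≡n a≤b
      ... | inj₂ a≡b = subst (a ⊑_) (inj a≡b) here
      ... | inj₁ a<b = up (not-root a<b) (ancestor (rec pb<b) (rightmost≥ a<b b≤c a~c)
                          (ℕ.≤-trans (ℕ.<⇒≤ pb<b) b≤c) a~c)
        where
        pb<b : t (par b) < t b
        pb<b = proj₁ (proj₂ (lt b (not-root a<b)))

    edge-comparable : ∀ {a c} → E a c → a ⊑ c ⊎ c ⊑ a
    edge-comparable {a} {c} a~c with ℕ.≤-total (t a) (t c)
    ... | inj₁ l = inj₁ (ancestor (<-wellFounded _) l ℕ.≤-refl a~c)
    ... | inj₂ l = inj₂ (ancestor (<-wellFounded _) l ℕ.≤-refl (E-sym a~c))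

    -- On a path of the tree all topological orders agree with `t`, so this form of the four-point
    -- condition can be carried over to other orders. The vertex `d` lies on the path because it is
    -- adjacent to `b`, hence comparable with it.
    four-on-path : ∀ {a b c} → a ⊑ b → a ≢ b → b ⊑ c → b ≢ c → E a c → ¬ E a b →
                   ∃[ d ] (a ⊑ d × a ≢ d × d ⊑ b × d ≢ b × E d b × ¬ E d c)
    four-on-path {a} {b} {c} a⊑b a≢b b⊑c b≢c a~c a≁b
      with four a b c (t-< a⊑b a≢b) (t-< b⊑c b≢c) a~c a≁b
    ... | d , a<d , d<b , d~b , d≁c =
      d , t-⊏ (⊑-chain a⊑b d⊑b) a<d , t-≢ a<d , d⊑b , t-≢ d<b , d~b , d≁c
      where
      d⊑b : d ⊑ b
      d⊑b = t-⊏ (edge-comparable d~b) d<b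

    -- The earlier neighbours of `d` are not behind its parent, which is also the parent of `c`; so
    -- they precede `c`, and the four-point condition for `a`, `c`, `d` is what domination asks for.
    siblings-dominate : ∀ {c d} → c ≢ root → d ≢ root → par c ≡ par d → t c < t d → Dominates t c d
    siblings-dominate {c} {d} m n e c<d a a~d a<d a≁c
      with four a c d a<c c<d a~d a≁c
      where
      a≤pd : t a ≤ t (par d)
      a≤pd = proj₂ (proj₂ (lt d n)) a a~d a<d
      a<c : t a < t c
      a<c = ℕ.≤-<-trans a≤pd (subst (λ w → t w < t c) e (proj₁ (proj₂ (lt c m))))
    ... | f , a<f , f<c , f~c , f≁d = f , f~c , f<c , f≁d , a<f

    -- Neighbours are comparable in the tree. In every topological order the earlier ones are
    -- therefore ancestors of `v`, and the parent is the last of these. This is why a tree that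
    -- fails the comparison for a single topological order can be rejected.
    topological⇒LTree : ∀ {q} → Topological q → LTree q
    topological⇒LTree {q} top v n = proj₁ (lt v n) , parent< v n , max
      where
      open Topological top
      max : ∀ u → E u v → q u < q v → q u ≤ q (par v)
      max u u~v u<v = ⊑⇒≤ (proj₂ (⊑-proper (⊏-of-< (edge-comparable u~v) u<v) (<⇒≢ u<v)))

    -- Here `ρ` is the order that supplied the pivots and `q` the sorted preorder.
    module _ {ρ q} (ρ-top : Topological ρ) (q-top : Topological q) (q-nested : Nested q) (q-sorted : Sorted ρ q) where
      open Interval q-top q-nested using (interval; diverging-<)
      open Topological q-top using (root⊑; ⊏-of-<; ⊑⇒<; ⊑⇒≤; <⇒≢; siblings-incomparable; diverging-incomparable)
      open Topological ρ-top using ()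
        renaming (⊑⇒≤ to ρ-≤; ⊑⇒< to ρ-<; ⊏-of-< to ρ-⊏; <⇒≢ to ρ-≢)

      -- Transitivity of the lexicographic comparison along b ≥ c′ ≥ c: alternately
      -- apply domination of c′ by b and the four-point condition on the path from c′
      -- to c, each time moving strictly down the path to b.
      private
        branch : ∀ {b c c′} → Dominates ρ b c′ → par b ≡ par c′ → b ≢ root → c′ ≢ root → c′ ⊑ c →
                 ∀ a → a ⊑ par b → E a c → ¬ E a b →
                 ∃[ d ] (a ⊑ d × a ≢ d × d ⊑ par b × E d b × ¬ E d c)
        branch {b} {c} {c′} dom same b≢r c′≢r c′⊑c = start
          where
          Goal : V → Set
          Goal a = ∃[ d ] (a ⊑ d × a ≢ d × d ⊑ par b × E d b × ¬ E d c)

          extend : ∀ {a e} → a ⊑ e → a ≢ e → Goal e → Goal a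
          extend a⊑e a≢e (d , e⊑d , e≢d , rest) =
            d , ⊑-trans a⊑e e⊑d , ρ-≢ (ℕ.≤-<-trans (ρ-≤ a⊑e) (ρ-< e⊑d e≢d)) , rest

          ≢c′ : ∀ {a} → a ⊑ par b → a ≢ c′
          ≢c′ {a} p refl = ℕ.<⇒≱ (Topological.parent< q-top c′ c′≢r) (subst (λ w → q c′ ≤ q w) same (⊑⇒≤ p))

          nearer : ∀ {a e} → a ⊑ e → a ≢ e → e ⊑ par b → ρ b ∸ ρ e < ρ b ∸ ρ a
          nearer a⊑e a≢e e⊑pb = ℕ.∸-monoʳ-< (ρ-< a⊑e a≢e) (ρ-≤ (up b≢r e⊑pb))

          onPath : ∀ {a} → a ⊑ par b → E a c → ¬ E a c′ →
                   Goal a ⊎ ∃[ f ] (a ⊑ f × a ≢ f × f ⊑ par b × E f c′ × ¬ E f b)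
          onPath {a} a⊑pb a~c a≁c′
            with four-on-path (up c′≢r (subst (a ⊑_) same a⊑pb)) (≢c′ a⊑pb) c′⊑c c′≢c a~c a≁c′
            where
            c′≢c : c′ ≢ c
            c′≢c refl = a≁c′ a~c
          ... | f , a⊑f , a≢f , f⊑c′ , f≢c′ , f~c′ , f≁c
            with subst (f ⊑_) (sym same) (proj₂ (⊑-proper f⊑c′ f≢c′)) | E? f b
          ...   | f⊑pb | yes f~b = inj₁ (f , a⊑f , a≢f , f⊑pb , f~b , f≁c)
          ...   | f⊑pb | no f≁b  = inj₂ (f , a⊑f , a≢f , f⊑pb , f~c′ , f≁b)

          go : ∀ a → Acc _<_ (ρ b ∸ ρ a) → a ⊑ par b → E a c′ → ¬ E a b → Goal a
          go a (acc rec) a⊑pb a~c′ a≁b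
            with dom a a~c′ (ρ-< (up c′≢r (subst (a ⊑_) same a⊑pb)) (≢c′ a⊑pb)) a≁b
          ... | e , e~b , e<b , e≁c′ , a<e = continue (E? e c)
            where
            e⊑pb : e ⊑ par b
            e⊑pb = proj₂ (⊑-proper (ρ-⊏ (edge-comparable e~b) e<b) (ρ-≢ e<b))
            a⊑e : a ⊑ e
            a⊑e = ρ-⊏ (⊑-chain a⊑pb e⊑pb) a<e
            continue : Dec (E e c) → Goal a
            continue (no e≁c) = e , a⊑e , ρ-≢ a<e , e⊑pb , e~b , e≁c
            continue (yes e~c) with onPath e⊑pb e~c e≁c′
            ... | inj₁ goal = extend a⊑e (ρ-≢ a<e) goal
            ... | inj₂ (f , e⊑f , e≢f , f⊑pb , f~c′ , f≁b) =
                extend a⊑f a≢f (go f (rec (nearer a⊑f a≢f f⊑pb)) f⊑pb f~c′ f≁b)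
              where
              a⊑f : a ⊑ f
              a⊑f = ⊑-trans a⊑e e⊑f
              a≢f : a ≢ f
              a≢f = ρ-≢ (ℕ.<-trans a<e (ρ-< e⊑f e≢f))

          start : ∀ a → a ⊑ par b → E a c → ¬ E a b → Goal a
          start a a⊑pb a~c a≁b with E? a c′
          ... | yes a~c′ = go a (<-wellFounded _) a⊑pb a~c′ a≁b
          ... | no a≁c′ with onPath a⊑pb a~c a≁c′
          ...   | inj₁ goal = goal
          ...   | inj₂ (f , a⊑f , a≢f , f⊑pb , f~c′ , f≁b) =
              extend a⊑f a≢f (go f (<-wellFounded _) f⊑pb f~c′ f≁b)

      -- If `b` is above `c`, the condition is inherited along the path. Otherwise the paths to `b`
      -- and `c` diverge. If `b` lies strictly below the parting sibling `b′`, then `par b` is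
      -- incomparable with `c`, hence not adjacent to it, and is the witness. If `b` is `b′`, the
      -- sorting of siblings decides through `branch`.
      sorted⇒FourPoint : FourPoint q
      sorted⇒FourPoint a b c a<b b<c a~c a≁b with compare-tree (root⊑ b) (root⊑ c)
      ... | inj₂ (inj₁ c⊑b) = contradiction (⊑⇒≤ c⊑b) (ℕ.<⇒≱ b<c)
      ... | inj₁ b⊑c = let d , a⊑d , a≢d , d⊑b , d≢b , d~b , d≁c = four-on-path a⊑b (<⇒≢ a<b) b⊑c (<⇒≢ b<c) a~c a≁b
                       in d , ⊑⇒< a⊑d a≢d , ⊑⇒< d⊑b d≢b , d~b , d≁c
        where
        a⊑b : a ⊑ b
        a⊑b = interval (⊏-of-< (edge-comparable a~c) (ℕ.<-trans a<b b<c)) (ℕ.<⇒≤ a<b) (ℕ.<⇒≤ b<c)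
      ... | inj₂ (inj₂ div) with Diverging.b′ div ≟ b
      ...   | no b′≢b = par b , ⊑⇒< a⊑pb a≢pb , parent< b b≢r , proj₁ (lt b b≢r) , pb≁c
        where
        open Topological q-top using (parent<)
        open Diverging div
        a⊑b : a ⊑ b
        a⊑b = interval (⊏-of-< (edge-comparable a~c) (ℕ.<-trans a<b b<c)) (ℕ.<⇒≤ a<b) (ℕ.<⇒≤ b<c)
        b≢r : b ≢ root
        b≢r = proj₁ (⊑-proper a⊑b (<⇒≢ a<b))
        a⊑pb : a ⊑ par b
        a⊑pb = proj₂ (⊑-proper a⊑b (<⇒≢ a<b))
        a≢pb : a ≢ par b
        a≢pb refl = a≁b (proj₁ (lt b b≢r))
        pb≁c : ¬ E (par b) c
        pb≁c pb~c with edge-comparable pb~c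
        ... | inj₁ l = proj₁ (diverging-incomparable record { Diverging div ; b′⊑b = here })
                         (⊑-trans (proj₂ (⊑-proper b′⊑b b′≢b)) l)
        ... | inj₂ l = proj₂ (diverging-incomparable div) (up b≢r l)
      ...   | yes refl with branch (q-sorted b c′ b′≢root c′≢root same (diverging-< div b<c))
                              same b′≢root c′≢root c′⊑c a a⊑pb a~c a≁b
        where
        open Diverging div
        a⊑b : a ⊑ b
        a⊑b = interval (⊏-of-< (edge-comparable a~c) (ℕ.<-trans a<b b<c)) (ℕ.<⇒≤ a<b) (ℕ.<⇒≤ b<c)
        a⊑pb : a ⊑ par b
        a⊑pb = proj₂ (⊑-proper a⊑b (<⇒≢ a<b))
      ...     | d , a⊑d , a≢d , d⊑pb , d~b , d≁c =
                d , ⊑⇒< a⊑d a≢d , ℕ.≤-<-trans (⊑⇒≤ d⊑pb) (Topological.parent< q-top b (Diverging.b′≢root div)) ,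
                    d~b , d≁c

    -- κ measures the comparison of siblings; ties are resolved by t.
    same-order : ∀ {q} (κ : V → ℕ) → Topological q → Nested q →
      (∀ c d → c ≢ root → d ≢ root → par c ≡ par d → Dominates t c d → κ d ≤ κ c) →
      (∀ c d → c ≢ root → d ≢ root → par c ≡ par d → q c < q d → κ d < κ c ⊎ (κ d ≡ κ c × t c < t d)) →
      ∀ u v → t u < t v → q u < q v
    same-order {q} κ q-top q-nested dom⇒κ q-sorted u v u<v
      with compare-tree (Topological.root⊑ t-top u) (Topological.root⊑ t-top v)
    ... | inj₁ u⊑v        = Topological.⊑⇒< q-top u⊑v (t-≢ u<v)
    ... | inj₂ (inj₁ v⊑u) = contradiction (t-≤ v⊑u) (ℕ.<⇒≱ u<v)
    ... | inj₂ (inj₂ div) = Interval.diverging-siblings q-top q-nested div q<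
      where
      open Diverging div
      t< : t b′ < t c′
      t< with ℕ.<-cmp (t b′) (t c′)
      ... | tri< l _ _ = l
      ... | tri≈ _ e _ = contradiction (inj e) b′≢c′
      ... | tri> _ _ l = contradiction u<v (ℕ.<-asym (Interval.diverging-siblings t-top nested
              record { b′≢root = c′≢root ; c′≢root = b′≢root ; same = sym same ; b′≢c′ = λ e → b′≢c′ (sym e)
                     ; b′⊑b = c′⊑c ; c′⊑c = b′⊑b } l))
      q< : q b′ < q c′
      q< with ℕ.<-cmp (q b′) (q c′)
      ... | tri< l _ _ = l
      ... | tri≈ _ e _ = contradiction (Topological.injective q-top e) b′≢c′
      ... | tri> _ _ l with q-sorted c′ b′ c′≢root b′≢root (sym same) l
      ...   | inj₁ κ< =
          contradiction (dom⇒κ b′ c′ b′≢root c′≢root same (siblings-dominate b′≢root c′≢root same t<))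
              (ℕ.<⇒≱ κ<)
      ...   | inj₂ (_ , t>) = contradiction t> (ℕ.<-asym t<)

-- Comparing sets of positions

false≢true : ∀ {b} → b ≡ false → b ≢ true
false≢true refl ()

differ : ∀ {b c} → b ≢ c → (b ≡ false × c ≡ true) ⊎ (c ≡ false × b ≡ true)
differ {false} {false} n = contradiction refl n
differ {false} {true}  n = inj₁ (refl , refl)
differ {true}  {false} n = inj₂ (refl , refl)
differ {true}  {true}  n = contradiction refl n

AgreeBelow : (ℕ → Bool) → (ℕ → Bool) → ℕ → Set
AgreeBelow f g N = ∀ j → j < N → f j ≡ g j

agree-sym : ∀ {f g N} → AgreeBelow f g N → AgreeBelow g f N
agree-sym eq j l = sym (eq j l)

agree-suc : ∀ {f g N} → AgreeBelow f g N → f N ≡ g N → AgreeBelow f g (suc N)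
agree-suc eq e j (s≤s l) with ℕ.m≤n⇒m<n∨m≡n l
... | inj₁ j<N  = eq j j<N
... | inj₂ refl = e

bit : Bool → ℕ
bit false = 0
bit true  = 1

bit≤1 : ∀ b → bit b ≤ 1
bit≤1 false = z≤n
bit≤1 true  = ℕ.≤-refl

-- Doubling leaves one free odd value directly behind each key. This serves both for appending a
-- digit and for placing the twin of a class.
odd<even : ∀ {a b} → a < b → suc (2 * a) < 2 * b
odd<even {a} a<b = ℕ.≤-trans (ℕ.≤-reflexive (sym (ℕ.*-suc 2 a))) (ℕ.*-monoʳ-≤ 2 a<b)

-- The number with binary digits f 0, …, f (N - 1), where f 0 is the most significant.
horner : (ℕ → Bool) → ℕ → ℕ
horner f zero    = 0
horner f (suc N) = bit (f N) + 2 * horner f N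

horner-cong : ∀ {f g} N → AgreeBelow f g N → horner f N ≡ horner g N
horner-cong zero    eq = refl
horner-cong (suc N) eq =
  cong₂ (λ b h → bit b + 2 * h) (eq N ℕ.≤-refl) (horner-cong N (λ j l → eq j (ℕ.m≤n⇒m≤1+n l)))

private
  HornerLess : (ℕ → Bool) → (ℕ → Bool) → ℕ → Set
  HornerLess f g N = ∃[ e ] (e < N × f e ≡ false × g e ≡ true × AgreeBelow f g e × horner f N < horner g N)

  horner-less-suc : ∀ {f g} N → HornerLess f g N → HornerLess f g (suc N)
  horner-less-suc {f} {g} N (e , l , fe , ge , eq , lt) =
    e , ℕ.m≤n⇒m≤1+n l , fe , ge , eq ,
    ℕ.≤-<-trans (ℕ.+-monoˡ-≤ (2 * horner f N) (bit≤1 (f N)))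
                (ℕ.<-≤-trans (odd<even lt) (ℕ.m≤n+m (2 * horner g N) (bit (g N))))

  horner-first : ∀ {f g} N → AgreeBelow f g N → f N ≡ false → g N ≡ true → HornerLess f g (suc N)
  horner-first {f} {g} N eq fN gN = N , ℕ.≤-refl , fN , gN , eq , less
    where
    less : horner f (suc N) < horner g (suc N)
    less rewrite fN | gN = ℕ.≤-reflexive (cong (λ h → suc (2 * h)) (horner-cong N eq))

  horner-compare : ∀ f g N → AgreeBelow f g N ⊎ HornerLess f g N ⊎ HornerLess g f N
  horner-compare f g zero = inj₁ (λ _ ())
  horner-compare f g (suc N) with horner-compare f g N | f N Bool.≟ g N
  ... | inj₂ (inj₁ l) | _ = inj₂ (inj₁ (horner-less-suc N l))
  ... | inj₂ (inj₂ l) | _ = inj₂ (inj₂ (horner-less-suc N l))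
  ... | inj₁ eq | yes e = inj₁ (agree-suc eq e)
  ... | inj₁ eq | no n with differ n
  ...   | inj₁ (fN , gN) = inj₂ (inj₁ (horner-first N eq fN gN))
  ...   | inj₂ (gN , fN) = inj₂ (inj₂ (horner-first N (agree-sym eq) gN fN))

-- The witness is the first difference: it must favour `g`, and it cannot lie behind `a`.
horner≤⇒ : ∀ {f g} N → horner f N ≤ horner g N → ∀ a → a < N → f a ≡ true → g a ≡ false →
           ∃[ e ] (e < a × g e ≡ true × f e ≡ false)
horner≤⇒ {f} {g} N f≤g a a<N fa ga with horner-compare f g N
... | inj₁ eq = contradiction (trans (sym (eq a a<N)) fa) (false≢true ga)
... | inj₂ (inj₂ (_ , _ , _ , _ , _ , g<f)) = contradiction f≤g (ℕ.<⇒≱ g<f)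
... | inj₂ (inj₁ (e , _ , fe , ge , eq , _)) with ℕ.<-cmp e a
...   | tri< l _ _    = e , l , ge , fe
...   | tri≈ _ refl _ = contradiction fa (false≢true fe)
...   | tri> _ _ l    = contradiction (trans (sym (eq a l)) fa) (false≢true ga)

⇒horner≤ : ∀ {f g} N →
           (∀ a → a < N → f a ≡ true → g a ≡ false → ∃[ e ] (e < a × g e ≡ true × f e ≡ false)) →
           horner f N ≤ horner g N
⇒horner≤ {f} {g} N dom with horner-compare f g N
... | inj₁ eq = ℕ.≤-reflexive (horner-cong N eq)
... | inj₂ (inj₁ (_ , _ , _ , _ , _ , f<g)) = ℕ.<⇒≤ f<g
... | inj₂ (inj₂ (e , e<N , ge , fe , eq , _)) with dom e e<N fe ge
...   | e′ , e′<e , ge′ , fe′ = contradiction (trans (sym (eq e′ e′<e)) ge′) (false≢true fe′)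

-- The label after `i` rounds of a vertex other than the root, where `f j` says whether the vertex
-- at position `j` is a neighbour. Positions count from 0 and rounds from 1, hence `suc i`. Here the
-- last difference decides, while in `horner` the first one does; for this reason the pivots will
-- run backwards.
labelOf : (ℕ → Bool) → ℕ → Label
labelOf f zero    = []
labelOf f (suc i) = if f i then suc i ∷ labelOf f i else labelOf f i

lex-refl : ∀ (l : Label) → l ≤ₗₑₓ l
lex-refl []      = Lex.base tt
lex-refl (x ∷ l) = Lex.next refl (lex-refl l)

private
  LabelLess : (ℕ → Bool) → (ℕ → Bool) → ℕ → Set
  LabelLess f g i = ∃[ e ] (e < i × f e ≡ false × g e ≡ true × (∀ j → e < j → j < i → f j ≡ g j) ×
                            labelOf f i ≤ₗₑₓ labelOf g i × ¬ labelOf g i ≤ₗₑₓ labelOf f i)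

  label-cong : ∀ {f g} i → AgreeBelow f g i → labelOf f i ≡ labelOf g i
  label-cong zero    eq = refl
  label-cong (suc i) eq = cong₂ (λ b l → if b then suc i ∷ l else l) (eq i ℕ.≤-refl)
                                (label-cong i (λ j l → eq j (ℕ.m≤n⇒m≤1+n l)))

  small-head : ∀ f i → labelOf f i ≡ [] ⊎ ∃[ k ] ∃[ l ] (labelOf f i ≡ k ∷ l × k ≤ i)
  small-head f zero = inj₁ refl
  small-head f (suc i) with f i
  ... | true = inj₂ (suc i , labelOf f i , refl , ℕ.≤-refl)
  ... | false with small-head f i
  ...   | inj₁ e = inj₁ e
  ...   | inj₂ (k , l , e , k≤i) = inj₂ (k , l , e , ℕ.m≤n⇒m≤1+n k≤i)

  -- After `i` rounds no label starts with a number above `i`, so whoever receives `suc i` beats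
  -- whoever does not.
  label-fresh : ∀ f g i → labelOf f i ≤ₗₑₓ (suc i ∷ labelOf g i) × ¬ (suc i ∷ labelOf g i) ≤ₗₑₓ labelOf f i
  label-fresh f g i with labelOf f i | small-head f i
  ... | .[]      | inj₁ refl = Lex.halt , λ ()
  ... | .(k ∷ l) | inj₂ (k , l , refl , k≤i) =
    Lex.this (s≤s k≤i) ,
        λ { (Lex.this lt) → ℕ.<⇒≱ lt (ℕ.m≤n⇒m≤1+n k≤i) ; (Lex.next refl _) → ℕ.<-irrefl refl k≤i }

  lex-tail : ∀ {k} {l l′ : Label} → (k ∷ l) ≤ₗₑₓ (k ∷ l′) → l ≤ₗₑₓ l′
  lex-tail (Lex.this lt)     = contradiction lt (ℕ.<-irrefl refl)
  lex-tail (Lex.next _ rest) = rest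

  label-less-suc : ∀ {f g} i → f i ≡ g i → LabelLess f g i → LabelLess f g (suc i)
  label-less-suc {f} {g} i fg (e , l , fe , ge , eq , le , nle) =
    e , ℕ.m≤n⇒m≤1+n l , fe , ge , agree , extend
    where
    agree : ∀ j → e < j → j < suc i → f j ≡ g j
    agree j e<j (s≤s j≤i) with ℕ.m≤n⇒m<n∨m≡n j≤i
    ... | inj₁ j<i = eq j e<j j<i
    ... | inj₂ refl = fg
    extend : labelOf f (suc i) ≤ₗₑₓ labelOf g (suc i) × ¬ labelOf g (suc i) ≤ₗₑₓ labelOf f (suc i)
    extend rewrite fg with g i
    ... | true  = Lex.next refl le , λ p → nle (lex-tail p)
    ... | false = le , nle

  label-last : ∀ {f g} i → f i ≡ false → g i ≡ true → LabelLess f g (suc i)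
  label-last {f} {g} i fi gi =
    i , ℕ.≤-refl , fi , gi , (λ j l l′ → contradiction l (ℕ.≤⇒≯ (ℕ.≤-pred l′))) , fresh
    where
    fresh : labelOf f (suc i) ≤ₗₑₓ labelOf g (suc i) × ¬ labelOf g (suc i) ≤ₗₑₓ labelOf f (suc i)
    fresh rewrite fi | gi = label-fresh f g i

  label-compare : ∀ f g i → AgreeBelow f g i ⊎ LabelLess f g i ⊎ LabelLess g f i
  label-compare f g zero = inj₁ (λ _ ())
  label-compare f g (suc i) with label-compare f g i | f i Bool.≟ g i
  ... | inj₁ eq       | yes e = inj₁ (agree-suc eq e)
  ... | inj₂ (inj₁ l) | yes e = inj₂ (inj₁ (label-less-suc i e l))
  ... | inj₂ (inj₂ l) | yes e = inj₂ (inj₂ (label-less-suc i (sym e) l))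
  ... | _             | no n with differ n
  ...   | inj₁ (fi , gi) = inj₂ (inj₁ (label-last i fi gi))
  ...   | inj₂ (gi , fi) = inj₂ (inj₂ (label-last i gi fi))

label≤⇒ : ∀ {f g} i → labelOf f i ≤ₗₑₓ labelOf g i → ∀ a → a < i → f a ≡ true → g a ≡ false →
          ∃[ e ] (a < e × e < i × g e ≡ true × f e ≡ false)
label≤⇒ {f} {g} i f≤g a a<i fa ga with label-compare f g i
... | inj₁ eq = contradiction (trans (sym (eq a a<i)) fa) (false≢true ga)
... | inj₂ (inj₂ (_ , _ , _ , _ , _ , _ , f≰g)) = contradiction f≤g f≰g
... | inj₂ (inj₁ (e , e<i , fe , ge , eq , _)) with ℕ.<-cmp e a
...   | tri> _ _ l    = e , l , e<i , ge , fe
...   | tri≈ _ refl _ = contradiction fa (false≢true fe)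
...   | tri< l _ _    = contradiction (trans (sym (eq a l a<i)) fa) (false≢true ga)

⇒label≤ : ∀ {f g} i →
          (∀ a → a < i → f a ≡ true → g a ≡ false → ∃[ e ] (a < e × e < i × g e ≡ true × f e ≡ false)) →
          labelOf f i ≤ₗₑₓ labelOf g i
⇒label≤ {f} {g} i dom with label-compare f g i
... | inj₁ eq = subst (labelOf f i ≤ₗₑₓ_) (label-cong i eq) (lex-refl _)
... | inj₂ (inj₁ (_ , _ , _ , _ , _ , f≤g , _)) = f≤g
... | inj₂ (inj₂ (e , e<i , ge , fe , eq , _)) with dom e e<i fe ge
...   | e′ , e<e′ , e′<i , ge′ , fe′ = contradiction (trans (sym (eq e′ e<e′ e′<i)) ge′) (false≢true fe′)

-- Reasoning about programs

update-≡ : ∀ {A : Set} (f : ℕ → A) k {x} → (f [ k ↦ x ]) k ≡ x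
update-≡ f k {x} = cong (λ b → if b then x else f k) (dec-true (k ℕ.≟ k) refl)

update-≢ : ∀ {A : Set} (f : ℕ → A) {k j x} → j ≢ k → (f [ k ↦ x ]) j ≡ f j
update-≢ f {k} {j} {x} j≢k = cong (λ b → if b then x else f j) (dec-false (j ℕ.≟ k) j≢k)

sumBelow : ℕ → (ℕ → ℕ) → ℕ
sumBelow zero    f = 0
sumBelow (suc k) f = f k + sumBelow k f

sumBelow-cong : ∀ k {f g} → (∀ j → j < k → f j ≡ g j) → sumBelow k f ≡ sumBelow k g
sumBelow-cong zero    eq = refl
sumBelow-cong (suc k) eq = cong₂ _+_ (eq k ℕ.≤-refl) (sumBelow-cong k (λ j l → eq j (ℕ.m≤n⇒m≤1+n l)))

sumBelow-remove : ∀ n w {v} → v < n → sumBelow n w ≡ w v + sumBelow n (w [ v ↦ 0 ])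
sumBelow-remove (suc n) w {v} (s≤s v≤n) with v ℕ.≟ n
... | yes refl = cong (w v +_) (trans (sumBelow-cong n (λ j j<n → sym (update-≢ w (ℕ.<⇒≢ j<n))))
                                      (cong (_+ sumBelow n (w [ v ↦ 0 ])) (sym (update-≡ w v))))
... | no v≢n = begin
    w n + sumBelow n w                              ≡⟨
        cong₂ _+_ (sym (update-≢ w (v≢n ∘ sym))) (sumBelow-remove n w (ℕ.≤∧≢⇒< v≤n v≢n)) ⟩
    w′ n + (w v + sumBelow n w′)                    ≡⟨ sym (ℕ.+-assoc (w′ n) (w v) _) ⟩
    (w′ n + w v) + sumBelow n w′                    ≡⟨ cong (_+ sumBelow n w′) (ℕ.+-comm (w′ n) (w v)) ⟩
    (w v + w′ n) + sumBelow n w′                    ≡⟨ ℕ.+-assoc (w v) (w′ n) _ ⟩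
    w v + (w′ n + sumBelow n w′)                    ∎
  where
  open ≡-Reasoning
  w′ : ℕ → ℕ
  w′ = w [ v ↦ 0 ]

InjectiveBelow : ℕ → (ℕ → ℕ) → Set
InjectiveBelow k r = ∀ i j → i < k → j < k → r i ≡ r j → i ≡ j

-- The amortisation behind the linear bounds: distinct vertices, visited in any order, together cost
-- at most the sum over all vertices. With weights 0 and 1 it is also the pigeonhole principle.
sumBelow-injective : ∀ k {n} r w → (∀ j → j < k → r j < n) → InjectiveBelow k r →
                     sumBelow k (w ∘ r) ≤ sumBelow n w
sumBelow-injective zero    r w r< inj = z≤n
sumBelow-injective (suc k) {n} r w r< inj = begin
  w (r k) + sumBelow k (w ∘ r)               ≡⟨ cong (w (r k) +_) (sumBelow-cong k λ j j<k →
      sym (update-≢ w (λ e → ℕ.<⇒≢ j<k (inj j k (ℕ.m≤n⇒m≤1+n j<k) ℕ.≤-refl e)))) ⟩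
  w (r k) + sumBelow k ((w [ r k ↦ 0 ]) ∘ r) ≤⟨ ℕ.+-monoʳ-≤ (w (r k)) (sumBelow-injective k r (w [ r k ↦ 0 ])
      (λ j l → r< j (ℕ.m≤n⇒m≤1+n l)) (λ i j l l′ → inj i j (ℕ.m≤n⇒m≤1+n l) (ℕ.m≤n⇒m≤1+n l′))) ⟩
  w (r k) + sumBelow n (w [ r k ↦ 0 ])       ≡⟨ sym (sumBelow-remove n w (r< k ℕ.≤-refl)) ⟩
  sumBelow n w                               ∎
  where open ℕ.≤-Reasoning

assignsVar : Program → Name → Bool
assignsVar skip                y = false
assignsVar (assign x e)        y = does (y ℕ.≟ x)
assignsVar (write a e e′)      y = false
assignsVar (p ⨾ q)             y = assignsVar p y ∨ assignsVar q y
assignsVar (ifNonZero e p q)   y = assignsVar p y ∨ assignsVar q y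
assignsVar (while e p)         y = assignsVar p y

writesArray : Program → Name → Bool
writesArray skip              b = false
writesArray (assign x e)      b = false
writesArray (write a e e′)    b = does (b ℕ.≟ a)
writesArray (p ⨾ q)           b = writesArray p b ∨ writesArray q b
writesArray (ifNonZero e p q) b = writesArray p b ∨ writesArray q b
writesArray (while e p)       b = writesArray p b

-- The untouched names are computed from the program text, so that the preservation of a register or
-- array is mostly proved by `refl`.
record Frame (p : Program) (st st′ : State) : Set where
  field
    var-eq   : ∀ x → assignsVar p x ≡ false → vars st′ x ≡ vars st x
    array-eq : ∀ a → writesArray p a ≡ false → arrays st′ a ≡ arrays st a

open Frame public

frame-refl : ∀ {p st} → Frame p st st
frame-refl .var-eq   _ _ = refl
frame-refl .array-eq _ _ = refl

frame-trans : ∀ {p st st′ st″} → Frame p st st′ → Frame p st′ st″ → Frame p st st″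
frame-trans f g .var-eq   x n = trans (var-eq g x n) (var-eq f x n)
frame-trans f g .array-eq a n = trans (array-eq g a n) (array-eq f a n)

private
  ∨-falseˡ : ∀ {a b} → a ∨ b ≡ false → a ≡ false
  ∨-falseˡ {false} _ = refl

  ∨-falseʳ : ∀ {a b} → a ∨ b ≡ false → b ≡ false
  ∨-falseʳ {false} e = e

frame-mono : ∀ {p q st st′} → (∀ x → assignsVar q x ≡ false → assignsVar p x ≡ false) →
             (∀ a → writesArray q a ≡ false → writesArray p a ≡ false) → Frame p st st′ → Frame q st st′
frame-mono v a f .var-eq   x n = var-eq f x (v x n)
frame-mono v a f .array-eq b n = array-eq f b (a b n)

frame-seqˡ : ∀ {p q st st′} → Frame p st st′ → Frame (p ⨾ q) st st′
frame-seqˡ {p} {q} = frame-mono (λ x → ∨-falseˡ {assignsVar p x}) (λ a → ∨-falseˡ {writesArray p a})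

frame-seqʳ : ∀ {p q st st′} → Frame q st st′ → Frame (p ⨾ q) st st′
frame-seqʳ {p} {q} = frame-mono (λ x → ∨-falseʳ {assignsVar p x}) (λ a → ∨-falseʳ {writesArray p a})

frame : ∀ {p st st′ t} → p ∣ st ⇓ st′ ∣ t → Frame p st st′
frame ⇓skip = frame-refl
frame {st = st} (⇓assign {x} {e}) .var-eq y n = cong (if_then ⟦ e ⟧ st else vars st y) n
frame ⇓assign .array-eq _ _ = refl
frame ⇓write .var-eq _ _ = refl
frame {st = st} (⇓write {a} {e} {e′}) .array-eq b n =
  cong (if_then arrays st a [ ⟦ e ⟧ st ↦ ⟦ e′ ⟧ st ] else arrays st b) n
frame (⇓seq {p} {q} d d′) = frame-trans (frame-seqˡ {p} {q} (frame d)) (frame-seqʳ {p} {q} (frame d′))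
frame (⇓then {e} {p} {q} _ d) = frame-mono (λ x → ∨-falseˡ {assignsVar p x}) (λ a → ∨-falseˡ {writesArray p a})
    (frame d)
frame (⇓else {e} {p} {q} _ d) = frame-mono (λ x → ∨-falseʳ {assignsVar p x}) (λ a → ∨-falseʳ {writesArray p a})
    (frame d)
frame (⇓loop {e} {p} _ d d′) = frame-trans (frame-mono (λ _ → id) (λ _ → id) (frame d)) (frame d′)
frame (⇓exit _) = frame-refl

-- A total-correctness triple with a bound on the running time.
record Runs (p : Program) (st : State) (b : ℕ) (Q : State → Set) : Set where
  constructor runs
  field
    {final}    : State
    {time}     : ℕ
    derivation : p ∣ st ⇓ final ∣ time
    time≤      : time ≤ b
    post       : Q final

runs-weaken : ∀ {p st b b′ Q} → b ≤ b′ → Runs p st b Q → Runs p st b′ Q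
runs-weaken l (runs d t q) = runs d (ℕ.≤-trans t l) q

runs-map : ∀ {p st b} {Q Q′ : State → Set} → (∀ st′ → Frame p st st′ → Q st′ → Q′ st′) → Runs p st b Q →
    Runs p st b Q′
runs-map f (runs d t q) = runs d t (f _ (frame d) q)

runs-skip : ∀ {st} {Q : State → Set} → Q st → Runs skip st 0 Q
runs-skip q = runs ⇓skip z≤n q

runs-assign : ∀ {x e st} {Q : State → Set} → Q (setVar x (⟦ e ⟧ st) st) → Runs (assign x e) st 1 Q
runs-assign q = runs ⇓assign ℕ.≤-refl q

runs-write : ∀ {a e e′ st} {Q : State → Set} → Q (setCell a (⟦ e ⟧ st) (⟦ e′ ⟧ st) st) →
    Runs (write a e e′) st 1 Q
runs-write q = runs ⇓write ℕ.≤-refl q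

infixr 4 _>>_
_>>_ : ∀ {p q st b b′} {Q R : State → Set} → Runs p st b Q →
       (∀ st′ → Frame p st st′ → Q st′ → Runs q st′ b′ R) → Runs (p ⨾ q) st (b + b′) R
runs d t q >> k with k _ (frame d) q
... | runs d′ t′ r = runs (⇓seq d d′) (ℕ.+-mono-≤ t t′) r

assign-then : ∀ {x e q st b R} → Runs q (setVar x (⟦ e ⟧ st) st) b R → Runs (assign x e ⨾ q) st (suc b) R
assign-then (runs d t r) = runs (⇓seq ⇓assign d) (s≤s t) r

write-then : ∀ {a e e′ q st b R} → Runs q (setCell a (⟦ e ⟧ st) (⟦ e′ ⟧ st) st) b R →
    Runs (write a e e′ ⨾ q) st (suc b) R
write-then (runs d t r) = runs (⇓seq ⇓write d) (s≤s t) r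

runs-if : ∀ {e p q st b Q} → (⟦ e ⟧ st ≢ 0 → Runs p st b Q) → (⟦ e ⟧ st ≡ 0 → Runs q st b Q) →
          Runs (ifNonZero e p q) st (suc b) Q
runs-if {e} {st = st} f g with ⟦ e ⟧ st ℕ.≟ 0
... | no n with f n
...   | runs d t r = runs (⇓then n d) (s≤s t) r
runs-if f g | yes z with g z
...   | runs d t r = runs (⇓else z d) (s≤s t) r

loop : Name → Name → Program → Program
loop x y body = while (var y ⊖ var x) (body ⨾ assign x (var x ⊕ lit 1))

-- I i s holds when the counter is i and at most s steps have been spent.
loop-rule : ∀ {x y body st₀ lo hi B} (I : ℕ → ℕ → State → Set) →
  assignsVar body x ≡ false → assignsVar (loop x y body) y ≡ false →
  vars st₀ x ≡ lo → vars st₀ y ≡ hi → lo ≤ hi → I lo 0 st₀ →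
  (∀ i s st → lo ≤ i → i < hi → Frame (loop x y body) st₀ st → vars st x ≡ i → I i s st →
     ∃[ b ] Runs body st b (λ st′ → I (suc i) (s + b + 2) (setVar x (vars st′ x + 1) st′))) →
  (∀ s st → Frame (loop x y body) st₀ st → I hi s st → s ≤ B) →
  Runs (loop x y body) st₀ (suc B) (λ st → ∃[ s ] I hi s st)
loop-rule {x} {y} {body} {st₀} {lo} {hi} {B} I nx ny x≡ y≡ lo≤hi init step bound =
  finish (go (hi ∸ lo) lo 0 st₀ (ℕ.m+[n∸m]≡n lo≤hi) ℕ.≤-refl frame-refl x≡ init)
  where
  p : Program
  p = loop x y body
  go : ∀ d i s st → i + d ≡ hi → lo ≤ i → Frame p st₀ st → vars st x ≡ i → I i s st →
       ∃[ s′ ] Runs p st (suc (s′ ∸ s)) (λ st′ → s ≤ s′ × I hi s′ st′)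
  go zero i s st e lo≤i f xi inv = s , runs (⇓exit guard) (s≤s z≤n)
      (ℕ.≤-refl , subst (λ k → I k s st) (trans (sym (ℕ.+-identityʳ i)) e) inv)
    where
    guard : vars st y ∸ vars st x ≡ 0
    guard rewrite var-eq f y ny | y≡ | xi | sym e | ℕ.+-identityʳ i = ℕ.n∸n≡0 i
  go (suc d) i s st e lo≤i f xi inv
    with step i s st lo≤i (subst (i <_) e (ℕ.m<m+n i (s≤s z≤n))) f xi inv
  ... | b , runs {st₁} {u₁} d₁ t₁ inv₁
    with go d (suc i) (s + b + 2) (setVar x (vars st₁ x + 1) st₁) (trans (sym (ℕ.+-suc i d)) e)
        (ℕ.m≤n⇒m≤1+n lo≤i)
            (frame-trans f (frame-mono (λ _ → id) (λ _ → id) (frame (⇓seq d₁ (⇓assign {x} {var x ⊕ lit 1})))))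
                x≡i+1 inv₁
    where
    x≡i+1 : vars (setVar x (vars st₁ x + 1) st₁) x ≡ suc i
    x≡i+1 = trans (update-≡ (vars st₁) x)
                  (trans (cong (_+ 1) (trans (var-eq (frame d₁) x nx) xi)) (ℕ.+-comm i 1))
  ... | s′ , runs {time = u₂} d₂ t₂ (l , inv₂) = s′ ,
      runs (⇓loop guard (⇓seq d₁ ⇓assign) d₂) total (ℕ.≤-trans s≤ l , inv₂)
    where
    guard : vars st y ∸ vars st x ≢ 0
    guard z rewrite var-eq f y ny | y≡ | xi = ℕ.<⇒≱ (subst (i <_) e (ℕ.m<m+n i (s≤s z≤n))) (ℕ.m∸n≡0⇒m≤n z)
    s≤ : s ≤ s + b + 2
    s≤ = ℕ.≤-trans (ℕ.m≤m+n s b) (ℕ.m≤m+n (s + b) 2)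
    open ℕ.≤-Reasoning
    total : suc (u₁ + 1 + u₂) ≤ suc (s′ ∸ s)
    total = s≤s (begin
      u₁ + 1 + u₂                             ≤⟨ ℕ.+-mono-≤ (ℕ.+-monoˡ-≤ 1 t₁) t₂ ⟩
      b + 1 + suc (s′ ∸ (s + b + 2))           ≡⟨ ℕ.+-suc (b + 1) _ ⟩
      suc (b + 1) + (s′ ∸ (s + b + 2))         ≡⟨ cong (_+ (s′ ∸ (s + b + 2))) (sym (ℕ.+-suc b 1)) ⟩
      b + 2 + (s′ ∸ (s + b + 2))               ≡⟨ cong (λ u → b + 2 + (s′ ∸ u)) (ℕ.+-assoc s b 2) ⟩
      b + 2 + (s′ ∸ (s + (b + 2)))             ≡⟨ cong (b + 2 +_) (sym (ℕ.∸-+-assoc s′ s (b + 2))) ⟩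
      b + 2 + ((s′ ∸ s) ∸ (b + 2))             ≡⟨
          ℕ.m+[n∸m]≡n (ℕ.m+n≤o⇒m≤o∸n (b + 2) (subst (_≤ s′) (trans (ℕ.+-assoc s b 2) (ℕ.+-comm s (b + 2))) l)) ⟩
      s′ ∸ s                                  ∎)
  finish : ∃[ s′ ] Runs p st₀ (suc s′) (λ st′ → 0 ≤ s′ × I hi s′ st′) →
      Runs p st₀ (suc B) (λ st → ∃[ s ] I hi s st)
  finish (s′ , runs d t (_ , inv)) = runs d (ℕ.≤-trans t (s≤s (bound s′ _ (frame d) inv))) (s′ , inv)

-- Each round pays `c` for the body, one step for the test and one for the counter; the outer `suc`
-- is the final test.
loop-const : ∀ {x y body st₀ lo hi c} (I : ℕ → State → Set) →
  assignsVar body x ≡ false → assignsVar (loop x y body) y ≡ false →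
  vars st₀ x ≡ lo → vars st₀ y ≡ hi → lo ≤ hi → I lo st₀ →
  (∀ i st → lo ≤ i → i < hi → Frame (loop x y body) st₀ st → vars st x ≡ i → I i st →
     Runs body st c (λ st′ → I (suc i) (setVar x (vars st′ x + 1) st′))) →
  Runs (loop x y body) st₀ (suc ((hi ∸ lo) * (c + 2))) (I hi)
loop-const {lo = lo} {hi} {c} I nx ny x≡ y≡ lo≤hi init step =
  runs-map (λ { _ _ (_ , inv , _) → inv })
    (loop-rule (λ i s st → I i st × s ≤ (i ∸ lo) * (c + 2)) nx ny x≡ y≡ lo≤hi (init , z≤n)
      (λ i s st lo≤i i<hi f xi (inv , s≤) → c ,
          runs-map (λ st′ _ inv′ → inv′ , spent lo≤i s≤) (step i st lo≤i i<hi f xi inv))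
      (λ _ _ _ → proj₂))
  where
  open ℕ.≤-Reasoning
  spent : ∀ {i s} → lo ≤ i → s ≤ (i ∸ lo) * (c + 2) → s + c + 2 ≤ (suc i ∸ lo) * (c + 2)
  spent {i} {s} lo≤i s≤ = begin
    s + c + 2                       ≡⟨ ℕ.+-assoc s c 2 ⟩
    s + (c + 2)                     ≡⟨ ℕ.+-comm s (c + 2) ⟩
    c + 2 + s                       ≤⟨ ℕ.+-monoʳ-≤ (c + 2) s≤ ⟩
    suc (i ∸ lo) * (c + 2)          ≡⟨ cong (_* (c + 2)) (sym (ℕ.+-∸-assoc 1 lo≤i)) ⟩
    (suc i ∸ lo) * (c + 2)          ∎

-- An amortised loop: round j costs c + d * w (r st j), where r st j is fixed once round j has been run.
loop-sweep : ∀ {x y body st₀ hi n} {w : ℕ → ℕ} {c d} (r : State → ℕ → ℕ) (I : ℕ → State → Set) →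
  assignsVar body x ≡ false → assignsVar (loop x y body) y ≡ false →
  vars st₀ x ≡ 0 → vars st₀ y ≡ hi → I 0 st₀ →
  (∀ i st → i < hi → Frame (loop x y body) st₀ st → vars st x ≡ i → I i st →
     Runs body st (c + d * w (r st i)) (λ st′ → I (suc i) (setVar x (vars st′ x + 1) st′) ×
                                  (∀ j → j ≤ i → r (setVar x (vars st′ x + 1) st′) j ≡ r st j))) →
  (∀ st → Frame (loop x y body) st₀ st → I hi st → (∀ j → j < hi → r st j < n) × InjectiveBelow hi (r st)) →
  Runs (loop x y body) st₀ (suc (hi * (c + 2) + d * sumBelow n w)) (I hi)
loop-sweep {x} {hi = hi} {n} {w} {c} {d} r I nx ny x≡ y≡ init step final =
  runs-map (λ { _ _ (_ , inv , _) → inv })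
    (loop-rule (λ i s st → I i st × s ≤ i * (c + 2) + d * sumBelow i (w ∘ r st)) nx ny x≡ y≡ z≤n (init , z≤n)
      (λ i s st _ i<hi f xi (inv , s≤) → c + d * w (r st i) ,
         runs-map (λ st′ _ (inv′ , same) → inv′ , spent i s st _ same s≤) (step i st i<hi f xi inv))
      (λ s st f (inv , s≤) → ℕ.≤-trans s≤ (ℕ.+-monoʳ-≤ (hi * (c + 2)) (ℕ.*-monoʳ-≤ d
         (sumBelow-injective hi (r st) w (proj₁ (final st f inv)) (proj₂ (final st f inv)))))))
  where
  open ℕ.≤-Reasoning
  spent : ∀ i s st st′ → (∀ j → j ≤ i → r st′ j ≡ r st j) → s ≤ i * (c + 2) + d * sumBelow i (w ∘ r st) →
          s + (c + d * w (r st i)) + 2 ≤ suc i * (c + 2) + d * sumBelow (suc i) (w ∘ r st′)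
  spent i s st st′ same s≤ = begin
    s + (c + d * w (r st i)) + 2                                            ≤⟨ ℕ.+-monoˡ-≤ 2
        (ℕ.+-monoˡ-≤ (c + d * w (r st i)) s≤) ⟩
    i * (c + 2) + d * sumBelow i (w ∘ r st) + (c + d * w (r st i)) + 2        ≡⟨
        arrange (i * (c + 2)) d (sumBelow i (w ∘ r st)) c (w (r st i)) ⟩
    (c + 2) + i * (c + 2) + d * (w (r st i) + sumBelow i (w ∘ r st))          ≡⟨
        cong (λ u → (c + 2) + i * (c + 2) + d * u)
        (cong₂ _+_ (cong w (sym (same i ℕ.≤-refl))) (sumBelow-cong i λ j l → cong w (sym (same j (ℕ.<⇒≤ l))))) ⟩
    suc i * (c + 2) + d * sumBelow (suc i) (w ∘ r st′)                        ∎
    where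
    arrange : ∀ a d s c w → a + d * s + (c + d * w) + 2 ≡ (c + 2) + a + d * (w + s)
    arrange = solve-∀

-- Register 6 names the vertex, register 4 runs through the indices of its adjacency list.
arcs : Program → Program
arcs body = assign 4 (read 0 (var 6)) ⨾ assign 5 (read 0 (var 6 ⊕ lit 1)) ⨾ loop 4 5 body

arcs-rule : ∀ {body st₀ v off c} (J : ℕ → State → Set) →
  assignsVar body 4 ≡ false → assignsVar (loop 4 5 body) 5 ≡ false →
  vars st₀ 6 ≡ v → arrays st₀ 0 ≡ off → off v ≤ off (suc v) →
  J (off v) (setVar 5 (off (v + 1)) (setVar 4 (off v) st₀)) →
  (∀ k st → off v ≤ k → k < off (suc v) → Frame (arcs body) st₀ st → vars st 4 ≡ k → J k st →
     Runs body st c (λ st′ → J (suc k) (setVar 4 (vars st′ 4 + 1) st′))) →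
  Runs (arcs body) st₀ (3 + (c + 2) * (off (suc v) ∸ off v)) (J (off (suc v)))
arcs-rule {body} {st₀} {v} {off} {c} J n4 n5 refl refl mono init step =
  runs-weaken (ℕ.≤-reflexive (cong (3 +_) (ℕ.*-comm (off (suc v) ∸ off v) (c + 2))))
    (assign-then (assign-then
      (loop-const J n4 n5 refl (cong off (ℕ.+-comm v 1)) mono init
          (λ k st l l′ f → step k st l l′ (frame-trans start (last f))))))
  where
  p₂ p₃ : Program
  p₂ = assign 5 (read 0 (var 6 ⊕ lit 1)) ⨾ p₃
  p₃ = loop 4 5 body
  last : ∀ {st st′} → Frame p₃ st st′ → Frame (arcs body) st st′
  last f = frame-seqʳ {assign 4 (read 0 (var 6))} {p₂} (frame-seqʳ {assign 5 (read 0 (var 6 ⊕ lit 1))} {p₃} f)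
  start : Frame (arcs body) st₀ (setVar 5 (off (v + 1)) (setVar 4 (off v) st₀))
  start = frame-trans (frame-seqˡ {assign 4 (read 0 (var 6))} {p₂} (frame ⇓assign))
                      (frame-seqʳ {assign 4 (read 0 (var 6))} {p₂}
                          (frame-seqˡ {assign 5 (read 0 (var 6 ⊕ lit 1))} {p₃} (frame ⇓assign)))

fill : Name → Exp → Exp → Program
fill a e e′ = assign 3 (lit 0) ⨾ loop 3 0 (write a e e′)

-- Injectivity of `g` keeps a later round from overwriting an earlier one. With suitable `g` the
-- same loop copies an array, inverts an order and scatters parent pointers.
fill-rule : ∀ {a e e′ st₀ n} (g f : ℕ → ℕ) → vars st₀ 0 ≡ n → InjectiveBelow n g →
  (∀ i st → i < n → Frame (fill a e e′) st₀ st → vars st 3 ≡ i → ⟦ e ⟧ st ≡ g i × ⟦ e′ ⟧ st ≡ f i) →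
  Runs (fill a e e′) st₀ (2 + n * 3) (λ st → (∀ i → i < n → arrays st a (g i) ≡ f i) ×
                                       (∀ j → (∀ i → i < n → j ≢ g i) → arrays st a j ≡ arrays st₀ a j))
fill-rule {a} {e} {e′} {st₀} {n} g f n≡ inj val = assign-then
  (runs-map (λ { _ _ (_ , new , old) → new , old })
    (loop-const (λ i st → i ≤ n × (∀ j → j < i → arrays st a (g j) ≡ f j) ×
        (∀ j → (∀ i → i < n → j ≢ g i) → arrays st a j ≡ arrays st₀ a j))
      refl refl refl n≡ z≤n (z≤n , (λ _ ()) , λ _ _ → refl)
      (λ i st _ i<n fr xi (_ , new , old) → runs-write
         (i<n , (λ j j≤i → written i st i<n fr xi new j (ℕ.≤-pred j≤i)) , λ j out →
             kept i st i<n fr xi old j out))))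
  where
  body : Program
  body = loop 3 0 (write a e e′)
  value : ∀ i st → i < n → Frame body (setVar 3 0 st₀) st → vars st 3 ≡ i → ⟦ e ⟧ st ≡ g i × ⟦ e′ ⟧ st ≡ f i
  value i st i<n fr =
      val i st i<n (frame-trans (frame-seqˡ {assign 3 (lit 0)} {body} (frame ⇓assign))
          (frame-seqʳ {assign 3 (lit 0)} {body} fr))
  module _ i st (i<n : i < n) (fr : Frame body (setVar 3 0 st₀) st) (xi : vars st 3 ≡ i) where
    new-array : ∀ j → arrays (setCell a (⟦ e ⟧ st) (⟦ e′ ⟧ st) st) a j ≡ (arrays st a [ g i ↦ f i ]) j
    new-array j rewrite proj₁ (value i st i<n fr xi) | proj₂ (value i st i<n fr xi) =
        cong (_$ j) (update-≡ (arrays st) a)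
    written : (∀ j → j < i → arrays st a (g j) ≡ f j) → ∀ j → j ≤ i →
              arrays (setCell a (⟦ e ⟧ st) (⟦ e′ ⟧ st) st) a (g j) ≡ f j
    written new j j≤i with ℕ.m≤n⇒m<n∨m≡n j≤i
    ... | inj₂ refl = trans (new-array (g i)) (update-≡ (arrays st a) (g i))
    ... | inj₁ j<i  = trans (new-array (g j)) (trans (update-≢ (arrays st a)
            (λ eq → ℕ.<⇒≢ j<i (inj j i (ℕ.<-trans j<i i<n) i<n eq))) (new j j<i))
    kept : (∀ j → (∀ i → i < n → j ≢ g i) → arrays st a j ≡ arrays st₀ a j) → ∀ j → (∀ i → i < n → j ≢ g i) →
           arrays (setCell a (⟦ e ⟧ st) (⟦ e′ ⟧ st) st) a j ≡ arrays st₀ a j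
    kept old j out = trans (new-array j) (trans (update-≢ (arrays st a) (out i i<n)) (old j out))

-- Leaves the sum of the values of e at 1, …, n - 1 in register 12.
check : Exp → Program
check e = assign 12 (lit 0) ⨾ assign 3 (lit 1) ⨾ loop 3 0 (assign 12 (var 12 ⊕ e))

-- A sum of natural numbers vanishes only if all its terms do, so one register collects all
-- violations. Position 0 is left out: it is the root, which has no parent and heads the sorted
-- list.
check-rule : ∀ {e st₀ n} (f : ℕ → ℕ) → vars st₀ 0 ≡ n → 1 ≤ n →
  (∀ i st → 1 ≤ i → i < n → Frame (check e) st₀ st → vars st 3 ≡ i → ⟦ e ⟧ st ≡ f i) →
  Runs (check e) st₀ (3 + n * 3) (λ st → vars st 12 ≡ 0 ⇔ (∀ i → 1 ≤ i → i < n → f i ≡ 0))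
check-rule {e} {st₀} {n} f n≡ 1≤n val = assign-then (assign-then
  (runs-weaken (s≤s (ℕ.*-monoˡ-≤ 3 (ℕ.m∸n≤m n 1)))
    (loop-const (λ i st → vars st 12 ≡ 0 ⇔ (∀ j → 1 ≤ j → j < i → f j ≡ 0))
      refl refl refl n≡ 1≤n (mk⇔ (λ _ j l l′ → contradiction l (ℕ.<⇒≱ l′)) (λ _ → refl))
      (λ i st 1≤i i<n fr xi inv → runs-assign (mk⇔
        (λ z j 1≤j j≤i → zero-below {st = st} (value i st 1≤i i<n fr xi) inv z j 1≤j (ℕ.≤-pred j≤i))
        (λ all → cong₂ _+_ (Equivalence.from inv (λ j l l′ → all j l (ℕ.m≤n⇒m≤1+n l′)))
                           (trans (value i st 1≤i i<n fr xi) (all i 1≤i ℕ.≤-refl))))))))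
  where
  p₁ p₂ : Program
  p₁ = assign 3 (lit 1) ⨾ p₂
  p₂ = loop 3 0 (assign 12 (var 12 ⊕ e))
  value : ∀ i st → 1 ≤ i → i < n → Frame p₂ (setVar 3 1 (setVar 12 0 st₀)) st → vars st 3 ≡ i → ⟦ e ⟧ st ≡ f i
  value i st 1≤i i<n fr = val i st 1≤i i<n
    (frame-trans (frame-seqˡ {assign 12 (lit 0)} {p₁} (frame ⇓assign))
      (frame-trans (frame-seqʳ {assign 12 (lit 0)} {p₁} (frame-seqˡ {assign 3 (lit 1)} {p₂} (frame ⇓assign)))
                   (frame-seqʳ {assign 12 (lit 0)} {p₁} (frame-seqʳ {assign 3 (lit 1)} {p₂} fr))))
  zero-below : ∀ {i st v} → v ≡ f i → vars st 12 ≡ 0 ⇔ (∀ j → 1 ≤ j → j < i → f j ≡ 0) → vars st 12 + v ≡ 0 →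
               ∀ j → 1 ≤ j → j ≤ i → f j ≡ 0
  zero-below {i} {st} v≡ inv z j 1≤j j≤i with ℕ.m≤n⇒m<n∨m≡n j≤i
  ... | inj₁ j<i  = Equivalence.to inv (ℕ.m+n≡0⇒m≡0 (vars st 12) z) j 1≤j j<i
  ... | inj₂ refl = trans (sym v≡) (ℕ.m+n≡0⇒n≡0 (vars st 12) z)

-- Sorted linked lists

-- The end of a list is marked by 0, which is therefore never the successor of another node.
data Chain (next κ : ℕ → ℕ) (h : ℕ) : List ℕ → Set where
  end  : next h ≡ 0 → Chain next κ h []
  link : ∀ {b L} → next h ≡ b → b ≢ 0 → κ h < κ b → Chain next κ b L → Chain next κ h (b ∷ L)

chain-head< : ∀ {next κ h L x} → Chain next κ h L → x ∈ L → κ h < κ x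
chain-head< (link _ _ l _) (here refl) = l
chain-head< (link _ _ l c) (there x∈)  = ℕ.<-trans l (chain-head< c x∈)

chain-head≤ : ∀ {next κ h L x} → Chain next κ h L → x ∈ h ∷ L → κ h ≤ κ x
chain-head≤ c (here refl) = ℕ.≤-refl
chain-head≤ c (there x∈)  = ℕ.<⇒≤ (chain-head< c x∈)

chain-injective : ∀ {next κ h L x y} → Chain next κ h L → x ∈ h ∷ L → y ∈ h ∷ L → κ x ≡ κ y → x ≡ y
chain-injective c (here refl) (here refl) e = refl
chain-injective c (here refl) (there y∈)  e = contradiction e (ℕ.<⇒≢ (chain-head< c y∈))
chain-injective c (there x∈)  (here refl) e = contradiction (sym e) (ℕ.<⇒≢ (chain-head< c x∈))
chain-injective (link _ _ _ c) (there x∈) (there y∈) e = chain-injective c x∈ y∈ e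

chain-next : ∀ {next κ h L x} → Chain next κ h L → x ∈ h ∷ L → next x ≡ 0 ⊎ (next x ∈ L × κ x < κ (next x))
chain-next (end e)           (here refl) = inj₁ e
chain-next (link refl _ l _) (here refl) = inj₂ (here refl , l)
chain-next (link _ _ _ c)    (there x∈) with chain-next c x∈
... | inj₁ e       = inj₁ e
... | inj₂ (m , l) = inj₂ (there m , l)

chain-next≤ : ∀ {next κ h L x y} → Chain next κ h L → x ∈ h ∷ L → y ∈ h ∷ L → κ x < κ y →
              next x ≢ 0 × κ (next x) ≤ κ y
chain-next≤ c (here refl) (here refl) l = contradiction l (ℕ.<-irrefl refl)
chain-next≤ (link refl n _ c) (here refl) (there y∈) l = n , chain-head≤ c y∈
chain-next≤ c (there x∈) (here refl) l = contradiction l (ℕ.<-asym (chain-head< c x∈))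
chain-next≤ (link _ _ _ c) (there x∈) (there y∈) l = chain-next≤ c x∈ y∈ l

chain-map : ∀ {next next′ κ κ′ h L} → (∀ x → x ∈ h ∷ L → next′ x ≡ next x) →
            (∀ x y → x ∈ h ∷ L → y ∈ h ∷ L → κ x < κ y → κ′ x < κ′ y) →
            Chain next κ h L → Chain next′ κ′ h L
chain-map n k (end e) = end (trans (n _ (here refl)) e)
chain-map n k (link e b≢0 l c) = link (trans (n _ (here refl)) e) b≢0 (k _ _ (here refl) (there (here refl)) l)
  (chain-map (λ x x∈ → n x (there x∈)) (λ x y x∈ y∈ → k x y (there x∈) (there y∈)) c)

-- The keys `κ` are not in memory. Being strictly increasing they make the nodes of a list distinct,
-- so that redirecting the pointers of `a` and `b` affects the list in one place only.
chain-insert : ∀ {next next′ κ h L a b} → Chain next κ h L → a ∈ h ∷ L → b ≢ 0 → κ a < κ b →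
  (next a ≢ 0 → κ b < κ (next a)) → next′ a ≡ b → next′ b ≡ next a →
  (∀ x → x ∈ h ∷ L → x ≢ a → next′ x ≡ next x) →
  ∃[ L′ ] (Chain next′ κ h L′ × length L′ ≡ suc (length L) × (∀ x → x ∈ L′ ⇔ (x ≡ b ⊎ x ∈ L)))
chain-insert {b = b} (end e) (here refl) b≢0 a<b _ na nb _ =
  b ∷ [] , link na b≢0 a<b (end (trans nb e)) , refl , λ x →
      mk⇔ (λ { (here e) → inj₁ e }) (λ { (inj₁ e) → here e })
chain-insert {b = b} (link {c} {L} refl c≢0 a<c ch) (here refl) b≢0 a<b b< na nb old =
  b ∷ c ∷ L ,
  link na b≢0 a<b (link nb c≢0 (b< c≢0) (chain-map
    (λ x x∈ → old x (there x∈) (λ { refl → ℕ.<⇒≱ a<c (chain-head≤ ch x∈) })) (λ _ _ _ _ l → l) ch)) ,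
  refl , λ x → mk⇔ (λ { (here e) → inj₁ e ; (there m) → inj₂ m }) (λ { (inj₁ e) → here e ; (inj₂ m) → there m })
chain-insert (link {c} {L} e c≢0 h<c ch) (there a∈) b≢0 a<b b< na nb old
  with chain-insert ch a∈ b≢0 a<b b< na nb (λ x x∈ → old x (there x∈))
... | L′ , ch′ , len , mem = c ∷ L′ ,
  link (trans (old _ (here refl) (λ { refl → ℕ.<⇒≱ h<c (chain-head≤ ch a∈) })) e) c≢0 h<c ch′ , cong suc len ,
  λ x → mk⇔ (λ { (here e) → inj₂ (here e) ; (there m) → cons-to x (Equivalence.to (mem x) m) })
            (λ { (inj₁ e) → there (Equivalence.from (mem x) (inj₁ e)) ; (inj₂ (here e)) → here e
               ; (inj₂ (there m)) → there (Equivalence.from (mem x) (inj₂ m)) })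
  where
  cons-to : ∀ {b} x → x ≡ b ⊎ x ∈ L → x ≡ b ⊎ x ∈ c ∷ L
  cons-to x (inj₁ e) = inj₁ e
  cons-to x (inj₂ m) = inj₂ (there m)

-- Positions and latest earlier neighbours

∸≢0⇒< : ∀ {m n} → m ∸ n ≢ 0 → n < m
∸≢0⇒< z = ℕ.≰⇒> (λ m≤n → z (ℕ.m≤n⇒m∸n≡0 m≤n))

-- The adjacency lists as memory holds them, an arc being an index. By `tgt-inj` no list repeats a
-- vertex: no child is enqueued twice, and no position is moved twice in one round of refinement.
record Network : Set where
  field
    n s     : ℕ
    off tgt : ℕ → ℕ
    s<n     : s < n

  IsArc : ℕ → ℕ → Set
  IsArc v k = off v ≤ k × k < off (suc v)

  degree : ℕ → ℕ
  degree v = off (suc v) ∸ off v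

  field
    off-mono : ∀ {v} → v < n → off v ≤ off (suc v)
    tgt<     : ∀ {v k} → v < n → IsArc v k → tgt k < n
    tgt-inj  : ∀ {v k k′} → v < n → IsArc v k → IsArc v k′ → tgt k ≡ tgt k′ → k ≡ k′

  arcCount : ℕ
  arcCount = sumBelow n degree

-- Memory: array 3 holds an order of the vertices, and from then on vertices are mostly referred to by
-- their position in it.  Array 4 holds the inverse of the order, array 5 the latest earlier neighbours,
-- array 6 the class of each position, array 7 the twins of the classes, array 8 the list of the classes
-- and later also of the positions, array 9 the sorted tree as a linked list, array 10 the same list as
-- an order.  Array 22 is array 2 of the embedded program.
invertOrder improveParent parentStep findParents locate : Program
invertOrder = fill 4 (read 3 (var 3)) (var 3)
improveParent =
  assign 7 (read 4 (read 1 (var 4))) ⨾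
  ifNonZero (var 3 ⊖ var 7) (ifNonZero ((var 7 ⊕ lit 1) ⊖ var 9) (assign 9 (var 7 ⊕ lit 1)) skip) skip
parentStep =
  assign 6 (read 3 (var 3)) ⨾ assign 9 (lit 0) ⨾ arcs improveParent ⨾ write 5 (var 3) (var 9)
findParents = assign 3 (lit 0) ⨾ loop 3 0 parentStep
locate = invertOrder ⨾ findParents

module Routines (N : Network) where
  open Network N

  record Loaded (st : State) : Set where
    field
      n≡   : vars st 0 ≡ n
      s≡   : vars st 1 ≡ s
      off≡ : arrays st 0 ≡ off
      tgt≡ : arrays st 1 ≡ tgt

  open Loaded

  loaded-frame : ∀ {p st st′} → assignsVar p 0 ≡ false → assignsVar p 1 ≡ false →
                 writesArray p 0 ≡ false → writesArray p 1 ≡ false → Frame p st st′ → Loaded st → Loaded st′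
  loaded-frame a b c d f l = record
    { n≡ = trans (var-eq f 0 a) (n≡ l) ; s≡ = trans (var-eq f 1 b) (s≡ l)
    ; off≡ = trans (array-eq f 0 c) (off≡ l) ; tgt≡ = trans (array-eq f 1 d) (tgt≡ l) }

  record IsOrder (R : ℕ → ℕ) : Set where
    field
      R<    : ∀ {i} → i < n → R i < n
      R-inj : InjectiveBelow n R

  -- B holds 0 for "no earlier neighbour" and 1 + y for position y.
  record Located (R pos B : ℕ → ℕ) : Set where
    field
      pos-R   : ∀ {i} → i < n → pos (R i) ≡ i
      latest  : ∀ {i k} → i < n → IsArc (R i) k → pos (tgt k) < i → suc (pos (tgt k)) ≤ B i
      present : ∀ {i} → i < n → B i ≡ 0 ⊎ ∃[ k ] (IsArc (R i) k × pos (tgt k) < i × B i ≡ suc (pos (tgt k)))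

  module _ {R : ℕ → ℕ} (ord : IsOrder R) where
    open IsOrder ord

    findParents-rule : ∀ {st} (pos : ℕ → ℕ) → Loaded st → arrays st 3 ≡ R → arrays st 4 ≡ pos →
      (∀ {i} → i < n → pos (R i) ≡ i) →
      Runs findParents st (2 + (n * 8 + 6 * arcCount)) (λ st′ → Located R pos (arrays st′ 5))
    findParents-rule {st₀} pos ld R≡ pos≡ pos-R = assign-then
      (runs-map (λ st′ _ spec →
          record { pos-R = pos-R ; latest = λ i<n arc → proj₁ (spec _ i<n) arc ; present = λ i<n →
              proj₂ (spec _ i<n) })
        (loop-sweep {n = n} {w = degree} {c = 6} {d = 6} (λ _ → R) (λ i st → ∀ j → j < i →
            Spec j (arrays st 5 j)) refl refl refl (n≡ ld) (λ _ ())
          outer (λ _ _ _ → (λ _ → R<) , R-inj)))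
      where
      -- Register 9 holds the maximum of `suc (pos w)` over the earlier neighbours `w` scanned so
      -- far, or 0 if there were none. `Upper` and `Attained` are the two halves of this.
      Upper : ℕ → ℕ → ℕ → Set
      Upper i k b = ∀ {k′} → off (R i) ≤ k′ → k′ < k → pos (tgt k′) < i → suc (pos (tgt k′)) ≤ b
      Attained : ℕ → ℕ → ℕ → Set
      Attained i k b = b ≡ 0 ⊎ ∃[ k′ ] ((off (R i) ≤ k′ × k′ < k) × pos (tgt k′) < i × b ≡ suc (pos (tgt k′)))
      Spec : ℕ → ℕ → Set
      Spec i b = (∀ {k} → IsArc (R i) k → pos (tgt k) < i → suc (pos (tgt k)) ≤ b) ×
          Attained i (off (suc (R i))) b

      outer : ∀ i st → i < n → Frame (loop 3 0 parentStep) (setVar 3 0 st₀) st → vars st 3 ≡ i →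
              (∀ j → j < i → Spec j (arrays st 5 j)) →
              Runs parentStep st (6 + 6 * degree (R i))
                (λ st′ → (∀ j → j < suc i → Spec j (arrays st′ 5 j)) × (∀ j → j ≤ i → R j ≡ R j))
      outer i st i<n fr xi done = runs-weaken (ℕ.≤-reflexive (arrange (degree (R i))))
        (assign-then (assign-then
          (arcs-rule (λ k st → Upper i k (vars st 9) × Attained i k (vars st 9)) refl refl
             (cong₂ _$_ (trans (array-eq fr 3 refl) R≡) xi)
             (trans (array-eq fr 0 refl) (off≡ ld)) (off-mono (R< i<n))
             ((λ l l′ → contradiction l (ℕ.<⇒≱ l′)) , inj₁ refl) inner
           >> λ st′ fr′ (up , att) → runs-write (finish st′ fr′ up att , λ _ _ → refl))))
        where
        arrange : ∀ d → suc (suc (3 + 6 * d + 1)) ≡ 6 + 6 * d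
        arrange = solve-∀
        st₁ : State
        st₁ = setVar 9 0 (setVar 6 (arrays st 3 (vars st 3)) st)
        inner : ∀ k st₂ → off (R i) ≤ k → k < off (suc (R i)) → Frame (arcs improveParent) st₁ st₂ →
            vars st₂ 4 ≡ k →
                Upper i k (vars st₂ 9) × Attained i k (vars st₂ 9) →
                Runs improveParent st₂ 4 (λ st′ → Upper i (suc k) (vars st′ 9) ×
                    Attained i (suc k) (vars st′ 9))
        inner k st₂ lo hi fr₂ k≡ (up , att) = assign-then
          (runs-if (λ x<i →
              runs-if (λ b<x → runs-assign (better x<i b<x)) (λ x≤b → runs-weaken z≤n (runs-skip (worse x≤b))))
                   (λ i≤x → runs-weaken z≤n (runs-skip (later i≤x))))
          where
          x≡ : arrays st₂ 4 (arrays st₂ 1 (vars st₂ 4)) ≡ pos (tgt k)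
          x≡ = cong₂ _$_ (trans (array-eq fr₂ 4 refl) (trans (array-eq fr 4 refl) pos≡))
                 (cong₂ _$_ (trans (array-eq fr₂ 1 refl) (trans (array-eq fr 1 refl) (tgt≡ ld))) k≡)
          i≡ : vars st₂ 3 ≡ i
          i≡ = trans (var-eq fr₂ 3 refl) xi
          grow : ∀ {b b′} → b ≤ b′ → (pos (tgt k) < i → suc (pos (tgt k)) ≤ b′) → Upper i k b →
              Upper i (suc k) b′
          grow b≤b′ new old {k′} l (s≤s k′≤k) x<i with ℕ.m≤n⇒m<n∨m≡n k′≤k
          ... | inj₁ k′<k = ℕ.≤-trans (old l k′<k x<i) b≤b′
          ... | inj₂ refl = new x<i
          widen : ∀ {b} → Attained i k b → Attained i (suc k) b
          widen (inj₁ e) = inj₁ e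
          widen (inj₂ (k′ , (l , l′) , rest)) = inj₂ (k′ , (l , ℕ.m≤n⇒m≤1+n l′) , rest)
          x : ℕ
          x = arrays st₂ 4 (arrays st₂ 1 (vars st₂ 4))
          better : vars st₂ 3 ∸ x ≢ 0 → (x + 1) ∸ vars st₂ 9 ≢ 0 → Upper i (suc k) (x + 1) ×
              Attained i (suc k) (x + 1)
          better x<i b<x =
              grow (ℕ.<⇒≤ (∸≢0⇒< b<x)) (λ _ → ℕ.≤-reflexive (trans (cong suc (sym x≡)) (ℕ.+-comm 1 x))) up ,
            inj₂ (k , (lo , ℕ.≤-refl) , subst₂ _<_ x≡ i≡ (∸≢0⇒< x<i) , trans (ℕ.+-comm x 1) (cong suc x≡))
          worse : (x + 1) ∸ vars st₂ 9 ≡ 0 → Upper i (suc k) (vars st₂ 9) × Attained i (suc k) (vars st₂ 9)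
          worse x≤b = grow ℕ.≤-refl
              (λ _ → ℕ.≤-trans (ℕ.≤-reflexive (trans (cong suc (sym x≡)) (ℕ.+-comm 1 x))) (ℕ.m∸n≡0⇒m≤n x≤b)) up
                  , widen att
          later : vars st₂ 3 ∸ x ≡ 0 → Upper i (suc k) (vars st₂ 9) × Attained i (suc k) (vars st₂ 9)
          later i≤x = grow ℕ.≤-refl (λ x<i → contradiction (subst₂ _≤_ i≡ x≡ (ℕ.m∸n≡0⇒m≤n i≤x)) (ℕ.<⇒≱ x<i)) up
              , widen att
        finish : ∀ st′ → Frame (arcs improveParent) st₁ st′ → Upper i (off (suc (R i))) (vars st′ 9) →
            Attained i (off (suc (R i))) (vars st′ 9) →
                 ∀ j → j < suc i → Spec j ((arrays st′ 5 [ vars st′ 3 ↦ vars st′ 9 ]) j)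
        finish st′ fr′ up att j (s≤s j≤i) with ℕ.m≤n⇒m<n∨m≡n j≤i
        ... | inj₂ refl =
            subst (Spec i)
                (sym (trans (cong (λ u → (arrays st′ 5 [ u ↦ vars st′ 9 ]) i) (trans (var-eq fr′ 3 refl) xi))
                    (update-≡ (arrays st′ 5) i)))
                            ((λ (l , l′) → up l l′) , att)
        ... | inj₁ j<i =
            subst (Spec j)
                (sym (trans (update-≢ (arrays st′ 5) (λ e → ℕ.<⇒≢ j<i (trans e (trans (var-eq fr′ 3 refl) xi))))
                            (cong (_$ j) (array-eq fr′ 5 refl)))) (done j j<i)

    locate-rule : ∀ {st} → Loaded st → arrays st 3 ≡ R →
      Runs locate st (4 + (n * 11 + 6 * arcCount)) (λ st′ → Located R (arrays st′ 4) (arrays st′ 5))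
    locate-rule {st₀} ld R≡ = runs-weaken (ℕ.≤-reflexive (arrange n arcCount))
      (fill-rule R id (n≡ ld) R-inj (λ i st i<n fr xi → cong₂ _$_ (trans (array-eq fr 3 refl) R≡) xi , xi)
       >> λ st′ fr (pos-R , _) →
           runs-map (λ st″ fr′ → subst (λ p → Located R p (arrays st″ 5)) (sym (array-eq fr′ 4 refl)))
         (findParents-rule (arrays st′ 4) (loaded-frame refl refl refl refl fr ld)
             (trans (array-eq fr 3 refl) R≡) refl (λ {i} → pos-R i)))
      where
      arrange : ∀ n a → 2 + n * 3 + (2 + (n * 8 + 6 * a)) ≡ 4 + (n * 11 + 6 * a)
      arrange = solve-∀

-- Breadth-first orders of trees

distance : Exp → Exp → Exp
distance e e′ = (e ⊖ e′) ⊕ (e′ ⊖ e)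

distance≡0⇒ : ∀ {a b} → (a ∸ b) + (b ∸ a) ≡ 0 → a ≡ b
distance≡0⇒ {a} {b} e = ℕ.≤-antisym (ℕ.m∸n≡0⇒m≤n (ℕ.m+n≡0⇒m≡0 (a ∸ b) e)) (ℕ.m∸n≡0⇒m≤n (ℕ.m+n≡0⇒n≡0 (a ∸ b) e))

⇒distance≡0 : ∀ {a b} → a ≡ b → (a ∸ b) + (b ∸ a) ≡ 0
⇒distance≡0 {a} refl = cong₂ _+_ (ℕ.n∸n≡0 a) (ℕ.n∸n≡0 a)

sumBelow-one : ∀ k → sumBelow k (λ _ → 1) ≡ k
sumBelow-one zero    = refl
sumBelow-one (suc k) = cong suc (sumBelow-one k)

-- Choosing a preimage for each `w` gives an injection of the numbers below `n` into those below
-- `i`. The value 0 of `index` from `n` on is a mere default.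
covered⇒≤ : ∀ {n i} (q : ℕ → ℕ) → (∀ w → w < n → ∃[ j ] (j < i × q j ≡ w)) → n ≤ i
covered⇒≤ {n} {i} q cover = subst₂ _≤_ (sumBelow-one n) (sumBelow-one i)
  (sumBelow-injective n index (λ _ → 1) index< (λ v w v<n w<n e →
    trans (sym (q-index v v<n)) (trans (cong q e) (q-index w w<n))))
  where
  index : ℕ → ℕ
  index w with w ℕ.<? n
  ... | yes l = proj₁ (cover w l)
  ... | no _  = 0
  index< : ∀ w → w < n → index w < i
  index< w l with w ℕ.<? n
  ... | yes l′ = proj₁ (proj₂ (cover w l′))
  ... | no ¬l  = contradiction l ¬l
  q-index : ∀ w → w < n → q (index w) ≡ w
  q-index w l with w ℕ.<? n
  ... | yes l′ = proj₂ (proj₂ (cover w l′))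
  ... | no ¬l  = contradiction l ¬l

-- Children are recognized among the neighbours of a vertex by their parent pointers, so no lists of
-- children have to be built.
enqueue breadthStep breadthFirst : Program
enqueue = assign 7 (read 1 (var 4)) ⨾
  ifNonZero (distance (read 2 (var 7)) (var 6)) skip
    (ifNonZero (distance (var 7) (var 1)) (write 3 (var 13) (var 7) ⨾ assign 13 (var 13 ⊕ lit 1)) skip)
breadthStep = assign 6 (read 3 (var 3)) ⨾ arcs enqueue
breadthFirst = write 3 (lit 0) (var 1) ⨾ assign 13 (lit 1) ⨾ assign 3 (lit 0) ⨾ loop 3 0 breadthStep

module BreadthFirst (N : Network) where
  open Network N
  open Routines N
  open Loaded

  -- `induct` expresses as an induction principle that the pointers lead from every vertex to `s`.
  record ParentPointers (P : ℕ → ℕ) : Set₁ where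
    field
      child-arc : ∀ {w} → w < n → w ≢ s → ∃[ k ] (IsArc (P w) k × tgt k ≡ w)
      induct    : (C : ℕ → Set) → C s → (∀ w → w < n → w ≢ s → C (P w) → C w) → ∀ w → w < n → C w

  module _ {P : ℕ → ℕ} (pp : ParentPointers P) where
    open ParentPointers pp

    -- The queue while the arcs k′ < k of its entry i are being scanned.
    record Queue (q : ℕ → ℕ) (tl i k : ℕ) : Set where
      field
        nonempty : 0 < tl
        i≤tl     : i ≤ tl
        first    : q 0 ≡ s
        q<       : ∀ {j} → j < tl → q j < n
        q-inj    : InjectiveBelow tl q
        origin   : ∀ {j} → 0 < j → j < tl → q j ≢ s × ∃[ j′ ] (j′ < j × P (q j) ≡ q j′ ×
                     (j′ < i ⊎ (j′ ≡ i × ∃[ k′ ] (IsArc (q i) k′ × k′ < k × tgt k′ ≡ q j))))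
        closed   : ∀ {j w} → j < i → w < n → w ≢ s → P w ≡ q j → ∃[ j′ ] (j′ < tl × q j′ ≡ w)
        scanned  : ∀ {k′} → IsArc (q i) k′ → k′ < k → tgt k′ ≢ s → P (tgt k′) ≡ q i →
            ∃[ j′ ] (j′ < tl × q j′ ≡ tgt k′)

    open Queue

    -- Were the queue exhausted at entry `i`, its entries would be closed under children, so by
    -- `induct` they would comprise all `n` vertices, against `i < n`.
    more : ∀ {q tl i k} → Queue q tl i k → i < n → i < tl
    more {q} {tl} {i} Q i<n with ℕ.m≤n⇒m<n∨m≡n (i≤tl Q)
    ... | inj₁ i<tl = i<tl
    ... | inj₂ refl =
        contradiction (covered⇒≤ q (induct (λ w → ∃[ j ] (j < tl × q j ≡ w)) (0 , nonempty Q , first Q)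
                        (λ { w w<n w≢s (j , j<i , e) → closed Q j<i w<n w≢s (sym e) }))) (ℕ.<⇒≱ i<n)

    next-round : ∀ {q tl i} → Queue q tl i (off (suc (q i))) → i < tl → Queue q tl (suc i) (off (q (suc i)))
    next-round {q} {tl} {i} Q i<tl = record
      { nonempty = nonempty Q ; i≤tl = i<tl ; first = first Q ; q< = q< Q ; q-inj = q-inj Q
      ; origin = λ 0<j j<tl → let ne , j′ , l , e , o = origin Q 0<j j<tl in ne , j′ , l , e , inj₁ (old o)
      ; closed = done
      ; scanned = λ (l , _) l′ → contradiction l (ℕ.<⇒≱ l′) }
      where
      old : ∀ {j j′ k} → j′ < i ⊎ (j′ ≡ i × ∃[ k′ ] (IsArc (q i) k′ × k′ < k × tgt k′ ≡ q j)) → j′ < suc i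
      old (inj₁ l)          = ℕ.m≤n⇒m≤1+n l
      old (inj₂ (refl , _)) = ℕ.≤-refl
      done : ∀ {j w} → j < suc i → w < n → w ≢ s → P w ≡ q j → ∃[ j′ ] (j′ < tl × q j′ ≡ w)
      done {j} {w} (s≤s j≤i) w<n w≢s e with ℕ.m≤n⇒m<n∨m≡n j≤i
      ... | inj₁ j<i = closed Q j<i w<n w≢s e
      ... | inj₂ refl with child-arc w<n w≢s
      ...   | k , arc , refl = scanned Q (subst (λ v → IsArc v k) e arc) (proj₂ (subst (λ v → IsArc v k) e arc))
          w≢s e

    ignore : ∀ {q tl i k} → Queue q tl i k → (tgt k ≢ s → P (tgt k) ≢ q i) → Queue q tl i (suc k)
    ignore {q} {tl} {i} {k} Q other = record
      { nonempty = nonempty Q ; i≤tl = i≤tl Q ; first = first Q ; q< = q< Q ; q-inj = q-inj Q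
      ; origin = λ 0<j j<tl → let ne , j′ , l , e , o = origin Q 0<j j<tl in ne , j′ , l , e , keep o
      ; closed = closed Q
      ; scanned = scan }
      where
      keep : ∀ {j j′} → j′ < i ⊎ (j′ ≡ i × ∃[ k′ ] (IsArc (q i) k′ × k′ < k × tgt k′ ≡ q j)) →
             j′ < i ⊎ (j′ ≡ i × ∃[ k′ ] (IsArc (q i) k′ × k′ < suc k × tgt k′ ≡ q j))
      keep (inj₁ l) = inj₁ l
      keep (inj₂ (e , k′ , a , l , t)) = inj₂ (e , k′ , a , ℕ.m≤n⇒m≤1+n l , t)
      scan : ∀ {k′} → IsArc (q i) k′ → k′ < suc k → tgt k′ ≢ s → P (tgt k′) ≡ q i →
          ∃[ j′ ] (j′ < tl × q j′ ≡ tgt k′)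
      scan arc (s≤s k′≤k) ne e with ℕ.m≤n⇒m<n∨m≡n k′≤k
      ... | inj₁ l = scanned Q arc l ne e
      ... | inj₂ refl = contradiction e (other ne)

    append : ∀ {q q′ tl i k} → Queue q tl i k → i < tl → IsArc (q i) k → tgt k ≢ s → P (tgt k) ≡ q i →
             (∀ {j} → j < tl → q′ j ≡ q j) → q′ tl ≡ tgt k → Queue q′ (suc tl) i (suc k)
    append {q} {q′} {tl} {i} {k} Q i<tl arc w≢s Pw≡ same new = record
      { nonempty = s≤s z≤n
      ; i≤tl = ℕ.m≤n⇒m≤1+n (i≤tl Q)
      ; first = trans (same (nonempty Q)) (first Q)
      ; q< = q<′ ; q-inj = inj ; origin = orig
      ; closed = λ j<i w<n ne e → found (closed Q j<i w<n ne (trans e (same (ℕ.<-trans j<i i<tl))))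
      ; scanned = scan }
      where
      w : ℕ
      w = tgt k
      split : ∀ {j} → j < suc tl → j < tl ⊎ j ≡ tl
      split (s≤s l) = ℕ.m≤n⇒m<n∨m≡n l
      -- An earlier occurrence of `w` would have come from the same parent, which by injectivity is
      -- the entry `i` now being scanned, and so from an earlier arc to `w`.
      fresh : ∀ {j} → j < tl → q j ≢ w
      fresh {zero} _ e = w≢s (trans (sym e) (first Q))
      fresh {suc j} j<tl e with origin Q (s≤s z≤n) j<tl
      ... | _ , j′ , l , Pe , inj₁ j′<i = ℕ.<⇒≢ j′<i (q-inj Q j′ i (ℕ.<-trans j′<i i<tl) i<tl
            (trans (sym Pe) (trans (cong P e) Pw≡)))
      ... | _ , _ , _ , _ , inj₂ (_ , k′ , arc′ , k′<k , t) =
          ℕ.<⇒≢ k′<k (tgt-inj (q< Q i<tl) arc′ arc (trans t e))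
      q<′ : ∀ {j} → j < suc tl → q′ j < n
      q<′ j< with split j<
      ... | inj₁ l    = subst (_< n) (sym (same l)) (q< Q l)
      ... | inj₂ refl = subst (_< n) (sym new) (tgt< (q< Q i<tl) arc)
      inj : InjectiveBelow (suc tl) q′
      inj a b a< b< e with split a< | split b<
      ... | inj₁ l    | inj₁ l′   = q-inj Q a b l l′ (trans (sym (same l)) (trans e (same l′)))
      ... | inj₁ l    | inj₂ refl = contradiction (trans (sym (same l)) (trans e new)) (fresh l)
      ... | inj₂ refl | inj₁ l    = contradiction (trans (sym (same l)) (trans (sym e) new)) (fresh l)
      ... | inj₂ refl | inj₂ refl = refl
      arc-at : ∀ {k′} → IsArc (q i) k′ → IsArc (q′ i) k′
      arc-at {k′} = subst (λ v → IsArc v k′) (sym (same i<tl))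
      orig : ∀ {j} → 0 < j → j < suc tl → q′ j ≢ s × ∃[ j′ ] (j′ < j × P (q′ j) ≡ q′ j′ ×
               (j′ < i ⊎ (j′ ≡ i × ∃[ k′ ] (IsArc (q′ i) k′ × k′ < suc k × tgt k′ ≡ q′ j))))
      orig {j} 0<j j< with split j<
      ... | inj₂ refl = (λ e → w≢s (trans (sym new) e)) ,
            i , i<tl , trans (cong P new) (trans Pw≡ (sym (same i<tl))) ,
                inj₂ (refl , k , arc-at arc , ℕ.≤-refl , sym new)
      ... | inj₁ l with origin Q 0<j l
      ...   | ne , j′ , j′<j , Pe , o = (λ e → ne (trans (sym (same l)) e)) ,
              j′ , j′<j , trans (cong P (same l)) (trans Pe (sym (same (ℕ.<-trans j′<j l)))) , keep o
        where
        keep : ∀ {j′} → j′ < i ⊎ (j′ ≡ i × ∃[ k′ ] (IsArc (q i) k′ × k′ < k × tgt k′ ≡ q j)) →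
               j′ < i ⊎ (j′ ≡ i × ∃[ k′ ] (IsArc (q′ i) k′ × k′ < suc k × tgt k′ ≡ q′ j))
        keep (inj₁ l′) = inj₁ l′
        keep (inj₂ (e , k′ , a , l′ , t)) = inj₂ (e , k′ , arc-at a , ℕ.m≤n⇒m≤1+n l′ , trans t (sym (same l)))
      found : ∀ {u} → ∃[ j′ ] (j′ < tl × q j′ ≡ u) → ∃[ j′ ] (j′ < suc tl × q′ j′ ≡ u)
      found (j′ , l , e) = j′ , ℕ.m≤n⇒m≤1+n l , trans (same l) e
      scan : ∀ {k′} → IsArc (q′ i) k′ → k′ < suc k → tgt k′ ≢ s → P (tgt k′) ≡ q′ i →
          ∃[ j′ ] (j′ < suc tl × q′ j′ ≡ tgt k′)
      scan {k′} arc′ (s≤s k′≤k) ne e with ℕ.m≤n⇒m<n∨m≡n k′≤k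
      ... | inj₁ l = found (scanned Q (subst (λ v → IsArc v k′) (same i<tl) arc′) l ne (trans e (same i<tl)))
      ... | inj₂ refl = tl , ℕ.≤-refl , new

    record TreeOrder (R : ℕ → ℕ) : Set where
      field
        isOrder : IsOrder R
        R0      : R 0 ≡ s
        earlier : ∀ {j} → 0 < j → j < n → R j ≢ s × ∃[ j′ ] (j′ < j × P (R j) ≡ R j′)

    start : ∀ {q} → q 0 ≡ s → Queue q 1 0 (off (q 0))
    start {q} q0 = record
      { nonempty = s≤s z≤n ; i≤tl = z≤n ; first = q0
      ; q< = λ { (s≤s z≤n) → subst (_< n) (sym q0) s<n }
      ; q-inj = λ { _ _ (s≤s z≤n) (s≤s z≤n) _ → refl }
      ; origin = λ { (s≤s _) (s≤s ()) }
      ; closed = λ () ; scanned = λ (l , _) l′ → contradiction l (ℕ.<⇒≱ l′) }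

    finished : ∀ {q tl k} → Queue q tl n k → TreeOrder q
    finished Q = record
      { isOrder = record { R< = λ l → q< Q (ℕ.<-≤-trans l (i≤tl Q))
                         ; R-inj = λ i j l l′ → q-inj Q i j (ℕ.<-≤-trans l (i≤tl Q)) (ℕ.<-≤-trans l′ (i≤tl Q)) }
      ; R0 = first Q
      ; earlier = λ 0<j j<n → let ne , j′ , l , e , _ = origin Q 0<j (ℕ.<-≤-trans j<n (i≤tl Q)) in ne , j′ , l , e }

    breadthFirst-rule : ∀ {st} → Loaded st → arrays st 2 ≡ P →
      Runs breadthFirst st (4 + (n * 6 + 7 * arcCount)) (λ st′ → TreeOrder (arrays st′ 3))
    breadthFirst-rule {st₀} ld P≡ = write-then (assign-then (assign-then
      (runs-map (λ _ _ Q → finished Q)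
        -- The visiting order is the queue itself, which grows during the sweep; the entries up to
        -- the current one no longer change, and this is all the amortisation needs.
        (loop-sweep {n = n} {w = degree} {c = 4} {d = 7} (λ st → arrays st 3)
            (λ i st → Inv i (arrays st 3) (vars st 13))
          refl refl refl (n≡ ld) (start (s≡ ld)) outer
          (λ st _ Q → (λ j l → IsOrder.R< (TreeOrder.isOrder (finished Q)) l) ,
              IsOrder.R-inj (TreeOrder.isOrder (finished Q)))))))
      where
      Inv : ℕ → (ℕ → ℕ) → ℕ → Set
      Inv i q tl = Queue q tl i (off (q i))
      st₁ : State
      st₁ = setVar 3 0 (setVar 13 1 (setCell 3 0 (vars st₀ 1) st₀))
      outer : ∀ i st → i < n → Frame (loop 3 0 breadthStep) st₁ st → vars st 3 ≡ i →
          Inv i (arrays st 3) (vars st 13) →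
              Runs breadthStep st (4 + 7 * degree (arrays st 3 i))
                (λ st′ → Inv (suc i) (arrays st′ 3) (vars st′ 13) ×
                    (∀ j → j ≤ i → arrays st′ 3 j ≡ arrays st 3 j))
      outer i st i<n fr xi Q = assign-then
        (runs-map (λ st′ fr′ (Q′ , i<tl , same) →
            next-round (subst (λ v → Queue (arrays st′ 3) (vars st′ 13) i (off (suc v))) (sym (same i ℕ.≤-refl))
                Q′) i<tl , same)
          (arcs-rule Scan refl refl (cong (arrays st 3) xi) (trans (array-eq fr 0 refl) (off≡ ld))
              (off-mono (q< Q i<tl₀))
            (Q , i<tl₀ , λ _ _ → refl) inner))
        where
        i<tl₀ : i < vars st 13
        i<tl₀ = more Q i<n
        v : ℕ
        v = arrays st 3 i
        Scan : ℕ → State → Set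
        Scan k st′ = Queue (arrays st′ 3) (vars st′ 13) i k × i < vars st′ 13 ×
            (∀ j → j ≤ i → arrays st′ 3 j ≡ arrays st 3 j)
        st₂ : State
        st₂ = setVar 6 (arrays st 3 (vars st 3)) st
        inner : ∀ k st₃ → off v ≤ k → k < off (suc v) → Frame (arcs enqueue) st₂ st₃ → vars st₃ 4 ≡ k →
            Scan k st₃ →
                Runs enqueue st₃ 5 (Scan (suc k))
        inner k st₃ lo hi fr₃ k≡ (Q₃ , i<tl , same) = assign-then
          (runs-if (λ d →
              runs-weaken z≤n
                  (runs-skip (ignore Q₃
                      (λ _ e → d (⇒distance≡0
                          (trans (cong P′ w≡) (trans (trans (cong (λ F → F (tgt k)) P′≡) e) (sym v≡))))) ,
                              i<tl , same)))
            (λ d → runs-if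
              (λ d′ → write-then (runs-assign
                (enqueued (trans (trans (sym (trans (cong P′ w≡) (cong (λ F → F (tgt k)) P′≡))) (distance≡0⇒ d))
                    v≡)
                          (λ e → d′ (⇒distance≡0 (trans w≡ (trans e (sym s≡₃))))))))
              (λ d′ → runs-weaken z≤n
                  (runs-skip (ignore Q₃
                      (λ w≢s → contradiction (trans (sym w≡) (trans (distance≡0⇒ d′) s≡₃)) w≢s) , i<tl ,
                          same)))))
          where
          w : ℕ
          w = arrays st₃ 1 (vars st₃ 4)
          P′ : ℕ → ℕ
          P′ = arrays st₃ 2
          w≡ : w ≡ tgt k
          w≡ = cong₂ _$_ (trans (array-eq fr₃ 1 refl) (trans (array-eq fr 1 refl) (tgt≡ ld))) k≡
          P′≡ : P′ ≡ P
          P′≡ = trans (array-eq fr₃ 2 refl) (trans (array-eq fr 2 refl) P≡)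
          s≡₃ : vars st₃ 1 ≡ s
          s≡₃ = trans (var-eq fr₃ 1 refl) (trans (var-eq fr 1 refl) (s≡ ld))
          v≡ : vars st₃ 6 ≡ arrays st₃ 3 i
          v≡ = trans (var-eq fr₃ 6 refl) (trans (cong (arrays st 3) xi) (sym (same i ℕ.≤-refl)))
          q′ : ℕ → ℕ
          q′ = arrays st₃ 3 [ vars st₃ 13 ↦ w ]
          enqueued : P (tgt k) ≡ arrays st₃ 3 i → tgt k ≢ s →
                     Queue q′ (vars st₃ 13 + 1) i (suc k) × i < vars st₃ 13 + 1 ×
                         (∀ j → j ≤ i → q′ j ≡ arrays st 3 j)
          enqueued Pw≡ w≢s =
            subst (λ t → Queue q′ t i (suc k)) (ℕ.+-comm 1 (vars st₃ 13))
              (append Q₃ i<tl (subst (λ u → IsArc u k) (sym (same i ℕ.≤-refl)) (lo , hi)) w≢s Pw≡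
                 (λ l → update-≢ (arrays st₃ 3) (ℕ.<⇒≢ l)) (trans (update-≡ (arrays st₃ 3) (vars st₃ 13)) w≡)) ,
            ℕ.<-≤-trans i<tl (ℕ.m≤m+n _ 1) ,
            λ j j≤i → trans (update-≢ (arrays st₃ 3) (ℕ.<⇒≢ (ℕ.≤-<-trans j≤i i<tl))) (same j j≤i)

-- Partition refinement

∈-grow : ∀ {h b : ℕ} {L L′} → (∀ x → x ∈ L′ ⇔ (x ≡ b ⊎ x ∈ L)) → ∀ {x} → x ∈ h ∷ L → x ∈ h ∷ L′
∈-grow mem (here e)  = here e
∈-grow mem (there m) = there (Equivalence.from (mem _) (inj₂ m))

∈-shrink : ∀ {h b : ℕ} {L L′} → (∀ x → x ∈ L′ ⇔ (x ≡ b ⊎ x ∈ L)) → ∀ {x} → x ∈ h ∷ L′ → x ≡ b ⊎ x ∈ h ∷ L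
∈-shrink mem (here e) = inj₂ (here e)
∈-shrink mem (there m) with Equivalence.to (mem _) m
... | inj₁ e  = inj₁ e
... | inj₂ m′ = inj₂ (there m′)

module Refinement (n : ℕ) where

  -- The classes 0, …, K - 1 of a partition of the positions, linked in increasing order of their keys.
  record Classes (cls twin next : ℕ → ℕ) (K : ℕ) (key : ℕ → ℕ) : Set where
    field
      κ     : ℕ → ℕ
      L     : List ℕ
      chain : Chain next κ 0 L
      ids<  : ∀ {c} → c ∈ 0 ∷ L → c < K
      twin< : ∀ c → twin c < K
      size  : K ≡ suc (length L)
      cls∈  : ∀ {x} → x < n → cls x ∈ 0 ∷ L
      κ-cls : ∀ {x} → x < n → κ (cls x) ≡ key x

  one-class : ∀ {cls twin next} → (∀ x → cls x ≡ 0) → (∀ x → twin x ≡ 0) → (∀ x → next x ≡ 0) →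
              Classes cls twin next 1 (λ _ → 0)
  one-class cls0 twin0 next0 = record
    { κ = λ _ → 0 ; L = [] ; chain = end (next0 0) ; ids< = λ { (here refl) → s≤s z≤n }
    ; twin< = λ c → s≤s (ℕ.≤-reflexive (twin0 c)) ; size = refl ; cls∈ = λ _ → here (cls0 _) ; κ-cls = λ _ →
        refl }

  -- The state within a round that started with the K₀ classes cls₀: the positions in S have been moved
  -- to the twins of their classes.  Keys are doubled at the start of a round, so that a twin fits
  -- directly behind its class.
  record Splitting (K₀ : ℕ) (cls₀ κ₀ : ℕ → ℕ) (S : ℕ → Set) (cls twin next : ℕ → ℕ) (K : ℕ) : Set where
    field
      κ          : ℕ → ℕ
      L          : List ℕ
      chain      : Chain next κ 0 L
      ids<       : ∀ {c} → c ∈ 0 ∷ L → c < K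
      twin<      : ∀ c → twin c < K
      size       : K ≡ suc (length L)
      K₀≤K       : K₀ ≤ K
      even       : ∀ {c} → c < K₀ → κ c ≡ 2 * κ₀ c
      fresh-next : ∀ {c} → c ∈ 0 ∷ L → c < K₀ → twin c < K₀ → next c < K₀
      twin∈      : ∀ {c} → c ∈ 0 ∷ L → c < K₀ → K₀ ≤ twin c → twin c ∈ L × κ (twin c) ≡ suc (κ c)
      cls₀∈      : ∀ {x} → x < n → cls₀ x ∈ 0 ∷ L
      cls₀<      : ∀ {x} → x < n → cls₀ x < K₀
      unmoved    : ∀ {x} → x < n → ¬ S x → cls x ≡ cls₀ x
      moved      : ∀ {x} → x < n → S x → cls x ∈ 0 ∷ L × κ (cls x) ≡ suc (2 * κ₀ (cls₀ x))

  start-round : ∀ {S cls twin next K key} (C : Classes cls twin next K key) → (∀ x → ¬ S x) →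
                Splitting K cls (Classes.κ C) S cls twin next K
  start-round {next = next} {K} C none = record
    { κ = λ c → 2 * Classes.κ C c ; L = L
    ; chain = chain-map (λ _ _ → refl) (λ _ _ _ _ → ℕ.*-monoʳ-< 2) chain
    ; ids< = ids< ; twin< = twin< ; size = size ; K₀≤K = ℕ.≤-refl ; even = λ _ → refl
    ; fresh-next = λ c∈ _ _ → next< (chain-next chain c∈)
    ; twin∈ = λ {c} _ _ l → contradiction (twin< c) (ℕ.≤⇒≯ l)
    ; cls₀∈ = cls∈ ; cls₀< = ids< ∘ cls∈ ; unmoved = λ _ _ → refl ; moved = λ {x} _ sx →
        contradiction sx (none x) }
    where
    open Classes C
    next< : ∀ {c} → next c ≡ 0 ⊎ (next c ∈ L × κ c < κ (next c)) → next c < K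
    next< (inj₁ e)       = subst (_< K) (sym e) (ids< (here refl))
    next< (inj₂ (m , _)) = ids< (there m)

  -- Doubling at the start of the round and adding one for the moved positions is the recursion of
  -- `horner`: a round appends one digit to every key.
  finish-round : ∀ {K₀ cls₀ κ₀ S cls twin next K} {key : ℕ → ℕ} (d : ℕ → Bool) →
      Splitting K₀ cls₀ κ₀ S cls twin next K →
                 (∀ {x} → x < n → κ₀ (cls₀ x) ≡ key x) → (∀ {x} → x < n → d x ≡ true → S x) →
                 (∀ {x} → x < n → d x ≡ false → ¬ S x) →
                 Classes cls twin next K (λ x → bit (d x) + 2 * key x)
  finish-round {κ₀ = κ₀} {cls = cls} {key = key} d P κ₀≡ yes-S no-S = record
    { κ = κ ; L = L ; chain = chain ; ids< = ids< ; twin< = twin< ; size = size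
    ; cls∈ = λ x<n → proj₁ (result x<n) ; κ-cls = λ x<n → proj₂ (result x<n) }
    where
    open Splitting P
    result : ∀ {x} → x < n → cls x ∈ 0 ∷ L × κ (cls x) ≡ bit (d x) + 2 * key x
    result {x} x<n with d x in dx
    ... | true  = proj₁ (moved x<n (yes-S x<n dx)) ,
                  trans (proj₂ (moved x<n (yes-S x<n dx))) (cong (λ h → suc (2 * h)) (κ₀≡ x<n))
    ... | false rewrite unmoved x<n (no-S x<n dx) =
                  cls₀∈ x<n , trans (even (cls₀< x<n)) (cong (2 *_) (κ₀≡ x<n))

  same-set : ∀ {K₀ cls₀ κ₀ S S′ cls twin next K} → (∀ x → S x ⇔ S′ x) →
             Splitting K₀ cls₀ κ₀ S cls twin next K → Splitting K₀ cls₀ κ₀ S′ cls twin next K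
  same-set eq P = record
    { Splitting P
    ; unmoved = λ {x} x<n ns → Splitting.unmoved P x<n (ns ∘ Equivalence.to (eq x))
    ; moved   = λ {x} x<n sx → Splitting.moved P x<n (Equivalence.from (eq x) sx) }

  -- The new class gets the number `K`. A value of `twin` below `K₀` is a leftover of an earlier
  -- round or the initial 0, so the array is never cleared between rounds. A class without a current
  -- twin is still followed by an old class (`fresh-next`), whose even key exceeds the odd key of
  -- the new twin.
  create-twin : ∀ {K₀ cls₀ κ₀ S cls twin next next′ K y} → Splitting K₀ cls₀ κ₀ S cls twin next K →
    y < n → let c = cls₀ y in twin c < K₀ → next′ c ≡ K → next′ K ≡ next c → (∀ x → x ≢ c → x ≢ K → next′ x ≡ next x) →
    Splitting K₀ cls₀ κ₀ S cls (twin [ c ↦ K ]) next′ (suc K)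
  create-twin {K₀} {cls₀} {κ₀} {S} {cls} {twin} {next} {next′} {K} {y} P y<n twin<K₀ next′c next′K next′old =
      record
    { κ = κ′ ; L = L′ ; chain = proj₁ (proj₂ inserted)
    ; ids< = λ m → [ (λ { refl → ℕ.≤-refl }) , (λ m′ → ℕ.m≤n⇒m≤1+n (ids< m′)) ]′ (∈-shrink mem m)
    ; twin< = twin′<
    ; size = cong suc (trans size (sym (proj₁ (proj₂ (proj₂ inserted)))))
    ; K₀≤K = ℕ.m≤n⇒m≤1+n K₀≤K
    ; even = λ l → trans (κ-old (ℕ.<-≤-trans l K₀≤K)) (even l)
    ; fresh-next = fresh-next′ ; twin∈ = twin′∈
    ; cls₀∈ = ∈-grow mem ∘ cls₀∈ ; cls₀< = cls₀<
    ; unmoved = unmoved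
    ; moved = λ x<n sx → let m , e = moved x<n sx in ∈-grow mem m , trans (κ-old (ids< m)) e }
    where
    open Splitting P
    c : ℕ
    c = cls₀ y
    c∈ : c ∈ 0 ∷ L
    c∈ = cls₀∈ y<n
    c<K : c < K
    c<K = ℕ.<-≤-trans (cls₀< y<n) K₀≤K
    κ′ : ℕ → ℕ
    κ′ = κ [ K ↦ suc (κ c) ]
    κ-old : ∀ {x} → x < K → κ′ x ≡ κ x
    κ-old l = update-≢ κ (ℕ.<⇒≢ l)
    behind : next c ≢ 0 → κ′ K < κ′ (next c)
    behind ne with chain-next chain c∈
    ... | inj₁ e = contradiction e ne
    ... | inj₂ (m , l) = subst₂ _<_ (sym (trans (update-≡ κ K) (cong suc (even (cls₀< y<n)))))
        (sym (trans (κ-old (ids< (there m))) (even next<K₀)))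
        (odd<even {κ₀ c} {κ₀ (next c)} (ℕ.*-cancelˡ-< 2 _ _ (subst₂ _<_ (even (cls₀< y<n)) (even next<K₀) l)))
      where
      next<K₀ : next c < K₀
      next<K₀ = fresh-next c∈ (cls₀< y<n) twin<K₀
    inserted : ∃[ L′ ] (Chain next′ κ′ 0 L′ × length L′ ≡ suc (length L) × (∀ x → x ∈ L′ ⇔ (x ≡ K ⊎ x ∈ L)))
    inserted = chain-insert
      (chain-map (λ _ _ → refl) (λ a b a∈ b∈ → subst₂ _<_ (sym (κ-old (ids< a∈))) (sym (κ-old (ids< b∈))))
          chain)
      c∈ (ℕ.m<n⇒n≢0 c<K) (subst₂ _<_ (sym (κ-old c<K)) (sym (update-≡ κ K)) ℕ.≤-refl) behind next′c next′K
      (λ x x∈ x≢c → next′old x x≢c (ℕ.<⇒≢ (ids< x∈)))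
    L′ : List ℕ
    L′ = proj₁ inserted
    mem : ∀ x → x ∈ L′ ⇔ (x ≡ K ⊎ x ∈ L)
    mem = proj₂ (proj₂ (proj₂ inserted))
    twin′< : ∀ x → (twin [ c ↦ K ]) x < suc K
    twin′< x with x ℕ.≟ c
    ... | yes refl = ℕ.≤-reflexive (cong suc (update-≡ twin c))
    ... | no x≢c   = ℕ.m≤n⇒m≤1+n (subst (_< K) (sym (update-≢ twin x≢c)) (twin< x))
    old∈ : ∀ {x} → x ∈ 0 ∷ L′ → x < K₀ → x ∈ 0 ∷ L
    old∈ m l with ∈-shrink mem m
    ... | inj₁ refl = contradiction K₀≤K (ℕ.<⇒≱ l)
    ... | inj₂ m′   = m′
    fresh-next′ : ∀ {x} → x ∈ 0 ∷ L′ → x < K₀ → (twin [ c ↦ K ]) x < K₀ → next′ x < K₀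
    fresh-next′ {x} m l t with x ℕ.≟ c
    ... | yes refl = contradiction K₀≤K (ℕ.<⇒≱ (subst (_< K₀) (update-≡ twin c) t))
    ... | no x≢c   = subst (_< K₀) (sym (next′old x x≢c (ℕ.<⇒≢ (ℕ.<-≤-trans l K₀≤K))))
                       (fresh-next (old∈ m l) l (subst (_< K₀) (update-≢ twin x≢c) t))
    twin′∈ : ∀ {x} → x ∈ 0 ∷ L′ → x < K₀ → K₀ ≤ (twin [ c ↦ K ]) x →
             (twin [ c ↦ K ]) x ∈ L′ × κ′ ((twin [ c ↦ K ]) x) ≡ suc (κ′ x)
    twin′∈ {x} m l t with x ℕ.≟ c
    ... | yes refl = subst (λ u → u ∈ L′ × κ′ u ≡ suc (κ′ c)) (sym (update-≡ twin c))
                       (Equivalence.from (mem K) (inj₁ refl) ,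
                           trans (update-≡ κ K) (cong suc (sym (κ-old c<K))))
    ... | no x≢c with twin∈ (old∈ m l) l (subst (K₀ ≤_) (update-≢ twin x≢c) t)
    ...   | t∈ , e = subst (λ u → u ∈ L′ × κ′ u ≡ suc (κ′ x)) (sym (update-≢ twin x≢c))
                       (Equivalence.from (mem (twin x)) (inj₂ t∈) ,
                        trans (κ-old (twin< x)) (trans e (cong suc (sym (κ-old (ℕ.<-≤-trans l K₀≤K))))))

  move : ∀ {K₀ cls₀ κ₀ S S′ cls twin next K y} → Splitting K₀ cls₀ κ₀ S cls twin next K →
         y < n → K₀ ≤ twin (cls₀ y) → (∀ x → S′ x ⇔ (S x ⊎ x ≡ y)) →
         Splitting K₀ cls₀ κ₀ S′ (cls [ y ↦ twin (cls₀ y) ]) twin next K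
  move {K₀} {cls₀} {κ₀} {S} {S′} {cls} {twin} {next} {K} {y} P y<n K₀≤ S′⇔ = record
    { Splitting P ; unmoved = unmoved′ ; moved = moved′ }
    where
    open Splitting P
    cls′ : ℕ → ℕ
    cls′ = cls [ y ↦ twin (cls₀ y) ]
    unmoved′ : ∀ {x} → x < n → ¬ S′ x → cls′ x ≡ cls₀ x
    unmoved′ {x} x<n ns = trans (update-≢ cls (λ e → ns (Equivalence.from (S′⇔ x) (inj₂ e))))
                                (unmoved x<n (ns ∘ Equivalence.from (S′⇔ x) ∘ inj₁))
    moved′ : ∀ {x} → x < n → S′ x → cls′ x ∈ 0 ∷ L × κ (cls′ x) ≡ suc (2 * κ₀ (cls₀ x))
    moved′ {x} x<n sx with x ℕ.≟ y
    ... | yes refl = subst (λ u → u ∈ 0 ∷ L × κ u ≡ suc (2 * κ₀ (cls₀ y))) (sym (update-≡ cls y))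
                       (there (proj₁ t) , trans (proj₂ t) (cong suc (even (cls₀< y<n))))
      where
      t : twin (cls₀ y) ∈ L × κ (twin (cls₀ y)) ≡ suc (κ (cls₀ y))
      t = twin∈ (cls₀∈ y<n) (cls₀< y<n) K₀≤
    ... | no x≢y with Equivalence.to (S′⇔ x) sx
    ...   | inj₁ sx′ = subst (λ u → u ∈ 0 ∷ L × κ u ≡ suc (2 * κ₀ (cls₀ x))) (sym (update-≢ cls x≢y))
        (moved x<n sx′)
    ...   | inj₂ e   = contradiction e x≢y

  -- Every position x gets a node K + x of its own behind the node of its class.
  nodeKey : (ℕ → ℕ) → ℕ → (ℕ → ℕ) → ℕ → ℕ
  nodeKey key K κ v with v ℕ.<? K
  ... | yes _ = κ v * n
  ... | no _  = key (v ∸ K) * n + (n ∸ (v ∸ K))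

  -- The factor `n` makes room for the positions behind each class. The term `n ∸ x` decreases
  -- because every position is inserted in front of the earlier ones of its class; building the
  -- preorder reverses siblings once more, so ties end up in the order of the positions. Position 0
  -- would collide with the next class, but as the root it gets no node.
  positionKey : (ℕ → ℕ) → ℕ → ℕ
  positionKey key x = key x * n + (n ∸ x)

  nodeKey-class : ∀ key {K} κ {v} → v < K → nodeKey key K κ v ≡ κ v * n
  nodeKey-class key {K} κ {v} l with v ℕ.<? K
  ... | yes _ = refl
  ... | no ¬l = contradiction l ¬l

  nodeKey-position : ∀ key K κ x → nodeKey key K κ (K + x) ≡ positionKey key x
  nodeKey-position key K κ x with (K + x) ℕ.<? K
  ... | yes l = contradiction l (ℕ.≤⇒≯ (ℕ.m≤m+n K x))
  ... | no _  = cong (positionKey key) (ℕ.m+n∸m≡n K x)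

  record Placed (K : ℕ) (key : ℕ → ℕ) (cls next : ℕ → ℕ) (i : ℕ) : Set where
    field
      κ     : ℕ → ℕ
      L M   : List ℕ
      K>0   : 0 < K
      cls∈  : ∀ {x} → x < n → cls x ∈ 0 ∷ L
      κ-cls : ∀ {x} → x < n → κ (cls x) ≡ key x
      ids<  : ∀ {c} → c ∈ 0 ∷ L → c < K
      chain : Chain next (nodeKey key K κ) 0 M
      old   : ∀ {c} → c ∈ 0 ∷ L → c ∈ 0 ∷ M
      new   : ∀ {y} → 1 ≤ y → y < i → K + y ∈ M
      only  : ∀ {v} → v ∈ 0 ∷ M → v < K ⊎ ∃[ y ] (v ≡ K + y × 1 ≤ y × y < i)
      size  : suc (suc (length M)) ≡ K + i

  start-placing : ∀ {cls twin next K key} → 1 ≤ n → Classes cls twin next K key → Placed K key cls next 1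
  start-placing {K = K} {key} 1≤n C = record
    { κ = κ ; L = L ; M = L ; K>0 = ids< (here refl) ; cls∈ = cls∈ ; κ-cls = κ-cls ; ids< = ids<
    ; chain = chain-map (λ _ _ → refl) (λ a b a∈ b∈ l → subst₂ _<_ (sym (nodeKey-class key κ (ids< a∈)))
                (sym (nodeKey-class key κ (ids< b∈))) (scale l)) chain
    ; old = id ; new = λ l l′ → contradiction l (ℕ.<⇒≱ l′) ; only = inj₁ ∘ ids<
    ; size = trans (cong suc (sym size)) (ℕ.+-comm 1 K) }
    where
    open Classes C
    scale : ∀ {a b} → a < b → a * n < b * n
    scale {a} {b} l = ℕ.<-≤-trans (ℕ.m<n+m (a * n) 1≤n) (ℕ.*-monoˡ-≤ n l)

  place-position : ∀ {K key cls next next′ i} → Placed K key cls next i → 1 ≤ i → i < n →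
    next′ (cls i) ≡ K + i → next′ (K + i) ≡ next (cls i) → (∀ x → x ≢ cls i → x ≢ K + i → next′ x ≡ next x) →
    Placed K key cls next′ (suc i)
  place-position {K} {key} {cls} {next} {next′} {i} P 1≤i i<n next′c next′b next′old = record
    { κ = κ ; L = L ; M = M′ ; K>0 = K>0 ; cls∈ = cls∈ ; κ-cls = κ-cls ; ids< = ids<
    ; chain = proj₁ (proj₂ inserted)
    ; old = ∈-grow mem ∘ old
    ; new = new′ ; only = only′
    ; size = trans (cong (2 +_) (proj₁ (proj₂ (proj₂ inserted)))) (trans (cong suc size) (sym (ℕ.+-suc K i))) }
    where
    open Placed P
    θ : ℕ → ℕ
    θ = nodeKey key K κ
    c∈ : cls i ∈ 0 ∷ M
    c∈ = old (cls∈ i<n)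
    θc : θ (cls i) ≡ key i * n
    θc = trans (nodeKey-class key κ (ids< (cls∈ i<n))) (cong (_* n) (κ-cls i<n))
    θb : θ (K + i) ≡ key i * n + (n ∸ i)
    θb = nodeKey-position key K κ i
    below-next : ∀ {a y} → 1 ≤ y → y < n → suc a * n ≤ a * n + (n ∸ y) → ⊥
    below-next {a} {y} 1≤y y<n l = ℕ.<⇒≱ (ℕ.+-monoʳ-< (a * n) (ℕ.∸-monoʳ-< 1≤y (ℕ.<⇒≤ y<n)))
                                  (subst (_≤ a * n + (n ∸ y)) (ℕ.+-comm n (a * n)) l)
    behind : next (cls i) ≢ 0 → θ (K + i) < θ (next (cls i))
    behind ne with chain-next chain c∈
    ... | inj₁ e = contradiction e ne
    ... | inj₂ (m , l) with only (there m)
    ...   | inj₁ class = subst₂ _<_ (sym θb) (sym θd) (ℕ.≰⇒> λ le →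
              below-next {key i} 1≤i i<n
                  (ℕ.≤-trans (ℕ.*-monoˡ-≤ n (ℕ.*-cancelʳ-< n (key i) (κ (next (cls i))) (subst₂ _<_ θc θd l)))
                      le))
      where
      θd : θ (next (cls i)) ≡ κ (next (cls i)) * n
      θd = nodeKey-class key κ class
    ...   | inj₂ (y , e , 1≤y , y<i) = subst₂ _<_ (sym θb) (sym θd)
              (ℕ.+-mono-≤-< (ℕ.*-monoˡ-≤ n key≤) (ℕ.∸-monoʳ-< y<i (ℕ.<⇒≤ i<n)))
      where
      θd : θ (next (cls i)) ≡ key y * n + (n ∸ y)
      θd = trans (cong θ e) (nodeKey-position key K κ y)
      key≤ : key i ≤ key y
      key≤ = ℕ.≮⇒≥ λ lt → below-next {key y} 1≤y (ℕ.<-trans y<i i<n)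
               (ℕ.≤-trans (ℕ.*-monoˡ-≤ n lt) (ℕ.<⇒≤ (subst₂ _<_ θc θd l)))
    θc<θb : θ (cls i) < θ (K + i)
    θc<θb = subst₂ _<_ (sym θc) (sym θb) (ℕ.m<m+n (key i * n) (ℕ.m<n⇒0<n∸m i<n))
    K+i≢0 : K + i ≢ 0
    K+i≢0 e = ℕ.<⇒≢ K>0 (sym (ℕ.m+n≡0⇒m≡0 K e))
    not-old : ∀ {x} → x ∈ 0 ∷ M → x ≢ K + i
    not-old m e with only m
    ... | inj₁ l = ℕ.<⇒≱ l (ℕ.≤-trans (ℕ.m≤m+n K i) (ℕ.≤-reflexive (sym e)))
    ... | inj₂ (y , e′ , _ , y<i) = ℕ.<⇒≢ y<i (ℕ.+-cancelˡ-≡ K y i (trans (sym e′) e))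
    inserted : ∃[ M′ ] (Chain next′ θ 0 M′ × length M′ ≡ suc (length M) × (∀ x → x ∈ M′ ⇔ (x ≡ K + i ⊎ x ∈ M)))
    inserted = chain-insert chain c∈ K+i≢0 θc<θb behind next′c next′b (λ x x∈ x≢c → next′old x x≢c (not-old x∈))
    M′ : List ℕ
    M′ = proj₁ inserted
    mem : ∀ x → x ∈ M′ ⇔ (x ≡ K + i ⊎ x ∈ M)
    mem = proj₂ (proj₂ (proj₂ inserted))
    new′ : ∀ {y} → 1 ≤ y → y < suc i → K + y ∈ M′
    new′ {y} 1≤y (s≤s y≤i) with ℕ.m≤n⇒m<n∨m≡n y≤i
    ... | inj₁ y<i  = Equivalence.from (mem _) (inj₂ (new 1≤y y<i))
    ... | inj₂ refl = Equivalence.from (mem _) (inj₁ refl)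
    only′ : ∀ {v} → v ∈ 0 ∷ M′ → v < K ⊎ ∃[ y ] (v ≡ K + y × 1 ≤ y × y < suc i)
    only′ m with ∈-shrink mem m
    ... | inj₁ e = inj₂ (i , e , 1≤i , ℕ.≤-refl)
    ... | inj₂ m′ with only m′
    ...   | inj₁ l = inj₁ l
    ...   | inj₂ (y , e , l , l′) = inj₂ (y , e , l , ℕ.m≤n⇒m≤1+n l′)

-- Building a preorder by inserting every vertex behind its parent

module Insertion (par key : ℕ → ℕ) where

  record Inserted (succ : ℕ → ℕ) (In : ℕ → Set) : Set where
    field
      q       : ℕ → ℕ
      N       : List ℕ
      chain   : Chain succ q 0 N
      members : ∀ x → x ∈ N ⇔ In x
      parent∈ : ∀ {x} → In x → par x ∈ 0 ∷ N
      parent< : ∀ {x} → In x → q (par x) < q x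
      nested  : ∀ {x y} → In x → In y → q (par x) < q y → q y < q x → q (par x) ≤ q (par y)
      sorted  : ∀ {c d} → In c → In d → par c ≡ par d → q c < q d → key d < key c

  inserted-cong : ∀ {succ In In′} → (∀ x → In x ⇔ In′ x) → Inserted succ In → Inserted succ In′
  inserted-cong eq I = record
    { q = q ; N = N ; chain = chain
    ; members = λ x →
        mk⇔ (Equivalence.to (eq x) ∘ Equivalence.to (members x)) (Equivalence.from (members x) ∘ back)
    ; parent∈ = parent∈ ∘ back ; parent< = parent< ∘ back
    ; nested = λ a b → nested (back a) (back b) ; sorted = λ a b → sorted (back a) (back b) }
    where
    open Inserted I
    back : ∀ {x} → _ → _
    back {x} = Equivalence.from (eq x)

  no-vertices : ∀ {succ In} → succ 0 ≡ 0 → (∀ x → ¬ In x) → Inserted succ In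
  no-vertices e none = record
    { q = λ _ → 0 ; N = [] ; chain = end e ; members = λ x → mk⇔ (λ ()) (λ i → contradiction i (none x))
    ; parent∈ = λ i → contradiction i (none _) ; parent< = λ i → contradiction i (none _)
    ; nested = λ i → contradiction i (none _) ; sorted = λ i → contradiction i (none _) }

  -- Behind its parent, `w` becomes the first child, which is its proper place since its key is the
  -- largest so far. Nothing comes between `w` and its parent, so nestedness survives. `shift` opens
  -- a gap at `suc (q p)` for the new value of `q`.
  insert-vertex : ∀ {succ succ′ In w} → Inserted succ In → w ≢ 0 → ¬ In w → par w ≡ 0 ⊎ In (par w) →
    (∀ {x} → In x → key x < key w) →
    succ′ (par w) ≡ w → succ′ w ≡ succ (par w) → (∀ x → x ≢ par w → x ≢ w → succ′ x ≡ succ x) →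
    Inserted succ′ (λ x → In x ⊎ x ≡ w)
  insert-vertex {succ} {succ′} {In} {w} I w≢0 w∉ p-in largest succ′p succ′w succ′old = record
    { q = q′ ; N = N′ ; chain = proj₁ (proj₂ inserted)
    ; members = λ x → mk⇔ (λ m → [ inj₂ , inj₁ ∘ Equivalence.to (members x) ]′ (Equivalence.to (mem x) m))
                          (λ i → Equivalence.from (mem x) ([ inj₂ ∘ Equivalence.from (members x) , inj₁ ]′ i))
    ; parent∈ = λ { (inj₁ i) → ∈-grow mem (parent∈ i) ; (inj₂ refl) → ∈-grow mem p∈ }
    ; parent< = λ { (inj₁ i) → up (parent∈ i) (in∈ i) (parent< i) ; (inj₂ refl) → p<w }
    ; nested = nested′ ; sorted = sorted′ }
    where
    open Inserted I
    p : ℕ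
    p = par w
    in∈ : ∀ {x} → In x → x ∈ 0 ∷ N
    in∈ i = there (Equivalence.from (members _) i)
    p∈ : p ∈ 0 ∷ N
    p∈ = [ here , in∈ ]′ p-in
    old≢w : ∀ {x} → x ∈ 0 ∷ N → x ≢ w
    old≢w (here refl) e = w≢0 (sym e)
    old≢w (there m) refl = w∉ (Equivalence.to (members w) m)
    shift : ℕ → ℕ
    shift z with z ℕ.≤? q p
    ... | yes _ = z
    ... | no _  = suc z
    shift-low : ∀ {z} → z ≤ q p → shift z ≡ z
    shift-low {z} l with z ℕ.≤? q p
    ... | yes _ = refl
    ... | no ¬l = contradiction l ¬l
    shift-high : ∀ {z} → q p < z → shift z ≡ suc z
    shift-high {z} l with z ℕ.≤? q p
    ... | yes l′ = contradiction l (ℕ.≤⇒≯ l′)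
    ... | no _   = refl
    shift-mono : ∀ {y z} → y < z → shift y < shift z
    shift-mono {y} {z} l with y ℕ.≤? q p | z ℕ.≤? q p
    ... | yes _ | yes _ = l
    ... | yes _ | no _  = ℕ.m≤n⇒m≤1+n l
    ... | no ¬a | yes b = contradiction (ℕ.≤-trans (ℕ.<⇒≤ l) b) ¬a
    ... | no _  | no _  = s≤s l
    shift-mono≤ : ∀ {y z} → y ≤ z → shift y ≤ shift z
    shift-mono≤ l with ℕ.m≤n⇒m<n∨m≡n l
    ... | inj₁ l′   = ℕ.<⇒≤ (shift-mono l′)
    ... | inj₂ refl = ℕ.≤-refl
    shift-reflects : ∀ {y z} → shift y < shift z → y < z
    shift-reflects l = ℕ.≰⇒> λ z≤y → ℕ.<⇒≱ l (shift-mono≤ z≤y)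
    q′ : ℕ → ℕ
    q′ = (shift ∘ q) [ w ↦ suc (q p) ]
    q-old : ∀ {x} → x ∈ 0 ∷ N → q′ x ≡ shift (q x)
    q-old m = update-≢ (shift ∘ q) (old≢w m)
    q-w : q′ w ≡ suc (q p)
    q-w = update-≡ (shift ∘ q) w
    up : ∀ {x y} → x ∈ 0 ∷ N → y ∈ 0 ∷ N → q x < q y → q′ x < q′ y
    up m m′ l = subst₂ _<_ (sym (q-old m)) (sym (q-old m′)) (shift-mono l)
    down : ∀ {x y} → x ∈ 0 ∷ N → y ∈ 0 ∷ N → q′ x < q′ y → q x < q y
    down m m′ l = shift-reflects (subst₂ _<_ (q-old m) (q-old m′) l)
    q-p : q′ p ≡ q p
    q-p = trans (q-old p∈) (shift-low ℕ.≤-refl)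
    p<w : q′ p < q′ w
    p<w = subst₂ _<_ (sym q-p) (sym q-w) ℕ.≤-refl
    <w⇒≤p : ∀ {x} → x ∈ 0 ∷ N → q′ x < q′ w → q x ≤ q p
    <w⇒≤p m l = ℕ.≮⇒≥ λ p<x → ℕ.<⇒≱ (subst₂ _<_ (trans (q-old m) (shift-high p<x)) q-w l) (ℕ.m≤n⇒m≤1+n p<x)
    behind : succ p ≢ 0 → q′ w < q′ (succ p)
    behind ne with chain-next chain p∈
    ... | inj₁ e = contradiction e ne
    ... | inj₂ (m , l) = subst₂ _<_ (sym q-w) (sym (trans (q-old (there m)) (shift-high l))) (s≤s l)
    inserted : ∃[ N′ ] (Chain succ′ q′ 0 N′ × length N′ ≡ suc (length N) × (∀ x → x ∈ N′ ⇔ (x ≡ w ⊎ x ∈ N)))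
    inserted = chain-insert (chain-map (λ _ _ → refl) (λ _ _ → up) chain) p∈ w≢0 p<w behind succ′p succ′w
      (λ x x∈ x≢p → succ′old x x≢p (old≢w x∈))
    N′ : List ℕ
    N′ = proj₁ inserted
    mem : ∀ x → x ∈ N′ ⇔ (x ≡ w ⊎ x ∈ N)
    mem = proj₂ (proj₂ (proj₂ inserted))
    nested′ : ∀ {x y} → In x ⊎ x ≡ w → In y ⊎ y ≡ w → q′ (par x) < q′ y → q′ y < q′ x → q′ (par x) ≤ q′ (par y)
    nested′ (inj₁ i) (inj₁ j) l l′ = subst₂ _≤_ (sym (q-old (parent∈ i))) (sym (q-old (parent∈ j)))
      (shift-mono≤ (nested i j (down (parent∈ i) (in∈ j) l) (down (in∈ j) (in∈ i) l′)))
    nested′ (inj₁ i) (inj₂ refl) l _ = subst₂ _≤_ (sym (q-old (parent∈ i))) (sym (q-old p∈))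
      (shift-mono≤ (<w⇒≤p (parent∈ i) l))
    nested′ (inj₂ refl) (inj₁ j) l l′ = contradiction (down p∈ (in∈ j) l) (ℕ.≤⇒≯ (<w⇒≤p (in∈ j) l′))
    nested′ (inj₂ refl) (inj₂ refl) _ _ = ℕ.≤-refl
    sorted′ : ∀ {c d} → In c ⊎ c ≡ w → In d ⊎ d ≡ w → par c ≡ par d → q′ c < q′ d → key d < key c
    sorted′ (inj₁ i) (inj₁ j) e l = sorted i j e (down (in∈ i) (in∈ j) l)
    sorted′ {c} (inj₁ i) (inj₂ refl) e l =
        contradiction (subst (λ u → q u < q c) e (parent< i)) (ℕ.≤⇒≯ (<w⇒≤p (in∈ i) l))
    sorted′ (inj₂ refl) (inj₁ j) e l = largest j
    sorted′ (inj₂ refl) (inj₂ refl) e l = contradiction l (ℕ.<-irrefl refl)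

-- Sorting a tree

does-true : ∀ {A : Set} (d : Dec A) → does d ≡ true → A
does-true (yes a) _ = a

while-loop : ∀ {e p st b b′} {Q R : State → Set} → ⟦ e ⟧ st ≢ 0 → Runs p st b Q →
             (∀ st′ → Frame p st st′ → Q st′ → Runs (while e p) st′ b′ R) → Runs (while e p) st (suc (b + b′)) R
while-loop n (runs d t q) k with k _ (frame d) q
... | runs d′ t′ r = runs (⇓loop n d d′) (s≤s (ℕ.+-mono-≤ t t′)) r

while-exit : ∀ {e p st} {R : State → Set} → ⟦ e ⟧ st ≡ 0 → R st → Runs (while e p) st 1 R
while-exit z r = runs (⇓exit z) ℕ.≤-refl r

-- Register 10 counts the classes, register 11 keeps their number at the start of the round,
-- register 14 holds the pivot and register 8 the current class or list node. Node `K + x` stands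
-- for position `x`; since position 0 has no node, `var 8 ⊖ var 10` is nonzero exactly at the nodes
-- of positions.
addTwin refineArc refineStep refine placeStep place insertVertex walkStep traverse sortTree : Program
addTwin = write 7 (var 8) (var 10) ⨾ write 8 (var 10) (read 8 (var 8)) ⨾ write 8 (var 8) (var 10) ⨾ assign 10
    (var 10 ⊕ lit 1)
refineArc = assign 7 (read 4 (read 1 (var 4))) ⨾
  ifNonZero (var 7 ⊖ var 14)
    (assign 8 (read 6 (var 7)) ⨾ ifNonZero (var 11 ⊖ read 7 (var 8)) addTwin skip ⨾ write 6 (var 7)
        (read 7 (var 8)))
    skip
refineStep = assign 14 ((var 0 ⊖ lit 1) ⊖ var 3) ⨾ assign 6 (read 3 (var 14)) ⨾ assign 11 (var 10) ⨾ arcs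
    refineArc
refine = assign 10 (lit 1) ⨾ assign 3 (lit 0) ⨾ loop 3 0 refineStep
placeStep = assign 8 (read 6 (var 3)) ⨾ write 8 (var 10 ⊕ var 3) (read 8 (var 8)) ⨾ write 8 (var 8)
    (var 10 ⊕ var 3)
place = assign 3 (lit 1) ⨾ loop 3 0 placeStep
insertVertex = assign 7 (var 8 ⊖ var 10) ⨾ assign 9 (read 5 (var 7) ⊖ lit 1) ⨾
  write 9 (var 7) (read 9 (var 9)) ⨾ write 9 (var 9) (var 7)
walkStep = ifNonZero (var 8 ⊖ var 10) insertVertex skip ⨾ assign 8 (read 8 (var 8))
traverse = assign 8 (read 8 (lit 0)) ⨾ while (var 8) walkStep
sortTree = refine ⨾ place ⨾ traverse

module TreeSort (N : Network) where
  open Network N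
  open Routines N
  open Loaded
  open Refinement n

  record Ranked (R pos : ℕ → ℕ) (adj : ℕ → ℕ → Bool) : Set where
    field
      isOrder : IsOrder R
      pos<    : ∀ {v} → v < n → pos v < n
      pos-R   : ∀ {i} → i < n → pos (R i) ≡ i
      R-pos   : ∀ {v} → v < n → R (pos v) ≡ v
      arc-adj : ∀ {i k} → i < n → IsArc (R i) k → adj i (pos (tgt k)) ≡ true
      adj-arc : ∀ {i x} → i < n → x < n → adj i x ≡ true → ∃[ k ] (IsArc (R i) k × pos (tgt k) ≡ x)
    open IsOrder isOrder public

  -- Running backwards gives the latest earlier neighbour the most significant digit, as in the
  -- comparison of labels.
  pivot : ℕ → ℕ
  pivot j = n ∸ 1 ∸ j

  pivot< : ∀ {j} → j < n → pivot j < n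
  pivot< {j} j<n = ℕ.≤-<-trans (ℕ.m∸n≤m (n ∸ 1) j) (ℕ.∸-monoʳ-< (s≤s z≤n) (ℕ.≤-trans (s≤s z≤n) j<n))

  j≤n∸1 : ∀ {j} → j < n → j ≤ n ∸ 1
  j≤n∸1 j<n = ℕ.∸-monoˡ-≤ 1 j<n

  pivot-involutive : ∀ {i} → i < n → pivot (pivot i) ≡ i
  pivot-involutive i<n = ℕ.m∸[m∸n]≡n (j≤n∸1 i<n)

  module _ {R pos adj} (rk : Ranked R pos adj) where
    open Ranked rk

    digit : ℕ → ℕ → Bool
    digit x j = adj (pivot j) x ∧ does (pivot j ℕ.<? x)

    rank : ℕ → ℕ
    rank x = horner (digit x) n

    pivots-injective : InjectiveBelow n (R ∘ pivot)
    pivots-injective a b a<n b<n e =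
        ℕ.∸-cancelˡ-≡ (j≤n∸1 a<n) (j≤n∸1 b<n) (R-inj (pivot a) (pivot b) (pivot< a<n) (pivot< b<n) e)

    -- The bound on the number of classes holds because each scanned arc creates at most one and
    -- each vertex is a pivot once. It is needed for the time of the traversal, which also walks
    -- over the classes.
    refine-rule : ∀ {st} → Loaded st → arrays st 3 ≡ R → arrays st 4 ≡ pos →
      (∀ x → arrays st 6 x ≡ 0) → (∀ x → arrays st 7 x ≡ 0) → (∀ x → arrays st 8 x ≡ 0) →
      Runs refine st (3 + (n * 8 + 11 * arcCount))
        (λ st′ → Classes (arrays st′ 6) (arrays st′ 7) (arrays st′ 8) (vars st′ 10) rank ×
            vars st′ 10 ≤ suc arcCount)
    refine-rule {st₀} ld R≡ pos≡ zero₆ zero₇ zero₈ = assign-then (assign-then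
      (runs-map (λ st′ _ (C , b) → C ,
          ℕ.≤-trans b (s≤s (sumBelow-injective n (R ∘ pivot) degree (λ j l → R< (pivot< l)) pivots-injective)))
        (loop-sweep {n = n} {w = degree} {c = 6} {d = 11} (λ _ → R ∘ pivot)
          (λ i st → Classes (arrays st 6) (arrays st 7) (arrays st 8) (vars st 10) (λ x → horner (digit x) i) ×
                    vars st 10 ≤ suc (sumBelow i (degree ∘ R ∘ pivot)))
          refl refl refl (n≡ ld) (one-class zero₆ zero₇ zero₈ , ℕ.≤-refl) outer
          (λ _ _ _ → (λ j l → R< (pivot< l)) , pivots-injective))))
      where
      st₁ : State
      st₁ = setVar 3 0 (setVar 10 1 st₀)
      outer : ∀ j st → j < n → Frame (loop 3 0 refineStep) st₁ st → vars st 3 ≡ j →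
              Classes (arrays st 6) (arrays st 7) (arrays st 8) (vars st 10) (λ x → horner (digit x) j) ×
                vars st 10 ≤ suc (sumBelow j (degree ∘ R ∘ pivot)) →
              Runs refineStep st (6 + 11 * degree (R (pivot j)))
                (λ st′ → (Classes (arrays st′ 6) (arrays st′ 7) (arrays st′ 8) (vars st′ 10)
                    (λ x → horner (digit x) (suc j)) ×
                          vars st′ 10 ≤ suc (sumBelow (suc j) (degree ∘ R ∘ pivot))) ×
                         (∀ i → i ≤ j → R (pivot i) ≡ R (pivot i)))
      outer j st j<n fr xj (C , K≤) = assign-then (assign-then (assign-then
        (runs-map (λ st′ _ (P , K≤′) →
            (finish-round (λ x → digit x j) P (Classes.κ-cls C) digit⇒S ¬digit⇒¬S , total K≤′) , λ _ _ → refl)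
          (arcs-rule Scan refl refl v≡ (trans (array-eq fr 0 refl) (off≡ ld)) (off-mono (R< (pivot< j<n)))
            (start-round C (λ x (k′ , l , l′ , _) → ℕ.<⇒≱ l′ l) ,
                ℕ.≤-reflexive (sym (trans (cong (K₀ +_) (ℕ.n∸n≡0 (off v))) (ℕ.+-identityʳ K₀))))
            inner))))
        where
        i v K₀ : ℕ
        i = pivot j
        v = R i
        K₀ = vars st 10
        cls₀ : ℕ → ℕ
        cls₀ = arrays st 6
        S : ℕ → ℕ → Set
        S k x = ∃[ k′ ] (off v ≤ k′ × k′ < k × pos (tgt k′) ≡ x × i < x)
        Scan : ℕ → State → Set
        Scan k st′ = Splitting K₀ cls₀ (Classes.κ C) (S k) (arrays st′ 6) (arrays st′ 7) (arrays st′ 8)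
            (vars st′ 10) ×
                     vars st′ 10 ≤ K₀ + (k ∸ off v)
        i≡ : vars st 0 ∸ 1 ∸ vars st 3 ≡ i
        i≡ = cong₂ (λ a b → a ∸ 1 ∸ b) (trans (var-eq fr 0 refl) (n≡ ld)) xj
        v≡ : arrays st 3 (vars st 0 ∸ 1 ∸ vars st 3) ≡ v
        v≡ = cong₂ _$_ (trans (array-eq fr 3 refl) R≡) i≡
        st₂ : State
        st₂ = setVar 11 K₀
            (setVar 6 (arrays st 3 (vars st 0 ∸ 1 ∸ vars st 3)) (setVar 14 (vars st 0 ∸ 1 ∸ vars st 3) st))
        digit⇒S : ∀ {x} → x < n → digit x j ≡ true → S (off (suc v)) x
        digit⇒S {x} x<n d with adj-arc (pivot< j<n) x<n (Bool.∧-conicalˡ (adj i x) _ d)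
        ... | k , (l , l′) , e = k , l , l′ , e , does-true (i ℕ.<? x) (Bool.∧-conicalʳ (adj i x) _ d)
        ¬digit⇒¬S : ∀ {x} → x < n → digit x j ≡ false → ¬ S (off (suc v)) x
        ¬digit⇒¬S d≡ d (k , l , l′ , refl , i<x) = false≢true d
          (cong₂ _∧_ (arc-adj (pivot< j<n) (l , l′)) (dec-true (i ℕ.<? pos (tgt k)) i<x))
        total : ∀ {K} → K ≤ K₀ + degree v → K ≤ suc (sumBelow (suc j) (degree ∘ R ∘ pivot))
        total l = ℕ.≤-trans l (ℕ.≤-trans (ℕ.+-monoˡ-≤ (degree v) K≤)
          (ℕ.≤-reflexive (cong suc (ℕ.+-comm (sumBelow j (degree ∘ R ∘ pivot)) (degree v)))))
        inner : ∀ k st₃ → off v ≤ k → k < off (suc v) → Frame (arcs refineArc) st₂ st₃ → vars st₃ 4 ≡ k →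
            Scan k st₃ →
                Runs refineArc st₃ 9 (Scan (suc k))
        inner k st₃ lo hi fr₃ k≡ (P , K≤′) = assign-then (runs-if
          (λ i<x → assign-then (_>>_ {Q = Mid}
             (runs-if (λ t → write-then (write-then (write-then (runs-assign (created i<x (∸≢0⇒< t))))))
                      (λ t → runs-weaken z≤n
                          (runs-skip (P , subst₂ (λ a c → a ≤ twin c) K₀≡ (c≡ i<x) (ℕ.m∸n≡0⇒m≤n t) ,
                              ℕ.m≤n⇒m≤1+n K≤′))))
             (λ st′ fr′ mid → runs-write (moved i<x st′ mid (var-eq fr′ 7 refl) (var-eq fr′ 8 refl)))))
          (λ x≤i → runs-weaken z≤n (runs-skip (same-set (λ y → mk⇔ widen (stays (ℕ.m∸n≡0⇒m≤n x≤i))) P ,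
             ℕ.≤-trans K≤′ (ℕ.+-monoʳ-≤ K₀ (ℕ.∸-monoˡ-≤ (off v) (ℕ.n≤1+n k)))))))
          where
          x K : ℕ
          x = arrays st₃ 4 (arrays st₃ 1 (vars st₃ 4))
          K = vars st₃ 10
          cls twin next : ℕ → ℕ
          cls  = arrays st₃ 6
          twin = arrays st₃ 7
          next = arrays st₃ 8
          x≡ : x ≡ pos (tgt k)
          x≡ = cong₂ _$_ (trans (array-eq fr₃ 4 refl) (trans (array-eq fr 4 refl) pos≡))
                 (cong₂ _$_ (trans (array-eq fr₃ 1 refl) (trans (array-eq fr 1 refl) (tgt≡ ld))) k≡)
          i≡₃ : vars st₃ 14 ≡ i
          i≡₃ = trans (var-eq fr₃ 14 refl) i≡
          K₀≡ : vars st₃ 11 ≡ K₀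
          K₀≡ = var-eq fr₃ 11 refl
          v<n : v < n
          v<n = R< (pivot< j<n)
          tgtk<n : tgt k < n
          tgtk<n = tgt< v<n (lo , hi)
          x<n : x < n
          x<n = subst (_< n) (sym x≡) (pos< tgtk<n)
          widen : ∀ {y} → S k y → S (suc k) y
          widen (k′ , l , l′ , rest) = k′ , l , ℕ.m≤n⇒m≤1+n l′ , rest
          split : ∀ {y} → S (suc k) y → S k y ⊎ (y ≡ x × i < y)
          split (k′ , l , s≤s l′ , e , i<y) with ℕ.m≤n⇒m<n∨m≡n l′
          ... | inj₁ k′<k = inj₁ (k′ , l , k′<k , e , i<y)
          ... | inj₂ refl = inj₂ (trans (sym e) (sym x≡) , i<y)
          stays : x ≤ vars st₃ 14 → ∀ {y} → S (suc k) y → S k y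
          stays x≤i s with split s
          ... | inj₁ s′ = s′
          ... | inj₂ (refl , i<x) = contradiction i<x (ℕ.≤⇒≯ (subst (x ≤_) i≡₃ x≤i))
          untouched : ¬ S k x
          untouched (k′ , l , l′ , e , _) = ℕ.<⇒≢ l′ (tgt-inj v<n (l , ℕ.<-trans l′ hi) (lo , hi)
            (trans (sym (R-pos (tgt< v<n (l , ℕ.<-trans l′ hi)))) (trans (cong R (trans e x≡)) (R-pos tgtk<n))))
          c≡ : x ∸ vars st₃ 14 ≢ 0 → cls x ≡ cls₀ x
          c≡ _ = Splitting.unmoved P x<n untouched
          -- Whether or not a twin had to be created, the class of `x` now has one belonging to this
          -- round.
          Mid : State → Set
          Mid st′ = Splitting K₀ cls₀ (Classes.κ C) (S k) (arrays st′ 6) (arrays st′ 7) (arrays st′ 8)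
              (vars st′ 10) ×
                    K₀ ≤ arrays st′ 7 (cls₀ x) × vars st′ 10 ≤ suc (K₀ + (k ∸ off v))
          next′ : ℕ → ℕ → ℕ
          next′ c = (next [ K ↦ next c ]) [ c ↦ K ]
          created : x ∸ vars st₃ 14 ≢ 0 → twin (cls x) < vars st₃ 11 →
                    Splitting K₀ cls₀ (Classes.κ C) (S k) cls (twin [ cls x ↦ K ]) (next′ (cls x)) (K + 1) ×
                    K₀ ≤ (twin [ cls x ↦ K ]) (cls₀ x) × K + 1 ≤ suc (K₀ + (k ∸ off v))
          created i<x t =
              subst (λ c → Splitting K₀ cls₀ (Classes.κ C) (S k) cls (twin [ c ↦ K ]) (next′ c) (K + 1) ×
                                  K₀ ≤ (twin [ c ↦ K ]) (cls₀ x) × K + 1 ≤ suc (K₀ + (k ∸ off v)))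
                                      (sym (c≡ i<x))
            (subst (Splitting K₀ cls₀ (Classes.κ C) (S k) cls (twin [ c₀ ↦ K ]) (next′ c₀)) (ℕ.+-comm 1 K)
               (create-twin P x<n (subst₂ (λ c a → twin c < a) (c≡ i<x) K₀≡ t)
                   (update-≡ (next [ K ↦ next c₀ ]) c₀)
                 (trans (update-≢ (next [ K ↦ next c₀ ]) (λ e → ℕ.<⇒≢ c₀<K (sym e))) (update-≡ next K))
                 (λ y y≢c y≢K → trans (update-≢ (next [ K ↦ next c₀ ]) y≢c) (update-≢ next y≢K))) ,
             ℕ.≤-trans (Splitting.K₀≤K P) (ℕ.≤-reflexive (sym (update-≡ twin c₀))) ,
             ℕ.≤-trans (ℕ.≤-reflexive (ℕ.+-comm K 1)) (s≤s K≤′))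
            where
            c₀ : ℕ
            c₀ = cls₀ x
            c₀<K : c₀ < K
            c₀<K = ℕ.<-≤-trans (Splitting.cls₀< P x<n) (Splitting.K₀≤K P)
          moved : x ∸ vars st₃ 14 ≢ 0 → ∀ st′ → Mid st′ → vars st′ 7 ≡ x → vars st′ 8 ≡ cls x →
                  Splitting K₀ cls₀ (Classes.κ C) (S (suc k))
                      (arrays st′ 6 [ vars st′ 7 ↦ arrays st′ 7 (vars st′ 8) ])
                    (arrays st′ 7) (arrays st′ 8) (vars st′ 10) × vars st′ 10 ≤ K₀ + (suc k ∸ off v)
          moved i<x st′ (P′ , K₀≤ , K≤″) e e′ =
            subst₂ (λ y c → Splitting K₀ cls₀ (Classes.κ C) (S (suc k)) (arrays st′ 6 [ y ↦ arrays st′ 7 c ])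
                              (arrays st′ 7) (arrays st′ 8) (vars st′ 10)) (sym e) (sym (trans e′ (c≡ i<x)))
              (move P′ x<n K₀≤ (λ y → mk⇔ (λ s → [ inj₁ , inj₂ ∘ proj₁ ]′ (split s))
                 [ widen , (λ { refl → k , lo , ℕ.≤-refl , sym x≡ , subst (_< x) i≡₃ (∸≢0⇒< i<x) }) ]′)) ,
            ℕ.≤-trans K≤″
                (ℕ.≤-reflexive (trans (sym (ℕ.+-suc K₀ (k ∸ off v))) (cong (K₀ +_) (sym (ℕ.+-∸-assoc 1 lo)))))

    place-rule : ∀ {st} → Loaded st → Classes (arrays st 6) (arrays st 7) (arrays st 8) (vars st 10) rank →
      Runs place st (2 + n * 5) (λ st′ → Placed (vars st 10) rank (arrays st 6) (arrays st′ 8) n)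
    place-rule {st₀} ld C = assign-then (runs-weaken (s≤s (ℕ.*-monoˡ-≤ 5 (ℕ.m∸n≤m n 1)))
      (loop-const (λ i st → Placed (vars st₀ 10) rank (arrays st₀ 6) (arrays st 8) i) refl refl refl (n≡ ld)
        1≤n (start-placing 1≤n C)
        (λ { _ st 1≤i i<n fr refl P → assign-then (write-then (runs-write
           (placed st 1≤i i<n (array-eq fr 6 refl) (var-eq fr 10 refl) P))) })))
      where
      1≤n : 1 ≤ n
      1≤n = ℕ.≤-trans (s≤s z≤n) s<n
      placed : ∀ st → 1 ≤ vars st 3 → vars st 3 < n → arrays st 6 ≡ arrays st₀ 6 → vars st 10 ≡ vars st₀ 10 →
               Placed (vars st₀ 10) rank (arrays st₀ 6) (arrays st 8) (vars st 3) →
               let node = vars st 10 + vars st 3 ; c = arrays st 6 (vars st 3) in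
               Placed (vars st₀ 10) rank (arrays st₀ 6) ((arrays st 8 [ node ↦ arrays st 8 c ]) [ c ↦ node ])
                   (suc (vars st 3))
      placed st 1≤i i<n e₆ e₁₀ P rewrite e₆ | e₁₀ = place-position P 1≤i i<n
        (update-≡ (next [ node ↦ next c ]) c)
        (trans (update-≢ (next [ node ↦ next c ]) (λ e → ℕ.<⇒≢ c<node (sym e))) (update-≡ next node))
        (λ x x≢c x≢node → trans (update-≢ (next [ node ↦ next c ]) x≢c) (update-≢ next x≢node))
        where
        next : ℕ → ℕ
        next = arrays st 8
        node c : ℕ
        node = vars st₀ 10 + vars st 3
        c = arrays st₀ 6 (vars st 3)
        c<node : c < node
        c<node = ℕ.<-≤-trans (Placed.ids< P (Placed.cls∈ P i<n)) (ℕ.m≤m+n (vars st₀ 10) (vars st 3))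

    nodeOrder : ℕ → ℕ
    nodeOrder = positionKey rank

    IsVertex : ℕ → Set
    IsVertex x = 1 ≤ x × x < n

    module _ {par : ℕ → ℕ} (par< : ∀ {x} → IsVertex x → par x < x) (par-adj : ∀ {x} → IsVertex x → adj (par x) x ≡ true) where
      open Insertion par nodeOrder

      -- The most significant digit of x is that of its parent, and the parent has no digit so high.
      rank-parent : ∀ {x} → IsVertex x → rank (par x) < rank x
      rank-parent {x} vx@(_ , x<n) = ℕ.≰⇒> λ le →
        let e , e<a , pe , _ = horner≤⇒ n le (pivot p) (pivot< p<n) bit-x bit-p
        in ℕ.<⇒≱ (subst (_< pivot e) (pivot-involutive p<n) (ℕ.∸-monoʳ-< e<a (j≤n∸1 (pivot< p<n))))
                 (ℕ.<⇒≤ (does-true (pivot e ℕ.<? p) (Bool.∧-conicalʳ (adj (pivot e) p) _ pe)))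
        where
        p : ℕ
        p = par x
        p<n : p < n
        p<n = ℕ.<-trans (par< vx) x<n
        bit-x : digit x (pivot p) ≡ true
        bit-x = trans (cong (λ i → adj i x ∧ does (i ℕ.<? x)) (pivot-involutive p<n))
                      (cong₂ _∧_ (par-adj vx) (dec-true (p ℕ.<? x) (par< vx)))
        bit-p : digit p (pivot p) ≡ false
        bit-p = trans (cong (λ i → adj i p ∧ does (i ℕ.<? p)) (pivot-involutive p<n))
                      (trans (cong (adj p p ∧_) (dec-false (p ℕ.<? p) (ℕ.<-irrefl refl)))
                          (Bool.∧-zeroʳ (adj p p)))

      nodeOrder-parent : ∀ {x} → IsVertex x → nodeOrder (par x) < nodeOrder x
      nodeOrder-parent {x} vx@(_ , x<n) = begin-strict
        rank (par x) * n + (n ∸ par x) ≤⟨ ℕ.+-monoʳ-≤ (rank (par x) * n) (ℕ.m∸n≤m n (par x)) ⟩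
        rank (par x) * n + n           ≡⟨ ℕ.+-comm (rank (par x) * n) n ⟩
        suc (rank (par x)) * n         ≤⟨ ℕ.*-monoˡ-≤ n (rank-parent vx) ⟩
        rank x * n                     <⟨ ℕ.m<m+n (rank x * n) (ℕ.m<n⇒0<n∸m x<n) ⟩
        rank x * n + (n ∸ x)           ∎
        where open ℕ.≤-Reasoning

      -- The list yields the vertices with increasing `nodeOrder`. Hence each vertex has the largest
      -- key so far when it is inserted, and by `nodeOrder-parent` its parent is already there. At
      -- class nodes nothing is inserted.
      traverse-rule : ∀ {st cls} → (∀ x → arrays st 5 x ∸ 1 ≡ par x) → (∀ x → arrays st 9 x ≡ 0) →
        Placed (vars st 10) rank cls (arrays st 8) n →
        Runs traverse st (2 + 7 * (vars st 10 + n)) (λ st′ → Inserted (arrays st′ 9) IsVertex)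
      traverse-rule {st₀} {cls} par≡ zero₉ P = assign-then (runs-weaken (s≤s (ℕ.*-monoʳ-≤ 7 length≤))
        (go 0 M st₁ frame-refl refl chain (λ m → only (there m)) (λ vx → inj₂ (new (proj₁ vx) (proj₂ vx)))
          (no-vertices (zero₉ 0) nothing)))
        where
        open Placed P
        K : ℕ
        K = vars st₀ 10
        θ next : ℕ → ℕ
        θ = nodeKey rank K κ
        next = arrays st₀ 8
        st₁ : State
        st₁ = setVar 8 (next 0) st₀
        length≤ : length M ≤ K + n
        length≤ = subst (length M ≤_) size (ℕ.m≤n⇒m≤1+n (ℕ.n≤1+n (length M)))
        UpTo : ℕ → ℕ → Set
        UpTo h x = IsVertex x × nodeOrder x ≤ θ h
        θ-node : ∀ x → θ (K + x) ≡ nodeOrder x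
        θ-node = nodeKey-position rank K κ
        nothing : ∀ x → ¬ UpTo 0 x
        nothing x ((1≤x , x<n) , le) = ℕ.<⇒≱ (subst (θ 0 <_) (θ-node x) (chain-head< chain (new 1≤x x<n))) le
        vertex-step : ∀ {h w L′ succ} → Chain next θ (K + w) L′ → θ h < θ (K + w) → IsVertex w →
          (∀ {x} → IsVertex x → nodeOrder x ≤ θ h ⊎ K + x ∈ (K + w) ∷ L′) →
          Inserted succ (UpTo h) → Inserted ((succ [ w ↦ succ (par w) ]) [ par w ↦ w ]) (UpTo (K + w))
        vertex-step {h} {w} {L′} {succ} ch h<w vw@(1≤w , w<n) known I = inserted-cong
          (λ x → mk⇔ [ (λ (vx , le) → vx , ℕ.<⇒≤ (ℕ.≤-<-trans le h<w)) ,
              (λ { refl → vw , ℕ.≤-reflexive (sym (θ-node w)) }) ]′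
                     (λ (vx , le) → back vx le))
          (insert-vertex I (ℕ.m<n⇒n≢0 1≤w) (λ (_ , le) → ℕ.<⇒≱ (subst (θ h <_) (θ-node w) h<w) le) parent-in
            (λ (_ , le) → ℕ.≤-<-trans le (subst (θ h <_) (θ-node w) h<w))
            (update-≡ (succ [ w ↦ succ (par w) ]) (par w))
            (trans (update-≢ (succ [ w ↦ succ (par w) ]) (λ e → ℕ.<⇒≢ (par< vw) (sym e))) (update-≡ succ w))
            (λ x x≢p x≢w → trans (update-≢ (succ [ w ↦ succ (par w) ]) x≢p) (update-≢ succ x≢w)))
          where
          back : ∀ {x} → IsVertex x → nodeOrder x ≤ θ (K + w) → UpTo h x ⊎ x ≡ w
          back {x} vx le with known vx
          ... | inj₁ le′ = inj₁ (vx , le′)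
          ... | inj₂ (here e) = inj₂ (ℕ.+-cancelˡ-≡ K x w e)
          ... | inj₂ (there m) =
              contradiction (subst (_≤ θ (K + w)) (sym (θ-node x)) le) (ℕ.<⇒≱ (chain-head< ch m))
          parent-in : par w ≡ 0 ⊎ UpTo h (par w)
          parent-in with par w in e
          ... | zero = inj₁ refl
          ... | suc p with known {suc p} (s≤s z≤n , ℕ.<-trans (subst (_< w) e (par< vw)) w<n)
          ...   | inj₁ le = inj₂ ((s≤s z≤n , ℕ.<-trans (subst (_< w) e (par< vw)) w<n) , le)
          ...   | inj₂ m = contradiction (subst₂ _≤_ (θ-node w) (θ-node (suc p)) (chain-head≤ ch m))
                             (ℕ.<⇒≱ (subst (λ u → nodeOrder u < nodeOrder w) e (nodeOrder-parent vw)))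
        class-step : ∀ {h c L′ succ} → Chain next θ c L′ → θ h < θ c → c < K →
          (∀ {x} → IsVertex x → nodeOrder x ≤ θ h ⊎ K + x ∈ c ∷ L′) →
          Inserted succ (UpTo h) → Inserted succ (UpTo c)
        class-step {h} {c} ch h<c c<K known = inserted-cong
          (λ x → mk⇔ (λ (vx , le) → vx , ℕ.<⇒≤ (ℕ.≤-<-trans le h<c)) (λ (vx , le) → vx , back vx le))
          where
          back : ∀ {x} → IsVertex x → nodeOrder x ≤ θ c → nodeOrder x ≤ θ h
          back {x} vx le with known vx
          ... | inj₁ le′ = le′
          ... | inj₂ (here refl) = contradiction c<K (ℕ.≤⇒≯ (ℕ.m≤m+n K x))
          ... | inj₂ (there m) = contradiction (subst (_≤ θ c) (sym (θ-node x)) le) (ℕ.<⇒≱ (chain-head< ch m))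
        go : ∀ h L′ st → Frame (while (var 8) walkStep) st₁ st → vars st 8 ≡ next h → Chain next θ h L′ →
             (∀ {v} → v ∈ L′ → v < K ⊎ ∃[ y ] (v ≡ K + y × 1 ≤ y × y < n)) →
             (∀ {x} → IsVertex x → nodeOrder x ≤ θ h ⊎ K + x ∈ L′) →
             Inserted (arrays st 9) (UpTo h) →
             Runs (while (var 8) walkStep) st (suc (7 * length L′)) (λ st′ → Inserted (arrays st′ 9) IsVertex)
        go h [] st fr c≡ (end e) kind known I = while-exit (trans c≡ e)
          (inserted-cong (λ x → mk⇔ proj₁ (λ vx → vx , [ id , (λ ()) ]′ (known vx))) I)
        go h (c ∷ L′) st fr c≡ (link e c≢0 h<c ch) kind known I =
            runs-weaken (ℕ.≤-reflexive (arrange (length L′)))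
          (while-loop {b = 6} (λ z → c≢0 (trans (sym vc) z)) step
            (λ { st′ fr′ (c≡′ , I′) → go c L′ st′ (frame-trans fr (frame-mono (λ _ → id) (λ _ → id) fr′)) c≡′ ch
                   (kind ∘ there) known′ I′ }))
          where
          arrange : ∀ l → 1 + (6 + (1 + 7 * l)) ≡ 1 + 7 * (1 + l)
          arrange = solve-∀
          vc : vars st 8 ≡ c
          vc = trans c≡ e
          K≡ : vars st 10 ≡ K
          K≡ = var-eq fr 10 refl
          next≡ : arrays st 8 ≡ next
          next≡ = array-eq fr 8 refl
          known′ : ∀ {x} → IsVertex x → nodeOrder x ≤ θ c ⊎ K + x ∈ L′
          known′ {x} vx with known vx
          ... | inj₁ le = inj₁ (ℕ.<⇒≤ (ℕ.≤-<-trans le h<c))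
          ... | inj₂ (here refl) = inj₁ (ℕ.≤-reflexive (sym (θ-node x)))
          ... | inj₂ (there m) = inj₂ m
          grown : ∀ w → c ≡ K + w → IsVertex w →
                  Inserted ((arrays st 9 [ w ↦ arrays st 9 (par w) ]) [ par w ↦ w ]) (UpTo c)
          grown w refl vw = vertex-step ch h<c vw known I
          step : Runs walkStep st 6 (λ st′ → vars st′ 8 ≡ next c × Inserted (arrays st′ 9) (UpTo c))
          step = _>>_ {b = 5} {b′ = 1} {Q = λ st′ → Inserted (arrays st′ 9) (UpTo c)}
            (runs-if (λ big → assign-then (assign-then (write-then (runs-write (vertex-case big)))))
                     (λ small → runs-weaken z≤n (runs-skip (class-case small))))
            (λ st′ fr′ I′ →
                runs-assign (cong₂ _$_ (trans (array-eq fr′ 8 refl) next≡) (trans (var-eq fr′ 8 refl) vc) , I′))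
            where
            class-case : vars st 8 ∸ vars st 10 ≡ 0 → Inserted (arrays st 9) (UpTo c)
            class-case small with kind (here refl)
            ... | inj₁ c<K = class-step ch h<c c<K known I
            ... | inj₂ (y , refl , 1≤y , _) = contradiction (subst₂ (λ a b → a ∸ b ≡ 0) vc K≡ small)
                    (λ z → ℕ.m<n⇒n≢0 1≤y (trans (sym (ℕ.m+n∸m≡n K y)) z))
            vertex-case : vars st 8 ∸ vars st 10 ≢ 0 →
              let w = vars st 8 ∸ vars st 10 ; p = arrays st 5 w ∸ 1 in
              Inserted ((arrays st 9 [ w ↦ arrays st 9 p ]) [ p ↦ w ]) (UpTo c)
            vertex-case big with kind (here refl)
            ... | inj₁ c<K =
                contradiction (subst₂ (λ a b → a ∸ b ≡ 0) (sym vc) (sym K≡) (ℕ.m≤n⇒m∸n≡0 (ℕ.<⇒≤ c<K))) big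
            ... | inj₂ (y , c≡y , vy) =
                subst₂ (λ w p → Inserted ((arrays st 9 [ w ↦ arrays st 9 p ]) [ p ↦ w ]) (UpTo c))
                    (sym w≡) (sym
                        (trans (cong (λ u → arrays st 5 u ∸ 1) w≡)
                            (trans (cong (λ F → F y ∸ 1) (array-eq fr 5 refl)) (par≡ y))))
                    (grown y c≡y vy)
              where
              w≡ : vars st 8 ∸ vars st 10 ≡ y
              w≡ = trans (cong₂ _∸_ (trans vc c≡y) K≡) (ℕ.m+n∸m≡n K y)

      sortTree-rule : ∀ {st} → Loaded st → arrays st 3 ≡ R → arrays st 4 ≡ pos →
          (∀ x → arrays st 5 x ∸ 1 ≡ par x) →
        (∀ x → arrays st 6 x ≡ 0) → (∀ x → arrays st 7 x ≡ 0) → (∀ x → arrays st 8 x ≡ 0) →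
            (∀ x → arrays st 9 x ≡ 0) →
        Runs sortTree st (14 + (n * 20 + 18 * arcCount)) (λ st′ → Inserted (arrays st′ 9) IsVertex)
      sortTree-rule ld R≡ pos≡ par≡ zero₆ zero₇ zero₈ zero₉ = runs-weaken (ℕ.≤-reflexive (arrange n arcCount))
        (refine-rule ld R≡ pos≡ zero₆ zero₇ zero₈ >> λ st′ fr (C , K≤) →
          place-rule (loaded-frame refl refl refl refl fr ld) C >> λ st″ fr′ P →
            runs-weaken (ℕ.+-monoʳ-≤ 2
                (ℕ.*-monoʳ-≤ 7 (ℕ.+-monoˡ-≤ n (ℕ.≤-trans (ℕ.≤-reflexive (var-eq fr′ 10 refl)) K≤))))
              (traverse-rule
                  (λ x → trans (cong (λ F → F x ∸ 1) (trans (array-eq fr′ 5 refl) (array-eq fr 5 refl)))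
                      (par≡ x))
                (λ x → trans (cong (_$ x) (trans (array-eq fr′ 9 refl) (array-eq fr 9 refl))) (zero₉ x))
                (subst (λ k → Placed k rank _ (arrays st″ 8) n) (sym (var-eq fr′ 10 refl)) P)))
        where
        arrange : ∀ n a → 3 + (n * 8 + 11 * a) + (2 + n * 5 + (2 + 7 * (suc a + n))) ≡ 14 + (n * 20 + 18 * a)
        arrange = solve-∀

-- Reading off the order and embedding a program

walk : (ℕ → ℕ) → ℕ → ℕ → ℕ
walk next h zero    = h
walk next h (suc j) = next (walk next h j)

walk-shift : ∀ next h j → walk next h (suc j) ≡ walk next (next h) j
walk-shift next h zero    = refl
walk-shift next h (suc j) = cong next (walk-shift next h j)

module _ {next κ : ℕ → ℕ} where

  walk-∈ : ∀ {h L} → Chain next κ h L → ∀ j → j ≤ length L → walk next h j ∈ h ∷ L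
  walk-∈ c zero _ = here refl
  walk-∈ {h} (link refl _ _ c) (suc j) (s≤s l) = there (subst (_∈ _) (sym (walk-shift next h j)) (walk-∈ c j l))

  walk-covers : ∀ {h L x} → Chain next κ h L → x ∈ h ∷ L → ∃[ j ] (j ≤ length L × walk next h j ≡ x)
  walk-covers c (here refl) = 0 , z≤n , refl
  walk-covers {h} (link refl _ _ c) (there m) with walk-covers c m
  ... | j , l , e = suc j , s≤s l , trans (walk-shift next h j) e

  walk-increasing : ∀ {h L} → Chain next κ h L → ∀ i j → i < j → j ≤ length L →
      κ (walk next h i) < κ (walk next h j)
  walk-increasing {h} c@(link refl _ _ c′) zero (suc j) _ (s≤s l) =
    subst (λ u → κ h < κ u) (sym (walk-shift next h j)) (chain-head< c (walk-∈ c′ j l))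
  walk-increasing {h} (link refl _ _ c) (suc i) (suc j) (s≤s l) (s≤s l′) =
    subst₂ (λ u v → κ u < κ v) (sym (walk-shift next h i)) (sym (walk-shift next h j))
        (walk-increasing c i j l l′)

  walk-injective : ∀ {h L} → Chain next κ h L → InjectiveBelow (suc (length L)) (walk next h)
  walk-injective c i j (s≤s i≤) (s≤s j≤) e with ℕ.<-cmp i j
  ... | tri< l _ _ = contradiction (cong κ e) (ℕ.<⇒≢ (walk-increasing c i j l j≤))

  ... | tri≈ _ e′ _ = e′

  ... | tri> _ _ l = contradiction (cong κ (sym e)) (ℕ.<⇒≢ (walk-increasing c j i l i≤))

  chain-length : ∀ {L n} → 1 ≤ n → Chain next κ 0 L → (∀ x → x ∈ L ⇔ (1 ≤ x × x < n)) → suc (length L) ≡ n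
  chain-length {L} {n} 1≤n c mem = ℕ.≤-antisym
    (subst₂ _≤_ (sumBelow-one (suc (length L))) (sumBelow-one n)
      (sumBelow-injective (suc (length L)) (walk next 0) (λ _ → 1) (λ { j (s≤s l) → below (walk-∈ c j l) })
          (walk-injective c)))
    (covered⇒≤ (walk next 0) (λ w w<n → let j , l , e = walk-covers c (member w w<n) in j , s≤s l , e))
    where
    below : ∀ {x} → x ∈ 0 ∷ L → x < n
    below (here refl) = 1≤n
    below (there m)   = proj₂ (Equivalence.to (mem _) m)
    member : ∀ w → w < n → w ∈ 0 ∷ L
    member zero    _ = here refl
    member (suc w) l = there (Equivalence.from (mem _) (s≤s z≤n , l))

emitStep emit : Program
emitStep = write 10 (var 3) (read 3 (var 7)) ⨾ assign 7 (read 9 (var 7))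
emit = assign 7 (lit 0) ⨾ assign 3 (lit 0) ⨾ loop 3 0 emitStep

emit-rule : ∀ {st n} → vars st 0 ≡ n →
  Runs emit st (3 + n * 4) (λ st′ → ∀ j → j < n → arrays st′ 10 j ≡ arrays st 3 (walk (arrays st 9) 0 j))
emit-rule {st₀} {n} n≡ = assign-then (assign-then
  (runs-map (λ _ _ → proj₂)
    (loop-const Inv refl refl refl n≡ z≤n (refl , (λ _ ())) step)))
  where
  R succ : ℕ → ℕ
  R = arrays st₀ 3
  succ = arrays st₀ 9
  Inv : ℕ → State → Set
  Inv i st = vars st 7 ≡ walk succ 0 i × (∀ j → j < i → arrays st 10 j ≡ R (walk succ 0 j))
  step : ∀ i st → 0 ≤ i → i < n → Frame (loop 3 0 emitStep) (setVar 3 0 (setVar 7 0 st₀)) st → vars st 3 ≡ i →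
      Inv i st →
         Runs emitStep st 2 (λ st′ → Inv (suc i) (setVar 3 (vars st′ 3 + 1) st′))
  step _ st _ _ fr refl (x≡ , out) = write-then (runs-assign
    (cong₂ _$_ (array-eq fr 9 refl) x≡ , out′))
    where
    i : ℕ
    i = vars st 3
    out′ : ∀ j → j < suc i → (arrays st 10 [ i ↦ arrays st 3 (vars st 7) ]) j ≡ R (walk succ 0 j)
    out′ j (s≤s j≤i) with ℕ.m≤n⇒m<n∨m≡n j≤i
    ... | inj₁ j<i  = trans (update-≢ (arrays st 10) (ℕ.<⇒≢ j<i)) (out j j<i)
    ... | inj₂ refl = trans (update-≡ (arrays st 10) i) (cong₂ _$_ (array-eq fr 3 refl) x≡)

-- The input registers, the answer and the adjacency lists keep their names; the other names
-- of the embedded program are moved out of the way of the names used here.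
renameVar renameArray : Name → Name
renameVar 0 = 0
renameVar 1 = 1
renameVar 2 = 2
renameVar (suc (suc (suc x))) = 23 + x
renameArray 0 = 0
renameArray 1 = 1
renameArray (suc (suc a)) = 22 + a

renameVar-injective : ∀ {x y} → renameVar x ≡ renameVar y → x ≡ y
renameVar-injective {0} {0} _ = refl
renameVar-injective {1} {1} _ = refl
renameVar-injective {2} {2} _ = refl
renameVar-injective {suc (suc (suc x))} {suc (suc (suc y))} e = cong (3 +_) (ℕ.+-cancelˡ-≡ 23 x y e)
renameVar-injective {0} {1} ()
renameVar-injective {0} {2} ()
renameVar-injective {0} {suc (suc (suc _))} ()
renameVar-injective {1} {0} ()
renameVar-injective {1} {2} ()
renameVar-injective {1} {suc (suc (suc _))} ()
renameVar-injective {2} {0} ()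
renameVar-injective {2} {1} ()
renameVar-injective {2} {suc (suc (suc _))} ()
renameVar-injective {suc (suc (suc _))} {0} ()
renameVar-injective {suc (suc (suc _))} {1} ()
renameVar-injective {suc (suc (suc _))} {2} ()

renameArray-injective : ∀ {x y} → renameArray x ≡ renameArray y → x ≡ y
renameArray-injective {0} {0} _ = refl
renameArray-injective {1} {1} _ = refl
renameArray-injective {suc (suc x)} {suc (suc y)} e = cong (2 +_) (ℕ.+-cancelˡ-≡ 22 x y e)
renameArray-injective {0} {1} ()
renameArray-injective {0} {suc (suc _)} ()
renameArray-injective {1} {0} ()
renameArray-injective {1} {suc (suc _)} ()
renameArray-injective {suc (suc _)} {0} ()
renameArray-injective {suc (suc _)} {1} ()

renameExp : Exp → Exp
renameExp (lit k)    = lit k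
renameExp (var x)    = var (renameVar x)
renameExp (read a e) = read (renameArray a) (renameExp e)
renameExp (e ⊕ e′)   = renameExp e ⊕ renameExp e′
renameExp (e ⊖ e′)   = renameExp e ⊖ renameExp e′

rename : Program → Program
rename skip              = skip
rename (assign x e)      = assign (renameVar x) (renameExp e)
rename (write a e e′)    = write (renameArray a) (renameExp e) (renameExp e′)
rename (p ⨾ q)           = rename p ⨾ rename q
rename (ifNonZero e p q) = ifNonZero (renameExp e) (rename p) (rename q)
rename (while e p)       = while (renameExp e) (rename p)

-- Only the cells with renamed names are constrained, so whatever the surrounding program has left
-- elsewhere is harmless.
record Simulates (st st′ : State) : Set where
  field
    same-vars   : ∀ x → vars st′ (renameVar x) ≡ vars st x
    same-arrays : ∀ a i → arrays st′ (renameArray a) i ≡ arrays st a i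

open Simulates public

rename-exp : ∀ {st st′} → Simulates st st′ → ∀ e → ⟦ renameExp e ⟧ st′ ≡ ⟦ e ⟧ st
rename-exp sim (lit k)    = refl
rename-exp sim (var x)    = same-vars sim x
rename-exp {st} {st′} sim (read a e) =
  trans (cong (arrays st′ (renameArray a)) (rename-exp sim e)) (same-arrays sim a (⟦ e ⟧ st))
rename-exp sim (e ⊕ e′)   = cong₂ _+_ (rename-exp sim e) (rename-exp sim e′)
rename-exp sim (e ⊖ e′)   = cong₂ _∸_ (rename-exp sim e) (rename-exp sim e′)

private
  simulate-var : ∀ {st st′ k k′} → Simulates st st′ → ∀ x → k′ ≡ k →
                 Simulates (setVar x k st) (setVar (renameVar x) k′ st′)
  simulate-var {st} {st′} {k} sim x refl .same-vars y with y ℕ.≟ x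
  ... | yes refl = trans (update-≡ (vars st′) (renameVar x)) (sym (update-≡ (vars st) x))
  ... | no y≢x   =
      trans (update-≢ (vars st′) (y≢x ∘ renameVar-injective))
          (trans (same-vars sim y) (sym (update-≢ (vars st) y≢x)))
  simulate-var sim x refl .same-arrays = same-arrays sim

  simulate-cell : ∀ {st st′ i i′ k k′} → Simulates st st′ → ∀ a → i′ ≡ i → k′ ≡ k →
                  Simulates (setCell a i k st) (setCell (renameArray a) i′ k′ st′)
  simulate-cell sim a refl refl .same-vars = same-vars sim
  simulate-cell {st} {st′} {i} {k = k} sim a refl refl .same-arrays b j with b ℕ.≟ a
  ... | no b≢a = trans (cong (_$ j) (update-≢ (arrays st′) (b≢a ∘ renameArray-injective)))
                   (trans (same-arrays sim b j) (cong (_$ j) (sym (update-≢ (arrays st) b≢a))))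
  ... | yes refl = trans (cong (_$ j) (update-≡ (arrays st′) (renameArray a)))
                     (trans cell (cong (_$ j) (sym (update-≡ (arrays st) a))))
    where
    cell : (arrays st′ (renameArray a) [ i ↦ k ]) j ≡ (arrays st a [ i ↦ k ]) j
    cell with j ℕ.≟ i
    ... | yes refl = trans (update-≡ (arrays st′ (renameArray a)) i) (sym (update-≡ (arrays st a) i))
    ... | no j≢i   =
        trans (update-≢ (arrays st′ (renameArray a)) j≢i)
            (trans (same-arrays sim a j) (sym (update-≢ (arrays st a) j≢i)))

rename-run : ∀ {p st₁ st₂ t st₁′} → p ∣ st₁ ⇓ st₂ ∣ t → Simulates st₁ st₁′ →
             ∃[ st₂′ ] (rename p ∣ st₁′ ⇓ st₂′ ∣ t × Simulates st₂ st₂′)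
rename-run ⇓skip sim = _ , ⇓skip , sim
rename-run (⇓assign {x} {e}) sim = _ , ⇓assign , simulate-var sim x (rename-exp sim e)
rename-run (⇓write {a} {e} {e′}) sim = _ , ⇓write , simulate-cell sim a (rename-exp sim e) (rename-exp sim e′)
rename-run (⇓seq d d′) sim with rename-run d sim
... | _ , r , sim′ with rename-run d′ sim′
...   | _ , r′ , sim″ = _ , ⇓seq r r′ , sim″
rename-run (⇓then {e} n d) sim with rename-run d sim
... | _ , r , sim′ = _ , ⇓then (n ∘ trans (sym (rename-exp sim e))) r , sim′
rename-run (⇓else {e} z d) sim with rename-run d sim
... | _ , r , sim′ = _ , ⇓else (trans (rename-exp sim e) z) r , sim′
rename-run (⇓loop {e} n d d′) sim with rename-run d sim
... | _ , r , sim′ with rename-run d′ sim′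
...   | _ , r′ , sim″ = _ , ⇓loop (n ∘ trans (sym (rename-exp sim e))) r r′ , sim″
rename-run (⇓exit {e} z) sim = _ , ⇓exit (trans (rename-exp sim e) z) , sim

rename-decides : ∀ {p st st′ b} {P : Set} → DecidesWithin p st b P → Simulates st st′ →
                 Runs (rename p) st′ b (λ st″ → vars st″ 2 ≡ 1 ⇔ P)
rename-decides (_ , _ , d , t≤b , ans) sim with rename-run d sim
... | _ , r , sim′ = runs r t≤b (mk⇔ (Equivalence.to ans ∘ trans (sym (same-vars sim′ 2)))
                                     (trans (same-vars sim′ 2) ∘ Equivalence.from ans))

-- The input as a network

unique-⊆⇒length≤ : ∀ {A : Set} {xs ys : List A} → Unique xs → (∀ {x} → x ∈ xs → x ∈ ys) → length xs ≤ length ys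
unique-⊆⇒length≤ [] _ = z≤n
unique-⊆⇒length≤ {xs = x ∷ xs} {ys} (x∉ ∷ u) sub with ∈-∃++ (sub (here refl))
... | as , bs , refl =
    subst (suc (length xs) ≤_) (sym (List.length-++-sucʳ as x bs)) (s≤s (unique-⊆⇒length≤ u sub′))
  where
  sub′ : ∀ {y} → y ∈ xs → y ∈ as ++ bs
  sub′ {y} m with ∈-++⁻ as (sub (there m))
  ... | inj₁ l         = ∈-++⁺ˡ l
  ... | inj₂ (here e)  = contradiction (sym e) (All.lookup x∉ m)
  ... | inj₂ (there l) = ∈-++⁺ʳ as l

contents-applyUpTo : ∀ f m {i} → i < m → contents (applyUpTo f m) i ≡ f i
contents-applyUpTo f (suc m) {zero}  _       = refl
contents-applyUpTo f (suc m) {suc i} (s≤s l) = contents-applyUpTo (f ∘ suc) m l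

contents-tabulate : ∀ {n} (f : Fin n → ℕ) i → contents (tabulate f) (toℕ i) ≡ f i
contents-tabulate f zero    = refl
contents-tabulate f (suc i) = contents-tabulate (f ∘ suc) i

contents-beyond : ∀ xs {i} → length xs ≤ i → contents xs i ≡ 0
contents-beyond []       _       = refl
contents-beyond (x ∷ xs) (s≤s l) = contents-beyond xs l

contents-++ˡ : ∀ xs ys {i} → i < length xs → contents (xs ++ ys) i ≡ contents xs i
contents-++ˡ (x ∷ xs) ys {zero}  _       = refl
contents-++ˡ (x ∷ xs) ys {suc i} (s≤s l) = contents-++ˡ xs ys l

contents-++ʳ : ∀ xs ys i → contents (xs ++ ys) (length xs + i) ≡ contents ys i
contents-++ʳ []       ys i = refl
contents-++ʳ (x ∷ xs) ys i = contents-++ʳ xs ys i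

contents-∈ : ∀ {n} (xs : List (Fin n)) {j} → j < length xs → ∃[ w ] (w ∈ xs × contents (map toℕ xs) j ≡ toℕ w)
contents-∈ (x ∷ xs) {zero}  _       = x , here refl , refl
contents-∈ (x ∷ xs) {suc j} (s≤s l) = let w , m , e = contents-∈ xs l in w , there m , e

∈-contents : ∀ {n} {xs : List (Fin n)} {w} → w ∈ xs → ∃[ j ] (j < length xs × contents (map toℕ xs) j ≡ toℕ w)
∈-contents (here refl) = 0 , s≤s z≤n , refl
∈-contents (there m)   = let j , l , e = ∈-contents m in suc j , s≤s l , e

contents-unique : ∀ {n} {xs : List (Fin n)} → Unique xs → ∀ {i j} → i < length xs → j < length xs →
                  contents (map toℕ xs) i ≡ contents (map toℕ xs) j → i ≡ j
contents-unique (x∉ ∷ u) {zero} {zero} _ _ _ = refl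
contents-unique {xs = x ∷ xs} (x∉ ∷ u) {zero} {suc j} _ (s≤s l) e with contents-∈ xs l
... | w , m , e′ = contradiction (Fin.toℕ-injective (trans e e′)) (All.lookup x∉ m)
contents-unique {xs = x ∷ xs} (x∉ ∷ u) {suc i} {zero} (s≤s l) _ e with contents-∈ xs l
... | w , m , e′ = contradiction (Fin.toℕ-injective (trans (sym e) e′)) (All.lookup x∉ m)
contents-unique (x∉ ∷ u) {suc i} {suc j} (s≤s l) (s≤s l′) e = cong suc (contents-unique u l l′ e)

module _ {A : Set} where

  prefix : ∀ {n} → (Fin n → List A) → ℕ → ℕ
  prefix f i = sum (take i (map length (tabulate f)))

  prefix-suc : ∀ {n} (f : Fin n → List A) i → prefix f (suc (toℕ i)) ≡ prefix f (toℕ i) + length (f i)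
  prefix-suc f zero    = ℕ.+-identityʳ (length (f zero))
  prefix-suc f (suc i) = trans (cong (length (f zero) +_) (prefix-suc (f ∘ suc) i))
                               (sym (ℕ.+-assoc (length (f zero)) _ _))

  prefix-all : ∀ {n} (f : Fin n → List A) → prefix f n ≡ sum (map length (tabulate f))
  prefix-all {zero}  f = refl
  prefix-all {suc n} f = cong (length (f zero) +_) (prefix-all (f ∘ suc))

  contents-concat : ∀ (g : A → ℕ) {n} (f : Fin n → List A) i {j} → j < length (f i) →
                    contents (map g (concat (tabulate f))) (prefix f (toℕ i) + j) ≡ contents (map g (f i)) j
  contents-concat g f zero {j} l =
    trans (cong (λ xs → contents xs j) (List.map-++ g (f zero) _))
          (contents-++ˡ (map g (f zero)) _ (subst (j <_) (sym (List.length-map g (f zero))) l))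
  contents-concat g f (suc i) {j} l = begin
    contents (map g (f zero ++ rest)) (length (f zero) + prefix (f ∘ suc) (toℕ i) + j)
      ≡⟨ cong₂ contents (List.map-++ g (f zero) rest)
           (trans (ℕ.+-assoc (length (f zero)) _ j)
               (cong (_+ (prefix (f ∘ suc) (toℕ i) + j)) (sym (List.length-map g (f zero))))) ⟩
    contents (map g (f zero) ++ map g rest) (length (map g (f zero)) + (prefix (f ∘ suc) (toℕ i) + j))
      ≡⟨ contents-++ʳ (map g (f zero)) (map g rest) _ ⟩
    contents (map g rest) (prefix (f ∘ suc) (toℕ i) + j)
      ≡⟨ contents-concat g (f ∘ suc) i l ⟩
    contents (map g (f (suc i))) j ∎
    where
    open ≡-Reasoning
    rest : List A
    rest = concat (tabulate (f ∘ suc))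

module _ {n : ℕ} (G : SimpleGraph n) where
  open SimpleGraph G

  private
    Pair : Set
    Pair = Fin n × Fin n

    pairs edges : List Pair
    pairs = cartesianProduct (allFin n) (allFin n)
    edges = filter (λ (u , v) → (u Fin.<? v) ×-dec (u ~? v)) pairs

    adjacent? : (e : Pair) → Dec (proj₁ e ~ proj₂ e)
    adjacent? (u , v) = u ~? v

    orient : ∀ {e} → e ∈ filter adjacent? pairs → e ∈ edges ++ map swap edges
    orient {u , v} m with Fin.<-cmp u v | proj₂ (∈-filter⁻ adjacent? {xs = pairs} m)
    ... | tri< u<v _ _ | u~v = ∈-++⁺ˡ (∈-filter⁺ _ (∈-cartesianProduct⁺ (∈-allFin u) (∈-allFin v)) (u<v , u~v))
    ... | tri≈ _ refl _ | u~u = contradiction u~u ~-irrefl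
    ... | tri> _ _ v<u | u~v =
        ∈-++⁺ʳ edges (∈-map⁺ swap
            (∈-filter⁺ _ (∈-cartesianProduct⁺ (∈-allFin v) (∈-allFin u)) (v<u , ~-sym u~v)))

    adjacent-pairs≤ : length (filter adjacent? pairs) ≤ edgeCount G + edgeCount G
    adjacent-pairs≤ = ℕ.≤-trans
      (unique-⊆⇒length≤
          (Unique.filter⁺ adjacent? (Unique.cartesianProduct⁺ (Unique.allFin⁺ n) (Unique.allFin⁺ n))) orient)
      (ℕ.≤-reflexive (trans (List.length-++ edges) (cong (length edges +_) (List.length-map swap edges))))

  -- The handshake lemma: an ordered pair of adjacent vertices is an edge of the count or the
  -- reverse of one.
  sum-degrees≤ : (nb : Fin n → List (Fin n)) → (∀ u → Unique (nb u)) → (∀ {u v} → v ∈ nb u → u ~ v) →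
                 sum (map length (tabulate nb)) ≤ edgeCount G + edgeCount G
  sum-degrees≤ nb unique sound =
      ℕ.≤-trans (ℕ.≤-reflexive (cong (sum ∘ map length) (sym (List.map-tabulate id nb))))
    (ℕ.≤-trans (per-vertex (allFin n)) adjacent-pairs≤)
    where
    one-vertex : ∀ u → length (nb u) ≤ length (filter adjacent? (map (u ,_) (allFin n)))
    one-vertex u = ℕ.≤-trans (ℕ.≤-reflexive (sym (List.length-map (u ,_) (nb u))))
      (unique-⊆⇒length≤ (Unique.map⁺ (λ { refl → refl }) (unique u)) included)
      where
      included : ∀ {e} → e ∈ map (u ,_) (nb u) → e ∈ filter adjacent? (map (u ,_) (allFin n))
      included m with ∈-map⁻ (u ,_) m
      ... | v , v∈ , refl = ∈-filter⁺ adjacent? (∈-map⁺ (u ,_) (∈-allFin v)) (sound v∈)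
    per-vertex : ∀ us →
        sum (map length (map nb us)) ≤ length (filter adjacent? (cartesianProduct us (allFin n)))
    per-vertex [] = z≤n
    per-vertex (u ∷ us) = ℕ.≤-trans (ℕ.+-mono-≤ (one-vertex u) (per-vertex us))
      (ℕ.≤-reflexive (sym (trans (cong length (List.filter-++ adjacent? (map (u ,_) (allFin n)) _))
                                 (List.length-++ (filter adjacent? (map (u ,_) (allFin n)))))))

sumBelow-telescope : ∀ k (f : ℕ → ℕ) → (∀ {v} → v < k → f v ≤ f (suc v)) →
    sumBelow k (λ v → f (suc v) ∸ f v) + f 0 ≡ f k
sumBelow-telescope zero    f mono = refl
sumBelow-telescope (suc k) f mono =
  trans (ℕ.+-assoc (f (suc k) ∸ f k) _ (f 0))
        (trans (cong (f (suc k) ∸ f k +_) (sumBelow-telescope k f (λ l → mono (ℕ.m≤n⇒m≤1+n l))))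
            (ℕ.m∸n+n≡m (mono ℕ.≤-refl)))

module InputNetwork (G : Graph) (adj : AdjacencyLists G) (s : Graph.Vertex G) where
  open Graph G
  open AdjacencyLists adj

  input : State
  input = inputState G adj s []

  off tgt : ℕ → ℕ
  off = arrays input 0
  tgt = arrays input 1

  off-prefix : ∀ {i} → i ≤ n → off i ≡ prefix neighbours i
  off-prefix {i} l = trans (cong (λ xs → contents xs i) (List.map-upTo _ (suc n)))
    (trans (contents-applyUpTo (λ i → sum (take i (map length (map neighbours (allFin n))))) (suc n) (s≤s l))
        (cong (λ ls → sum (take i (map length ls))) (List.map-tabulate id neighbours)))

  off-suc : ∀ v → off (suc (toℕ v)) ≡ off (toℕ v) + length (neighbours v)
  off-suc v = trans (off-prefix (Fin.toℕ<n v)) (trans (prefix-suc neighbours v)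
    (cong (_+ length (neighbours v)) (sym (off-prefix (ℕ.<⇒≤ (Fin.toℕ<n v))))))

  tgt-at : ∀ v {j} → j < length (neighbours v) → tgt (off (toℕ v) + j) ≡ contents (map toℕ (neighbours v)) j
  tgt-at v {j} l =
      trans (cong₂ (λ ls o → contents (map toℕ (concat ls)) (o + j)) (List.map-tabulate id neighbours)
    (off-prefix (ℕ.<⇒≤ (Fin.toℕ<n v)))) (contents-concat toℕ neighbours v l)

  arc-index : ∀ v {k} → off (toℕ v) ≤ k → k < off (suc (toℕ v)) →
              ∃[ j ] (j < length (neighbours v) × k ≡ off (toℕ v) + j)
  arc-index v {k} l l′ = k ∸ off (toℕ v) ,
    ℕ.+-cancelˡ-< (off (toℕ v)) _ _ (subst₂ _<_ (sym (ℕ.m+[n∸m]≡n l)) (off-suc v) l′) , sym (ℕ.m+[n∸m]≡n l)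

  arc-sound : ∀ v {k} → off (toℕ v) ≤ k → k < off (suc (toℕ v)) → ∃[ w ] (v ~ w × tgt k ≡ toℕ w)
  arc-sound v l l′ with arc-index v l l′
  ... | j , j< , refl with contents-∈ (neighbours v) j<
  ...   | w , w∈ , e = w , Equivalence.to (complete v w) w∈ , trans (tgt-at v j<) e

  arc-complete : ∀ {v w} → v ~ w → ∃[ k ] ((off (toℕ v) ≤ k × k < off (suc (toℕ v))) × tgt k ≡ toℕ w)
  arc-complete {v} {w} v~w with ∈-contents (Equivalence.from (complete v w) v~w)
  ... | j , j< , e = off (toℕ v) + j ,
    (ℕ.m≤m+n _ j , subst (off (toℕ v) + j <_) (sym (off-suc v)) (ℕ.+-monoʳ-< (off (toℕ v)) j<)) ,
        trans (tgt-at v j<) e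

  on-vertex : ∀ (P : ℕ → Set) → (∀ (v : Fin n) → P (toℕ v)) → ∀ {v} → v < n → P v
  on-vertex P p l = subst P (Fin.toℕ-fromℕ< l) (p (fromℕ< l))

  network : Network
  network = record
    { n = n ; s = toℕ s ; off = off ; tgt = tgt ; s<n = Fin.toℕ<n s
    ; off-mono = on-vertex (λ v → off v ≤ off (suc v))
        (λ v → subst (off (toℕ v) ≤_) (sym (off-suc v)) (ℕ.m≤m+n _ _))
    ; tgt< = λ {v} {k} v<n → on-vertex (λ v → off v ≤ k × k < off (suc v) → tgt k < n)
        (λ v (l , l′) → let w , _ , e = arc-sound v l l′ in subst (_< n) (sym e) (Fin.toℕ<n w)) v<n
    ; tgt-inj = λ {v} {k} {k′} v<n → on-vertex
        (λ v → off v ≤ k × k < off (suc v) → off v ≤ k′ × k′ < off (suc v) → tgt k ≡ tgt k′ → k ≡ k′)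
            (λ v → distinct v) v<n }
    where
    distinct : ∀ v {k k′} → off (toℕ v) ≤ k × k < off (suc (toℕ v)) → off (toℕ v) ≤ k′ ×
        k′ < off (suc (toℕ v)) →
               tgt k ≡ tgt k′ → k ≡ k′
    distinct v (l , l′) (m , m′) e with arc-index v l l′ | arc-index v m m′
    ... | j , j< , refl | j′ , j′< , refl = cong (off (toℕ v) +_)
      (contents-unique (unique v) j< j′< (trans (sym (tgt-at v j<)) (trans e (tgt-at v j′<))))

  arcCount≤ : Network.arcCount network ≤ m + m
  arcCount≤ = begin
    Network.arcCount network                        ≤⟨ ℕ.m≤m+n _ (off 0) ⟩
    Network.arcCount network + off 0                ≡⟨ sumBelow-telescope n off (Network.off-mono network) ⟩
    off n                                           ≡⟨ trans (off-prefix ℕ.≤-refl) (prefix-all neighbours) ⟩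
    sum (map length (tabulate neighbours))          ≤⟨ sum-degrees≤ graph neighbours unique
        (λ {u} {v} → Equivalence.to (complete u v)) ⟩
    m + m                                           ∎
    where open ℕ.≤-Reasoning

-- LexDFS orders and ℒ-trees

does-false : ∀ {A : Set} (d : Dec A) → does d ≡ false → ¬ A
does-false (no ¬a) _ = ¬a

module Orders (G : Graph) (s : Graph.Vertex G) where
  open Graph G

  module _ (par : Vertex → Vertex) where
    open Search Fin._≟_ _~?_ ~-sym s par public

  module _ (σ : Order G) where

    position : Vertex → ℕ
    position v = toℕ (σ ⟨$⟩ˡ v)

    position-injective : Injective _≡_ _≡_ position
    position-injective {u} {v} e =
      trans (sym (inverseʳ σ)) (trans (cong (σ ⟨$⟩ʳ_) (Fin.toℕ-injective e)) (inverseʳ σ))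

    position-at : ∀ i → position (σ ⟨$⟩ʳ i) ≡ toℕ i
    position-at i = cong toℕ (inverseˡ σ)

    adjacentAt : Vertex → ℕ → Bool
    adjacentAt v j with j ℕ.<? n
    ... | yes l = does (σ ⟨$⟩ʳ fromℕ< l ~? v)
    ... | no _  = false

    adjacentAt-vertex : ∀ v u → adjacentAt v (position u) ≡ does (u ~? v)
    adjacentAt-vertex v u with position u ℕ.<? n
    ... | yes l = cong (λ w → does (w ~? v)) (trans (cong (σ ⟨$⟩ʳ_) (Fin.fromℕ<-toℕ (σ ⟨$⟩ˡ u) l)) (inverseʳ σ))
    ... | no ¬l = contradiction (Fin.toℕ<n (σ ⟨$⟩ˡ u)) ¬l

    adjacentAt-index : ∀ v i → adjacentAt v (toℕ i) ≡ does (σ ⟨$⟩ʳ i ~? v)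
    adjacentAt-index v i = trans (cong (adjacentAt v) (sym (position-at i))) (adjacentAt-vertex v (σ ⟨$⟩ʳ i))

    -- Cut off at the position of `v`, so that the label is frozen once `v` is numbered.
    earlierAt : Vertex → ℕ → Bool
    earlierAt v j = does (j ℕ.<? position v) ∧ adjacentAt v j

    earlierAt-below : ∀ {v j} → j < position v → earlierAt v j ≡ adjacentAt v j
    earlierAt-below {v} {j} l = cong (_∧ adjacentAt v j) (dec-true (j ℕ.<? position v) l)

    -- Labels in closed form. The root is numbered in the first round and never receives another
    -- number, so it keeps its initial label.
    runLabel : Vertex → ℕ → Label
    runLabel v i = if does (v Fin.≟ s) then 0 ∷ [] else labelOf (earlierAt v) i

    runLabel-root : ∀ i → runLabel s i ≡ 0 ∷ []
    runLabel-root i = cong (if_then 0 ∷ [] else labelOf (earlierAt s) i) (dec-true (s Fin.≟ s) refl)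

    runLabel-other : ∀ {v} i → v ≢ s → runLabel v i ≡ labelOf (earlierAt v) i
    runLabel-other {v} i n = cong (if_then 0 ∷ [] else labelOf (earlierAt v) i) (dec-false (v Fin.≟ s) n)

    runLabel-suc : position s ≡ 0 → ∀ v (i : Fin n) →
      runLabel v (suc (toℕ i)) ≡
      (if does (i Fin.<? σ ⟨$⟩ˡ v) ∧ does (σ ⟨$⟩ʳ i ~? v) then suc (toℕ i) ∷ runLabel v (toℕ i) else runLabel v
          (toℕ i))
    runLabel-suc s0 v i with v Fin.≟ s
    ... | no _ = cong
        (λ b → if does (i Fin.<? σ ⟨$⟩ˡ v) ∧ b then suc (toℕ i) ∷ labelOf (earlierAt v) (toℕ i) else labelOf
            (earlierAt v) (toℕ i))
                      (adjacentAt-index v i)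
    ... | yes refl rewrite dec-false (i Fin.<? σ ⟨$⟩ˡ s) (λ l → ℕ.<⇒≱ l (subst (_≤ toℕ i) (sym s0) z≤n)) = refl

    -- Initially all vertices other than `s` have the empty label, which is smaller than `0 ∷ []`.
    run⇒first : IsLexDFSOrder G s σ → position s ≡ 0
    run⇒first run = go (subst (_≤ₗₑₓ label zero (σ ⟨$⟩ʳ start)) (trans (init s) root-label) (choose′ s))
      where
      open LexDFSRun run
      root-label : initialLabel G s s ≡ 0 ∷ []
      root-label = cong (if_then 0 ∷ [] else []) (dec-true (s Fin.≟ s) refl)
      start : Fin n
      start = fromℕ< (ℕ.≤-<-trans z≤n (Fin.toℕ<n s))
      start≡0 : toℕ start ≡ 0
      start≡0 = Fin.toℕ-fromℕ< _
      first : Vertex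
      first = σ ⟨$⟩ʳ start
      choose′ : ∀ u → label zero u ≤ₗₑₓ label zero first
      choose′ u = subst (λ i → label i u ≤ₗₑₓ label i first)
        (Fin.toℕ-injective (trans (Fin.toℕ-inject₁ start) start≡0))
            (choose start u (subst (_≤ position u) (sym start≡0) z≤n))
      go : (0 ∷ []) ≤ₗₑₓ label zero first → position s ≡ 0
      go le with first Fin.≟ s | init first
      ... | yes e | _ = trans (cong position (sym e)) (trans (position-at start) start≡0)
      ... | no _  | e with subst ((0 ∷ []) ≤ₗₑₓ_) e le
      ...   | ()

    module _ (par : Vertex → Vertex) where

      -- When `b` is chosen, `c` is still unnumbered, so its label is at most that of `b`. As `a`
      -- speaks for `c`, the last difference lies behind `a` and speaks for `b`; the vertex at that
      -- position is `d`.
      run⇒FourPoint : IsLexDFSOrder G s σ → FourPoint par position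
      run⇒FourPoint run a b c a<b b<c a~c a≁b
        with label≤⇒ (position b) labels (position a) a<b
               (trans (earlierAt-below (ℕ.<-trans a<b b<c))
                   (trans (adjacentAt-vertex c a) (dec-true (a ~? c) a~c)))
               (trans (earlierAt-below a<b) (trans (adjacentAt-vertex b a) (dec-false (a ~? b) a≁b)))
        where
        open LexDFSRun run
        s0 : position s ≡ 0
        s0 = run⇒first run
        label≡ : ∀ v i → label i v ≡ runLabel v (toℕ i)
        label≡ v = <-weakInduction _ (init v) λ i ih → trans (update i v)
          (trans (cong (λ l → if does (i Fin.<? σ ⟨$⟩ˡ v) ∧ does (σ ⟨$⟩ʳ i ~? v) then suc (toℕ i) ∷ l else l)
                       (trans ih (cong (runLabel v) (Fin.toℕ-inject₁ i))))
                 (sym (runLabel-suc s0 v i)))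
        ≢s : ∀ {u v} → position u < position v → v ≢ s
        ≢s l refl = ℕ.<⇒≱ l (subst (_≤ _) (sym s0) z≤n)
        label-at : ∀ {v} → v ≢ s → label (inject₁ (σ ⟨$⟩ˡ b)) v ≡ labelOf (earlierAt v) (position b)
        label-at {v} ne = trans (label≡ v (inject₁ (σ ⟨$⟩ˡ b)))
          (trans (cong (runLabel v) (Fin.toℕ-inject₁ (σ ⟨$⟩ˡ b))) (runLabel-other (position b) ne))
        labels : labelOf (earlierAt c) (position b) ≤ₗₑₓ labelOf (earlierAt b) (position b)
        labels = subst₂ _≤ₗₑₓ_ (label-at (≢s b<c))
            (trans (cong (label (inject₁ (σ ⟨$⟩ˡ b))) (inverseʳ σ)) (label-at (≢s a<b)))
                   (choose (σ ⟨$⟩ˡ b) c (ℕ.<⇒≤ b<c))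
      ... | e , a<e , e<b , fb , fc = d , subst (position a <_) (sym d≡) a<e ,
          subst (_< position b) (sym d≡) e<b ,
              does-true (d ~? b) (trans (sym (trans (earlierAt-below e<b) (at b))) fb) ,
              does-false (d ~? c) (trans (sym (trans (earlierAt-below (ℕ.<-trans e<b b<c)) (at c))) fc)
        where
        i : Fin n
        i = fromℕ< (ℕ.<-trans e<b (Fin.toℕ<n (σ ⟨$⟩ˡ b)))
        d : Vertex
        d = σ ⟨$⟩ʳ i
        d≡ : position d ≡ e
        d≡ = trans (position-at i) (Fin.toℕ-fromℕ< _)
        at : ∀ v → adjacentAt v e ≡ does (d ~? v)
        at v = trans (cong (adjacentAt v) (sym d≡)) (adjacentAt-vertex v d)

      -- The labels are forced, so only the choices have to be justified. The root is chosen at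
      -- position 0, when all other labels are empty; elsewhere the four-point condition provides
      -- the later difference that favours the chosen vertex.
      FourPoint⇒run : position s ≡ 0 → FourPoint par position → IsLexDFSOrder G s σ
      FourPoint⇒run s0 four = record
        { label = λ i v → runLabel v (toℕ i)
        ; init = λ _ → refl
        ; choose = λ i u l → subst (λ k → runLabel u k ≤ₗₑₓ runLabel (σ ⟨$⟩ʳ i) k) (sym (Fin.toℕ-inject₁ i))
            (chosen i u l)
        ; update = λ i v →
            subst (λ k → runLabel v (suc (toℕ i)) ≡ (if does (i Fin.<? σ ⟨$⟩ˡ v) ∧ does (σ ⟨$⟩ʳ i ~? v)
            then suc (toℕ i) ∷ runLabel v k else runLabel v k)) (sym (Fin.toℕ-inject₁ i)) (runLabel-suc s0 v i)
                }
        where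
        chosen : ∀ i u → toℕ i ≤ position u → runLabel u (toℕ i) ≤ₗₑₓ runLabel (σ ⟨$⟩ʳ i) (toℕ i)
        chosen i u i≤u with ℕ.m≤n⇒m<n∨m≡n i≤u
        ... | inj₂ i≡u = subst (λ w → runLabel u (toℕ i) ≤ₗₑₓ runLabel w (toℕ i))
                           (position-injective (trans (sym i≡u) (sym (position-at i)))) (lex-refl _)
        ... | inj₁ i<u = later (b Fin.≟ s)
          where
          b : Vertex
          b = σ ⟨$⟩ʳ i
          u≢s : u ≢ s
          u≢s refl = ℕ.<⇒≱ i<u (subst (_≤ toℕ i) (sym s0) z≤n)
          later : Dec (b ≡ s) → runLabel u (toℕ i) ≤ₗₑₓ runLabel b (toℕ i)
          later (yes b≡s) =
              subst₂ _≤ₗₑₓ_ (sym (trans (runLabel-other (toℕ i) u≢s) (cong (labelOf (earlierAt u)) i≡0)))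
            (sym (trans (cong (λ w → runLabel w (toℕ i)) b≡s) (runLabel-root (toℕ i)))) Lex.halt
            where
            i≡0 : toℕ i ≡ 0
            i≡0 = trans (sym (position-at i)) (trans (cong position b≡s) s0)
          later (no b≢s) = subst₂ _≤ₗₑₓ_ (sym (runLabel-other (toℕ i) u≢s)) (sym (runLabel-other (toℕ i) b≢s))
            (⇒label≤ (toℕ i) dominated)
            where
            dominated : ∀ a → a < toℕ i → earlierAt u a ≡ true → earlierAt b a ≡ false →
                        ∃[ e ] (a < e × e < toℕ i × earlierAt b e ≡ true × earlierAt u e ≡ false)
            dominated a a<i fu fb
              with four v b u (subst₂ _<_ (sym v≡) (sym (position-at i)) a<i)
                  (subst (_< position u) (sym (position-at i)) i<u)
                     (does-true (v ~? u) (trans (sym (trans (earlierAt-below (ℕ.<-trans a<i i<u)) (at u))) fu))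
                     (does-false (v ~? b)
                         (trans (sym (trans (earlierAt-below (subst (a <_) (sym (position-at i)) a<i)) (at b)))
                             fb))
              where
              j : Fin n
              j = fromℕ< (ℕ.<-trans a<i (Fin.toℕ<n i))
              v : Vertex
              v = σ ⟨$⟩ʳ j
              v≡ : position v ≡ a
              v≡ = trans (position-at j) (Fin.toℕ-fromℕ< _)
              at : ∀ w → adjacentAt w a ≡ does (v ~? w)
              at w = trans (cong (adjacentAt w) (sym v≡)) (adjacentAt-vertex w v)
            ... | d , v<d , d<b , d~b , d≁u =
              position d , subst (_< position d) (trans (position-at _) (Fin.toℕ-fromℕ< _)) v<d , d<i ,
              trans (earlierAt-below d<b) (trans (adjacentAt-vertex b d) (dec-true (d ~? b) d~b)) ,
              trans (earlierAt-below (ℕ.<-trans d<i i<u))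
                  (trans (adjacentAt-vertex u d) (dec-false (d ~? u) d≁u))
              where
              d<i : position d < toℕ i
              d<i = subst (position d <_) (position-at i) d<b

  module _ {T : SpanningTree G} (pa : ParentArray G s T) where
    open SpanningTree T using (_~ₜ_) renaming (connected to T-connected)
    open ParentArray pa

    parent-edge : ∀ {v} → v ≢ s → v ~ₜ parent v
    parent-edge {v} ne = Equivalence.from (edges v (parent v)) (inj₁ (ne , refl))

    private
      infix 4 _⊑ₜ_
      _⊑ₜ_ : Vertex → Vertex → Set
      _⊑ₜ_ = _⊑_ parent

    -- That the pointers lead to the root is not part of `ParentArray`. It follows from the
    -- connectivity of the tree: the property passes along each edge of a path from `s`, in
    -- whichever direction the edge is oriented.
    root-above : ∀ v → s ⊑ₜ v
    root-above v = along (T-connected s v) here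
      where
      along : ∀ {u} → Star _~ₜ_ u v → s ⊑ₜ u → s ⊑ₜ v
      along ε p = p
      along {u} (_◅_ {j = w} e es) p with Equivalence.to (edges u w) e
      ... | inj₁ (u≢s , refl) = along es (proj₂ (⊑-proper parent p (λ e → u≢s (sym e))))
      ... | inj₂ (w≢s , refl) = along es (up w≢s p)

    private
      -- Pointers alternating between `v` and `parent v`, both different from `s`, would never reach
      -- `s`.
      no-two-cycle : ∀ {v w} → s ⊑ₜ w → w ≡ v ⊎ w ≡ parent v → v ≢ s → parent v ≢ s → parent (parent v) ≢ v
      no-two-cycle here     (inj₁ w≡v)  v≢s _    _ = v≢s (sym w≡v)
      no-two-cycle here     (inj₂ w≡pv) _   pv≢s _ = pv≢s (sym w≡pv)
      no-two-cycle (up _ p) (inj₁ w≡v)  v≢s pv≢s e = no-two-cycle p (inj₂ (cong parent w≡v)) v≢s pv≢s e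
      no-two-cycle (up _ p) (inj₂ w≡pv) v≢s pv≢s e =
          no-two-cycle p (inj₁ (trans (cong parent w≡pv) e)) v≢s pv≢s e

    module _ (σ : Order G) where

      rightmost-unique : ∀ {v w w′} → RightmostEarlierNeighbour G σ v w → RightmostEarlierNeighbour G σ v w′ →
          w ≡ w′
      rightmost-unique (w~v , w<v , w-max) (w′~v , w′<v , w′-max) =
        position-injective σ (ℕ.≤-antisym (w′-max _ w~v w<v) (w-max _ w′~v w′<v))

      -- `IsLTree` compares unoriented edges, so the edge between `v` and `parent v` might come from
      -- `parent v` choosing `v`. By induction from the root `parent v` chooses its own parent, and
      -- this would close a cycle of two pointers.
      IsLTree⇒LTree : IsLTree G σ s T → LTree parent (position σ)
      IsLTree⇒LTree (s0 , tree) v = go (root-above v)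
        where
        go : ∀ {v} → s ⊑ₜ v → v ≢ s → RightmostEarlierNeighbour G σ v (parent v)
        go here v≢s = contradiction refl v≢s
        go {v} r@(up _ p) v≢s with Equivalence.to (tree v (parent v)) (parent-edge v≢s)
        ... | inj₁ rm = rm
        ... | inj₂ rm with parent v Fin.≟ s
        ...   | yes pv≡s =
            contradiction (proj₁ (proj₂ rm))
                (ℕ.≤⇒≯ (subst (_≤ _) (sym (trans (cong (position σ) pv≡s) s0)) z≤n))
        ...   | no pv≢s = contradiction (rightmost-unique (go p pv≢s) rm) (no-two-cycle r (inj₁ refl) v≢s pv≢s)

      LTree⇒IsLTree : position σ s ≡ 0 → LTree parent (position σ) → IsLTree G σ s T
      LTree⇒IsLTree s0 lt = s0 , λ u v →
          mk⇔ (to u v ∘ Equivalence.to (edges u v)) (Equivalence.from (edges u v) ∘ from u v)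
        where
        to : ∀ u v → (u ≢ s × parent u ≡ v) ⊎ (v ≢ s × parent v ≡ u) → RightmostEarlierNeighbour G σ u v ⊎
            RightmostEarlierNeighbour G σ v u
        to u v (inj₁ (ne , refl)) = inj₁ (lt u ne)
        to u v (inj₂ (ne , refl)) = inj₂ (lt v ne)
        parent-of : ∀ {u v} → RightmostEarlierNeighbour G σ u v → u ≢ s × parent u ≡ v
        parent-of {u} {v} rm = u≢s , rightmost-unique (lt u u≢s) rm
          where
          u≢s : u ≢ s
          u≢s refl = ℕ.<⇒≱ (proj₁ (proj₂ rm)) (subst (_≤ position σ v) (sym s0) z≤n)
        from : ∀ u v → RightmostEarlierNeighbour G σ u v ⊎ RightmostEarlierNeighbour G σ v u →
            (u ≢ s × parent u ≡ v) ⊎ (v ≢ s × parent v ≡ u)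
        from u v (inj₁ rm) = inj₁ (parent-of rm)
        from u v (inj₂ rm) = inj₂ (parent-of rm)

-- Orders held in memory

-- If `v` were missed, weights 1 everywhere except 0 at `v` would sum to `n` along `r` but only to
-- `n - 1` over all numbers below `n`.
injective⇒surjective : ∀ {n r} → (∀ j → j < n → r j < n) → InjectiveBelow n r → ∀ {v} → v < n →
    ∃[ i ] (i < n × r i ≡ v)
injective⇒surjective {n} {r} r< inj {v} v<n with ℕ.anyUpTo? (λ i → r i ℕ.≟ v) n
... | yes (i , l , e) = i , l , e
... | no missed = contradiction (subst₂ _≤_ all-one refl (sumBelow-injective n r w r< inj))
                    (ℕ.<⇒≱ (ℕ.≤-reflexive (trans (sym (sumBelow-remove n (λ _ → 1) v<n)) refl)))
  where
  w : ℕ → ℕ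
  w = (λ _ → 1) [ v ↦ 0 ]
  all-one : sumBelow n (w ∘ r) ≡ sumBelow n (λ _ → 1)
  all-one = sumBelow-cong n (λ j l → update-≢ (λ _ → 1) (λ e → missed (j , l , e)))

module Context (G : Graph) (adj : AdjacencyLists G) (s : Graph.Vertex G) where
  open Graph G
  open InputNetwork G adj s using (network; arc-sound; arc-complete; off; tgt)
  open Network network using (IsArc)
  open Routines network
  open TreeSort network
  open Refinement n using (positionKey)
  open Orders G s

  vertexOf : ℕ → Vertex
  vertexOf k with k ℕ.<? n
  ... | yes l = fromℕ< l
  ... | no _  = s

  toℕ-vertexOf : ∀ {k} → k < n → toℕ (vertexOf k) ≡ k
  toℕ-vertexOf {k} l with k ℕ.<? n
  ... | yes l′ = Fin.toℕ-fromℕ< l′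
  ... | no ¬l  = contradiction l ¬l

  vertexOf-toℕ : ∀ v → vertexOf (toℕ v) ≡ v
  vertexOf-toℕ v = Fin.toℕ-injective (toℕ-vertexOf (Fin.toℕ<n v))

  adjacentIn : (ℕ → ℕ) → ℕ → ℕ → Bool
  adjacentIn R i x = does (vertexOf (R i) ~? vertexOf (R x))

  located⇒ranked : ∀ {R pos B} → IsOrder R → Located R pos B → Ranked R pos (adjacentIn R)
  located⇒ranked {R} {pos} ord loc = record
    { isOrder = ord ; pos< = pos< ; pos-R = pos-R ; R-pos = R-pos
    ; arc-adj = arc-adj ; adj-arc = adj-arc }
    where
    open IsOrder ord
    open Located loc
    index : ∀ {v} → v < n → ∃[ i ] (i < n × R i ≡ v)
    index = injective⇒surjective (λ _ → R<) R-inj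
    pos< : ∀ {v} → v < n → pos v < n
    pos< l with index l
    ... | i , i<n , refl = subst (_< n) (sym (pos-R i<n)) i<n
    R-pos : ∀ {v} → v < n → R (pos v) ≡ v
    R-pos l with index l
    ... | i , i<n , refl = cong R (pos-R i<n)
    arc-adj : ∀ {i k} → i < n → IsArc (R i) k → adjacentIn R i (pos (tgt k)) ≡ true
    arc-adj {i} {k} i<n arc with arc-sound (vertexOf (R i)) (proj₁ arc′) (proj₂ arc′)
      where
      arc′ : IsArc (toℕ (vertexOf (R i))) k
      arc′ = subst (λ v → IsArc v k) (sym (toℕ-vertexOf (R< i<n))) arc
    ... | w , v~w , e = dec-true (_ ~? _) (subst (vertexOf (R i) ~_)
          (sym (trans (cong vertexOf (trans (R-pos (subst (_< n) (sym e) (Fin.toℕ<n w))) e)) (vertexOf-toℕ w)))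
              v~w)
    adj-arc : ∀ {i x} → i < n → x < n → adjacentIn R i x ≡ true → ∃[ k ] (IsArc (R i) k × pos (tgt k) ≡ x)
    adj-arc {i} {x} i<n x<n a with arc-complete (does-true (_ ~? _) a)
    ... | k , arc , e = k , subst (λ v → IsArc v k) (toℕ-vertexOf (R< i<n)) arc ,
                        trans (cong pos (trans e (toℕ-vertexOf (R< x<n)))) (pos-R x<n)

  module Ranking {R pos} (rk : Ranked R pos (adjacentIn R)) where
    open Ranked rk

    ρ : Vertex → ℕ
    ρ v = pos (toℕ v)

    ρ< : ∀ v → ρ v < n
    ρ< v = pos< (Fin.toℕ<n v)

    R-ρ : ∀ v → R (ρ v) ≡ toℕ v
    R-ρ v = R-pos (Fin.toℕ<n v)

    ρ-injective : Injective _≡_ _≡_ ρ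
    ρ-injective {u} {v} e = Fin.toℕ-injective (trans (sym (R-ρ u)) (trans (cong R e) (R-ρ v)))

    vertexAt : ℕ → Vertex
    vertexAt x = vertexOf (R x)

    ρ-vertexAt : ∀ {x} → x < n → ρ (vertexAt x) ≡ x
    ρ-vertexAt l = trans (cong pos (toℕ-vertexOf (R< l))) (pos-R l)

    vertexAt-ρ : ∀ v → vertexAt (ρ v) ≡ v
    vertexAt-ρ v = trans (cong vertexOf (R-ρ v)) (vertexOf-toℕ v)

    order : Order G
    order = permutation (λ i → vertexAt (toℕ i)) (λ v → fromℕ< (ρ< v))
      (λ v → trans (cong vertexAt (Fin.toℕ-fromℕ< (ρ< v))) (vertexAt-ρ v))
      (λ i → Fin.toℕ-injective (trans (Fin.toℕ-fromℕ< _) (ρ-vertexAt (Fin.toℕ<n i))))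

    position-order : ∀ v → position order v ≡ ρ v
    position-order v = Fin.toℕ-fromℕ< (ρ< v)

    toℕ-order : ∀ i → toℕ (order ⟨$⟩ʳ i) ≡ R (toℕ i)
    toℕ-order i = toℕ-vertexOf (R< (Fin.toℕ<n i))

    adjacent⇒arc : ∀ {u v} → u ~ v → ∃[ k ] (IsArc (R (ρ v)) k × tgt k ≡ toℕ u)
    adjacent⇒arc {u} {v} u~v with arc-complete (~-sym u~v)
    ... | k , arc , e = k , subst (λ w → IsArc w k) (sym (R-ρ v)) arc , e

    arc⇒adjacent : ∀ {v k} → IsArc (R (ρ v)) k → ∃[ u ] (u ~ v × tgt k ≡ toℕ u)
    arc⇒adjacent {v} {k} arc with subst (λ w → IsArc w k) (R-ρ v) arc
    ... | l , l′ with arc-sound v l l′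
    ...   | u , v~u , e = u , ~-sym v~u , e

    module _ (R0 : R 0 ≡ toℕ s) where

      ρs≡0 : ρ s ≡ 0
      ρs≡0 = trans (cong pos (sym R0)) (pos-R (ℕ.≤-trans (s≤s z≤n) (Fin.toℕ<n s)))

      ρ≢0 : ∀ {v} → v ≢ s → 1 ≤ ρ v
      ρ≢0 ne = ℕ.n≢0⇒n>0 (λ e → ne (ρ-injective (trans e (sym ρs≡0))))

      vertex : ∀ {v} → v ≢ s → 1 ≤ ρ v × ρ v < n
      vertex {v} ne = ρ≢0 ne , ρ< v

      vertexAt≢s : ∀ {x} → 1 ≤ x → x < n → vertexAt x ≢ s
      vertexAt≢s 1≤x x<n e = ℕ.<⇒≢ 1≤x (trans (sym ρs≡0) (trans (cong ρ (sym e)) (ρ-vertexAt x<n)))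

  module Found {R pos} (rk : Ranked R pos (adjacentIn R)) (R0 : R 0 ≡ toℕ s) (par : Vertex → Vertex) {B} (loc : Located R pos B) where
    open Ranking rk
    open Ranked rk
    open Located loc using (latest; present)

    ParentsFound : Set
    ParentsFound = ∀ v → v ≢ s → B (ρ v) ≡ suc (ρ (par v))

    LTree⇒found : LTree par ρ → ParentsFound
    LTree⇒found lt v v≢s with lt v v≢s
    ... | p~v , p<v , max with adjacent⇒arc p~v
    ...   | k , arc , e with latest (ρ< v) arc (subst (_< ρ v) (sym (cong pos e)) p<v) | present (ρ< v)
    ...     | suc-p≤ | inj₁ B≡0 = contradiction (subst (suc _ ≤_) B≡0 suc-p≤) (λ ())
    ...     | suc-p≤ | inj₂ (k′ , arc′ , l , B≡) with arc⇒adjacent arc′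
    ...       | u , u~v , e′ = ℕ.≤-antisym
                (ℕ.≤-trans (ℕ.≤-reflexive B≡)
                    (s≤s (subst (_≤ ρ (par v)) (sym (cong pos e′))
                        (max u u~v (subst (_< ρ v) (cong pos e′) l)))))
                (subst (λ y → suc y ≤ B (ρ v)) (cong pos e) suc-p≤)

    found⇒LTree : ParentsFound → LTree par ρ
    found⇒LTree found v v≢s with present (ρ< v)
    ... | inj₁ B≡0 = contradiction (trans (sym (found v v≢s)) B≡0) (λ ())
    ... | inj₂ (k , arc , l , B≡) with arc⇒adjacent arc
    ...   | u , u~v ,
        e with ρ-injective (trans (cong pos (sym e)) (ℕ.suc-injective (trans (sym B≡) (found v v≢s))))
    ...     | refl = u~v , subst (_< ρ v) (cong pos e) l , max
      where
      max : ∀ w → w ~ v → ρ w < ρ v → ρ w ≤ ρ (par v)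
      max w w~v w<v with adjacent⇒arc w~v
      ... | k′ , arc′ , e′ = ℕ.≤-pred (subst₂ (λ a b → suc a ≤ b) (cong pos e′) (found v v≢s)
                               (latest (ρ< v) arc′ (subst (_< ρ v) (sym (cong pos e′)) w<v)))

    -- The subtraction makes a vertex without earlier neighbours look as if it had the root as
    -- parent. In case of a match its parent would then be the root, which is adjacent to it and
    -- earlier after all.
    matched⇒found : (∀ v → v ≢ s → par v ~ v) → (∀ i → 1 ≤ i → i < n → toℕ (par (vertexAt i)) ≡ R (B i ∸ 1)) →
        ParentsFound
    matched⇒found par~ matched v v≢s with present (ρ< v)
    ... | inj₂ (k , arc , l , B≡) = trans B≡ (cong suc (trans (sym (pos-R (ℕ.<-trans l (ρ< v))))
          (trans (cong (λ b → pos (R (b ∸ 1))) (sym B≡)) (cong pos (sym toℕ-par)))))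
      where
      toℕ-par : toℕ (par v) ≡ R (B (ρ v) ∸ 1)
      toℕ-par = trans (cong (toℕ ∘ par) (sym (vertexAt-ρ v))) (matched (ρ v) (ρ≢0 R0 v≢s) (ρ< v))
    ... | inj₁ B≡0 with adjacent⇒arc (par~ v v≢s)
    ...   | k , arc , e =
        contradiction
            (subst (suc _ ≤_) B≡0
                (latest (ρ< v) arc (subst (_< ρ v) (sym (trans (cong pos e) ρpar≡0)) (ρ≢0 R0 v≢s)))) (λ ())
      where
      ρpar≡0 : ρ (par v) ≡ 0
      ρpar≡0 = trans
          (cong pos (trans (cong (toℕ ∘ par) (sym (vertexAt-ρ v))) (trans (matched (ρ v) (ρ≢0 R0 v≢s) (ρ< v))
        (trans (cong (λ b → R (b ∸ 1)) B≡0) R0)))) (ρs≡0 R0)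

    found⇒matched : ParentsFound → ∀ i → 1 ≤ i → i < n → toℕ (par (vertexAt i)) ≡ R (B i ∸ 1)
    found⇒matched found i 1≤i i<n = sym (trans (cong (λ x → R (B x ∸ 1)) (sym (ρ-vertexAt i<n)))
      (trans (cong (λ b → R (b ∸ 1)) (found (vertexAt i) (vertexAt≢s R0 1≤i i<n))) (R-ρ (par (vertexAt i)))))

  module Sorting {R pos} (rk : Ranked R pos (adjacentIn R)) (R0 : R 0 ≡ toℕ s) (par : Vertex → Vertex) {B}
      (loc : Located R pos B)
    (found : Found.ParentsFound rk R0 par loc) where
    open Ranking rk
    open Ranked rk

    parentOf : ℕ → ℕ
    parentOf x = B x ∸ 1

    parentOf-ρ : ∀ {v} → v ≢ s → parentOf (ρ v) ≡ ρ (par v)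
    parentOf-ρ {v} ne = cong (_∸ 1) (found v ne)

    ρ-tree : LTree par ρ
    ρ-tree = Found.found⇒LTree rk R0 par loc found

    ρ-top : Topological par ρ
    ρ-top = LTree⇒Topological par ρ-injective ρ-tree

    on-position : ∀ (P : ℕ → Set) → (∀ v → v ≢ s → P (ρ v)) → ∀ {x} → IsVertex rk x → P x
    on-position P p (1≤x , x<n) = subst P (ρ-vertexAt x<n) (p (vertexAt _) (vertexAt≢s R0 1≤x x<n))

    parentOf< : ∀ {x} → IsVertex rk x → parentOf x < x
    parentOf< = on-position (λ x → parentOf x < x)
      (λ v ne → subst (_< ρ v) (sym (parentOf-ρ ne)) (proj₁ (proj₂ (ρ-tree v ne))))

    adjacentIn-ρ : ∀ u v → adjacentIn R (ρ u) (ρ v) ≡ does (u ~? v)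
    adjacentIn-ρ u v = cong₂ (λ a b → does (a ~? b)) (vertexAt-ρ u) (vertexAt-ρ v)

    parentOf-adjacent : ∀ {x} → IsVertex rk x → adjacentIn R (parentOf x) x ≡ true
    parentOf-adjacent = on-position (λ x → adjacentIn R (parentOf x) x ≡ true)
      (λ v ne → trans (cong (λ y → adjacentIn R y (ρ v)) (parentOf-ρ ne))
        (trans (adjacentIn-ρ (par v) v) (dec-true (par v ~? v) (proj₁ (ρ-tree v ne)))))

    open Insertion parentOf (nodeOrder rk) using (Inserted)

    digit⇒ : ∀ {v j} → j < n → digit rk (ρ v) j ≡ true → vertexAt (pivot j) ~ v × pivot j < ρ v
    digit⇒ {v} {j} j<n d =
      subst (vertexAt (pivot j) ~_) (vertexAt-ρ v)
          (does-true (_ ~? _) (Bool.∧-conicalˡ (adjacentIn R (pivot j) (ρ v)) _ d)) ,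
      does-true (pivot j ℕ.<? ρ v) (Bool.∧-conicalʳ (adjacentIn R (pivot j) (ρ v)) _ d)

    ⇒digit : ∀ {u v} j → pivot j ≡ ρ u → u ~ v → ρ u < ρ v → digit rk (ρ v) j ≡ true
    ⇒digit {u} {v} j e u~v l = cong₂ _∧_
      (trans (cong (λ i → adjacentIn R i (ρ v)) e) (trans (adjacentIn-ρ u v) (dec-true (u ~? v) u~v)))
      (dec-true (pivot j ℕ.<? ρ v) (subst (_< ρ v) (sym e) l))

    ¬digit⇒ : ∀ {u v} j → pivot j ≡ ρ u → digit rk (ρ v) j ≡ false → ρ u < ρ v → ¬ u ~ v
    ¬digit⇒ j e d l u~v = false≢true d (⇒digit j e u~v l)

    ⇒¬digit : ∀ {u v} j → pivot j ≡ ρ u → ¬ u ~ v → digit rk (ρ v) j ≡ false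
    ⇒¬digit {u} {v} j e u≁v = cong (_∧ does (pivot j ℕ.<? ρ v))
      (trans (cong (λ i → adjacentIn R i (ρ v)) e) (trans (adjacentIn-ρ u v) (dec-false (u ~? v) u≁v)))

    rankOf : Vertex → ℕ
    rankOf v = rank rk (ρ v)

    module _ {succ} (I : Inserted succ (IsVertex rk)) where
      open Insertion.Inserted I

      q′ : Vertex → ℕ
      q′ v = q (ρ v)

      member : ∀ {x} → x < n → x ∈ 0 ∷ N
      member {zero}  _ = here refl
      member {suc x} l = there (Equivalence.from (members (suc x)) (s≤s z≤n , l))

      q′-top : Topological par q′
      q′-top = record
        { injective = λ {u} {v} e → ρ-injective (chain-injective chain (member (ρ< u)) (member (ρ< v)) e)
        ; parent< = λ v ne → subst (λ y → q y < q′ v) (parentOf-ρ ne) (parent< (vertex R0 ne)) }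

      q′-nested : Nested par q′
      q′-nested x y x≢s y≢s l l′ = subst₂ (λ a b → q a ≤ q b) (parentOf-ρ x≢s) (parentOf-ρ y≢s)
        (nested (vertex R0 x≢s) (vertex R0 y≢s) (subst (λ a → q a < q′ y) (sym (parentOf-ρ x≢s)) l) l′)

      siblings-order : ∀ c d → c ≢ s → d ≢ s → par c ≡ par d → q′ c < q′ d →
                       rankOf d < rankOf c ⊎ (rankOf d ≡ rankOf c × ρ c < ρ d)
      siblings-order c d c≢s d≢s e l with ℕ.<-cmp (rankOf d) (rankOf c)
      ... | tri< lt _ _ = inj₁ lt
      ... | tri≈ _ eq _ = inj₂ (eq , ℕ.∸-cancelʳ-< (ℕ.+-cancelˡ-< (rankOf c * n) _ _
              (subst (λ r → r * n + (n ∸ ρ d) < rankOf c * n + (n ∸ ρ c)) eq key<)))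
        where
        key< : nodeOrder rk (ρ d) < nodeOrder rk (ρ c)
        key< = sorted (vertex R0 c≢s) (vertex R0 d≢s)
            (trans (parentOf-ρ c≢s) (trans (cong ρ e) (sym (parentOf-ρ d≢s)))) l
      ... | tri> _ _ gt = contradiction key< (ℕ.≤⇒≯ (begin
          rankOf c * n + (n ∸ ρ c) ≤⟨ ℕ.+-monoʳ-≤ (rankOf c * n) (ℕ.m∸n≤m n (ρ c)) ⟩
          rankOf c * n + n         ≡⟨ ℕ.+-comm (rankOf c * n) n ⟩
          suc (rankOf c) * n       ≤⟨ ℕ.*-monoˡ-≤ n gt ⟩
          rankOf d * n             ≤⟨ ℕ.m≤m+n (rankOf d * n) (n ∸ ρ d) ⟩
          rankOf d * n + (n ∸ ρ d) ∎))
        where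
        open ℕ.≤-Reasoning
        key< : nodeOrder rk (ρ d) < nodeOrder rk (ρ c)
        key< = sorted (vertex R0 c≢s) (vertex R0 d≢s)
            (trans (parentOf-ρ c≢s) (trans (cong ρ e) (sym (parentOf-ρ d≢s)))) l

      module _ {t : Vertex → ℕ} (t-inj : Injective _≡_ _≡_ t) (t-tree : LTree par t) (t-first : ∀ v → t s ≤ t v) (four : FourPoint par t) where
        open LexDFS par t-inj t-tree t-first four using (edge-comparable; sorted⇒FourPoint)

        below-parent : ∀ {x c} → x ~ c → ρ x < ρ c → ρ x ≤ ρ (par c)
        below-parent {x} {c} x~c l = Topological.⊑⇒≤ par ρ-top (proj₂ (⊑-proper par
          (Topological.⊏-of-< par ρ-top (edge-comparable x~c) l) (Topological.<⇒≢ par ρ-top l)))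

        -- The first differing digit gives a neighbour `x` of `c`. A digit 0 of `d` at `x` shows
        -- that they are not adjacent only if `x` precedes `d`; it does, since earlier neighbours of
        -- `c` are at or before the common parent.
        rank⇒dominates : ∀ {c d} → c ≢ s → d ≢ s → par c ≡ par d → rankOf d ≤ rankOf c → Dominates par ρ c d
        rank⇒dominates {c} {d} c≢s d≢s e le a a~d a<d a≁c
          with horner≤⇒ {digit rk (ρ d)} {digit rk (ρ c)} n le (pivot (ρ a)) (pivot< (ρ< a))
                 (⇒digit (pivot (ρ a)) (pivot-involutive (ρ< a)) a~d a<d)
                     (⇒¬digit (pivot (ρ a)) (pivot-involutive (ρ< a)) a≁c)
        ... | j , j<a , dc , dd with ℕ.<-trans j<a (pivot< (ρ< a))
        ...   | j<n with digit⇒ {c} j<n dc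
        ...     | x~c , x<c = x , x~c , ρx<ρc , ¬digit⇒ j (sym ρx) dd ρx<ρd ,
            subst₂ _<_ (pivot-involutive (ρ< a)) (sym ρx) (ℕ.∸-monoʳ-< j<a (j≤n∸1 (pivot< (ρ< a))))
          where
          x : Vertex
          x = vertexAt (pivot j)
          ρx : ρ x ≡ pivot j
          ρx = ρ-vertexAt (pivot< j<n)
          ρx<ρc : ρ x < ρ c
          ρx<ρc = subst (_< ρ c) (sym ρx) x<c
          ρx<ρd : ρ x < ρ d
          ρx<ρd = ℕ.≤-<-trans (below-parent x~c ρx<ρc)
              (subst (λ p → ρ p < ρ d) (sym e) (Topological.parent< ρ-top d d≢s))

        dominates⇒rank : ∀ {c d} → c ≢ s → d ≢ s → par c ≡ par d → Dominates par ρ c d → rankOf d ≤ rankOf c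
        dominates⇒rank {c} {d} c≢s d≢s e dom = ⇒horner≤ n λ j j<n dd dc → let x~d , x<d = digit⇒ {d} j<n dd in at j j<n x~d x<d dc
          where
          at : ∀ j → j < n → vertexAt (pivot j) ~ d → pivot j < ρ d → digit rk (ρ c) j ≡ false →
               ∃[ i ] (i < j × digit rk (ρ c) i ≡ true × digit rk (ρ d) i ≡ false)
          at j j<n x~d x<d dc with dom x x~d ρx<ρd (¬digit⇒ j (sym ρx) dc ρx<ρc)
            where
            x : Vertex
            x = vertexAt (pivot j)
            ρx : ρ x ≡ pivot j
            ρx = ρ-vertexAt (pivot< j<n)
            ρx<ρd : ρ x < ρ d
            ρx<ρd = subst (_< ρ d) (sym ρx) x<d
            ρx<ρc : ρ x < ρ c
            ρx<ρc = ℕ.≤-<-trans (below-parent x~d ρx<ρd)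
                (subst (λ p → ρ p < ρ c) e (Topological.parent< ρ-top c c≢s))
          ... | y , y~c , y<c , y≁d , x<y = pivot (ρ y) ,
            subst (pivot (ρ y) <_) (pivot-involutive j<n)
                (ℕ.∸-monoʳ-< (subst (_< ρ y) (ρ-vertexAt (pivot< j<n)) x<y) (j≤n∸1 (ρ< y))) ,
            ⇒digit (pivot (ρ y)) (pivot-involutive (ρ< y)) y~c y<c ,
                ⇒¬digit (pivot (ρ y)) (pivot-involutive (ρ< y)) y≁d

        q′-sorted : Sorted par ρ q′
        q′-sorted c d c≢s d≢s e l =
            rank⇒dominates c≢s d≢s e ([ ℕ.<⇒≤ , ℕ.≤-reflexive ∘ proj₁ ]′ (siblings-order c d c≢s d≢s e l))

        q′-FourPoint : FourPoint par q′
        q′-FourPoint = sorted⇒FourPoint ρ-top q′-top q′-nested q′-sorted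

      q′-same-order : (∀ v → ρ s ≤ ρ v) → FourPoint par ρ → ∀ u v → ρ u < ρ v → q′ u < q′ v
      q′-same-order ρ-first four = LexDFS.same-order par ρ-injective ρ-tree ρ-first four rankOf q′-top q′-nested
        (λ c d c≢s d≢s e → dominates⇒rank ρ-injective ρ-tree ρ-first four c≢s d≢s e) siblings-order

-- The two reductions

-- Each expression vanishes when the position in register 3 passes the test. The sorted list
-- consists of positions, so the given order is the sorted preorder when each position is followed
-- by the next.
treeMismatch isolated unsorted : Exp
treeMismatch = distance (read 2 (read 3 (var 3))) (read 3 (read 5 (var 3) ⊖ lit 1))
isolated = lit 1 ⊖ read 5 (var 3)
unsorted = distance (read 9 (var 3 ⊖ lit 1)) (var 3)

-- Leaving early keeps register 2 at 0, which means rejection. `decideTree` compares trees twice: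
-- for the breadth-first order, to ensure that latest earlier neighbours are parents when the sort
-- starts, and for the sorted preorder, to ensure that the order submitted to `p` has the given
-- tree.
decideTree decideOrder : Program → Program
decideTree p =
  breadthFirst ⨾ locate ⨾ check treeMismatch ⨾ ifNonZero (var 12) skip
    (sortTree ⨾ emit ⨾ fill 3 (var 3) (read 10 (var 3)) ⨾ locate ⨾ check treeMismatch ⨾ ifNonZero (var 12) skip
      (fill 22 (var 3) (read 3 (var 3)) ⨾ rename p))
decideOrder p =
  fill 3 (var 3) (read 2 (var 3)) ⨾ locate ⨾ check isolated ⨾ ifNonZero (var 12) skip
    (sortTree ⨾ check unsorted ⨾ ifNonZero (var 12) skip
      (fill 22 (read 3 (var 3)) (read 3 (read 5 (var 3) ⊖ lit 1)) ⨾ rename p))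

-- The memory reserved for the embedded program is still empty.
record Clean (st : State) : Set where
  field
    answer : vars st 2 ≡ 0
    vars0  : ∀ x → vars st (23 + x) ≡ 0
    cells0 : ∀ a i → arrays st (22 + a) i ≡ 0

clean-frame : ∀ {p st st′} → assignsVar p 2 ≡ false → (∀ x → assignsVar p (23 + x) ≡ false) →
              (∀ a → writesArray p (22 + a) ≡ false) → Frame p st st′ → Clean st → Clean st′
clean-frame n₂ nv na f c = record
  { answer = trans (var-eq f 2 n₂) (Clean.answer c)
  ; vars0  = λ x → trans (var-eq f (23 + x) (nv x)) (Clean.vars0 c x)
  ; cells0 = λ a i → trans (cong (_$ i) (array-eq f (22 + a) (na a))) (Clean.cells0 c a i) }

record Fresh (st : State) : Set where
  field
    zero₆ : ∀ x → arrays st 6 x ≡ 0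
    zero₇ : ∀ x → arrays st 7 x ≡ 0
    zero₈ : ∀ x → arrays st 8 x ≡ 0
    zero₉ : ∀ x → arrays st 9 x ≡ 0

fresh-frame : ∀ {p st st′} → writesArray p 6 ≡ false → writesArray p 7 ≡ false → writesArray p 8 ≡ false →
    writesArray p 9 ≡ false →
              Frame p st st′ → Fresh st → Fresh st′
fresh-frame a b c d f e = record
  { zero₆ = λ x → trans (cong (_$ x) (array-eq f 6 a)) (Fresh.zero₆ e x)
  ; zero₇ = λ x → trans (cong (_$ x) (array-eq f 7 b)) (Fresh.zero₇ e x)
  ; zero₈ = λ x → trans (cong (_$ x) (array-eq f 8 c)) (Fresh.zero₈ e x)
  ; zero₉ = λ x → trans (cong (_$ x) (array-eq f 9 d)) (Fresh.zero₉ e x) }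

reject : ∀ {st} {P : Set} → Clean st → ¬ P → vars st 2 ≡ 1 ⇔ P
reject c ¬p = mk⇔ (λ e → contradiction (trans (sym (Clean.answer c)) e) (λ ())) (λ p → contradiction p ¬p)

mismatch-value : ∀ {P R B : ℕ → ℕ} {st st′} → arrays st 2 ≡ P → arrays st 3 ≡ R → arrays st 5 ≡ B →
  Frame (check treeMismatch) st st′ → ∀ {i} → vars st′ 3 ≡ i →
  ⟦ treeMismatch ⟧ st′ ≡ (P (R i) ∸ R (B i ∸ 1)) + (R (B i ∸ 1) ∸ P (R i))
mismatch-value refl refl refl fr refl rewrite array-eq fr 2 refl | array-eq fr 3 refl | array-eq fr 5 refl =
    refl

argmax : ∀ {k} (f : Fin (suc k) → ℕ) → ∃[ i ] (∀ j → f j ≤ f i)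
argmax {zero}  f = zero , λ { zero → ℕ.≤-refl }
argmax {suc k} f with argmax (f ∘ suc)
... | i , max with ℕ.≤-total (f zero) (f (suc i))
...   | inj₁ l = suc i , λ { zero → l ; (suc j) → max j }
...   | inj₂ l = zero , λ { zero → ℕ.≤-refl ; (suc j) → ℕ.≤-trans (max j) l }

cycle-neighbours : ∀ {n} {G : SimpleGraph n} (c : Cycle G) → let open SimpleGraph G; open Cycle c in
                   ∀ i → ∃[ j ] ∃[ l ] (j ≢ l × at i ~ at j × at i ~ at l)
cycle-neighbours {G = G} c i with view i
... | ‵fromℕ = inject₁ (fromℕ (suc k)) , zero , (λ ()) , ~-sym (step (fromℕ (suc k))) , close
  where open SimpleGraph G; open Cycle c
... | ‵inject₁ zero = suc zero , fromℕ (2 + k) , (λ ()) , step zero , ~-sym close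
  where open SimpleGraph G; open Cycle c
... | ‵inject₁ (suc j) = suc (suc j) , inject₁ (inject₁ j) , far , step (suc j) , ~-sym (step (inject₁ j))
  where
  open SimpleGraph G; open Cycle c
  far : suc (suc j) ≢ inject₁ (inject₁ j)
  far e = ℕ.<⇒≢ (ℕ.m≤n⇒m≤1+n ℕ.≤-refl)
      (sym (trans (cong toℕ e) (trans (Fin.toℕ-inject₁ (inject₁ j)) (Fin.toℕ-inject₁ j))))

-- Correctness of the two reductions

module Decide (G : Graph) (adj : AdjacencyLists G) (s : Graph.Vertex G) where
  open Graph G
  open InputNetwork G adj s using (network; arcCount≤; arc-complete)
  open Network network using (IsArc; arcCount)
  open Routines network
  open TreeSort network
  open BreadthFirst network
  open Orders G s
  open Context G adj s

  1≤n : 1 ≤ n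
  1≤n = ℕ.≤-trans (s≤s z≤n) (Fin.toℕ<n s)

  input-loaded : ∀ xs → Loaded (inputState G adj s xs)
  input-loaded xs = record { n≡ = refl ; s≡ = refl ; off≡ = refl ; tgt≡ = refl }

  input-clean : ∀ xs → Clean (inputState G adj s xs)
  input-clean xs = record { answer = refl ; vars0 = λ _ → refl ; cells0 = λ _ _ → refl }

  input-fresh : ∀ xs → Fresh (inputState G adj s xs)
  input-fresh xs = record { zero₆ = λ _ → refl ; zero₇ = λ _ → refl ; zero₈ = λ _ → refl ; zero₉ = λ _ → refl }

  -- The embedded program has to find the memory of its own input. Being injective on the numbers
  -- below `n`, `g` reaches all of them, so every entry is written, and the cells of array 22 from
  -- `n` on are still zero.
  embed : ∀ {p st b P e e′} (xs : List ℕ) (g f : ℕ → ℕ) → DecidesWithin p (inputState G adj s xs) b P →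
      Loaded st → Clean st →
    length xs ≡ n → (∀ i → i < n → g i < n) → InjectiveBelow n g → (∀ i → i < n → contents xs (g i) ≡ f i) →
    (∀ i st′ → i < n → Frame (fill 22 e e′) st st′ → vars st′ 3 ≡ i → ⟦ e ⟧ st′ ≡ g i × ⟦ e′ ⟧ st′ ≡ f i) →
    Runs (fill 22 e e′ ⨾ rename p) st (2 + n * 3 + b) (λ st′ → vars st′ 2 ≡ 1 ⇔ P)
  embed {p} {st} {b} {P} {e} {e′} xs g f dec ld cl len g< g-inj value eval =
    fill-rule {22} g f (Loaded.n≡ ld) g-inj eval >> λ st′ fr (new , old) →
        rename-decides dec (simulates st′ fr new old)
    where
    simulates : ∀ st′ → Frame (fill 22 e e′) st st′ → (∀ i → i < n → arrays st′ 22 (g i) ≡ f i) →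
                (∀ j → (∀ i → i < n → j ≢ g i) → arrays st′ 22 j ≡ arrays st 22 j) →
                    Simulates (inputState G adj s xs) st′
    simulates st′ fr new old = record { same-vars = sv ; same-arrays = sa }
      where
      sv : ∀ x → vars st′ (renameVar x) ≡ vars (inputState G adj s xs) x
      sv 0 = trans (var-eq fr 0 refl) (Loaded.n≡ ld)
      sv 1 = trans (var-eq fr 1 refl) (Loaded.s≡ ld)
      sv 2 = trans (var-eq fr 2 refl) (Clean.answer cl)
      sv (suc (suc (suc x))) = trans (var-eq fr (23 + x) refl) (Clean.vars0 cl x)
      sa : ∀ a i → arrays st′ (renameArray a) i ≡ arrays (inputState G adj s xs) a i
      sa 0 i = cong (_$ i) (trans (array-eq fr 0 refl) (Loaded.off≡ ld))
      sa 1 i = cong (_$ i) (trans (array-eq fr 1 refl) (Loaded.tgt≡ ld))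
      sa 2 j with j ℕ.<? n
      ... | yes j<n = let i , i<n , gi≡j = injective⇒surjective g< g-inj j<n in
                      subst (λ u → arrays st′ 22 u ≡ contents xs u) gi≡j (trans (new i i<n) (sym (value i i<n)))
      ... | no j≮n = trans (old j (λ i i<n j≡ → j≮n (subst (_< n) (sym j≡) (g< i i<n))))
                       (trans (Clean.cells0 cl 0 j)
                           (sym (contents-beyond xs (subst (_≤ j) (sym len) (ℕ.≮⇒≥ j≮n)))))
      sa (suc (suc (suc a))) i = trans (cong (_$ i) (array-eq fr (23 + a) refl)) (Clean.cells0 cl (suc a) i)

  FourPoint-cong : ∀ {par : Vertex → Vertex} {r r′ : Vertex → ℕ} → (∀ u v → r u < r v → r′ u < r′ v) →
      (∀ u v → r′ u < r′ v → r u < r v) →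
                   FourPoint par r → FourPoint par r′
  FourPoint-cong to from four a b c a<b b<c a~c a≁b with four a b c (from a b a<b) (from b c b<c) a~c a≁b
  ... | d , a<d , d<b , d~b , d≁c = d , to a d a<d , to d b d<b , d~b , d≁c

  LTree-cong : ∀ {par : Vertex → Vertex} {r r′ : Vertex → ℕ} → (∀ v → r v ≡ r′ v) → LTree par r → LTree par r′
  LTree-cong eq lt v n with lt v n
  ... | e , l , max = e , subst₂ _<_ (eq _) (eq v) l , λ u u~v u<v →
      subst₂ _≤_ (eq u) (eq _) (max u u~v (subst₂ _<_ (sym (eq u)) (sym (eq v)) u<v))

  module TreeSide (T : SpanningTree G) (pa : ParentArray G s T) where
    open SpanningTree T using (_~ₜ_; ⊆G)
    open ParentArray pa

    P : ℕ → ℕ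
    P = contents (tabulate (λ v → toℕ (parent v)))

    P-toℕ : ∀ v → P (toℕ v) ≡ toℕ (parent v)
    P-toℕ = contents-tabulate (λ v → toℕ (parent v))

    parent~ : ∀ v → v ≢ s → parent v ~ v
    parent~ v ne = ~-sym (⊆G (parent-edge pa ne))

    parent-pointers : ParentPointers P
    parent-pointers = record
      { child-arc = λ {w} w<n →
          InputNetwork.on-vertex G adj s
              (λ w → w ≢ toℕ s → ∃[ k ] (IsArc (P w) k × InputNetwork.tgt G adj s k ≡ w)) child-arc w<n
      ; induct = λ C base step w w<n →
          InputNetwork.on-vertex G adj s C (λ v → climb C base step (root-above pa v)) w<n }
      where
      child-arc : ∀ v → toℕ v ≢ toℕ s → ∃[ k ] (IsArc (P (toℕ v)) k × InputNetwork.tgt G adj s k ≡ toℕ v)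
      child-arc v ne with arc-complete (parent~ v (ne ∘ cong toℕ))
      ... | k , arc , e = k , subst (λ u → IsArc u k) (sym (P-toℕ v)) arc , e
      climb : (C : ℕ → Set) → C (toℕ s) → (∀ w → w < n → w ≢ toℕ s → C (P w) → C w) →
              ∀ {v} → _⊑_ parent s v → C (toℕ v)
      climb C base step here = base
      climb C base step {v} (up ne p) = step (toℕ v) (Fin.toℕ<n v) (ne ∘ Fin.toℕ-injective)
        (subst C (sym (P-toℕ v)) (climb C base step p))

    Answer : Set
    Answer = IsLTreeOfLexDFS G s T

    module Witness {τ} (run : IsLexDFSOrder G s τ) (tree : IsLTree G τ s T) where
      τ-first : ∀ v → position τ s ≤ position τ v
      τ-first v = subst (_≤ position τ v) (sym (run⇒first τ run)) z≤n
      τ-tree : LTree parent (position τ)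
      τ-tree = IsLTree⇒LTree pa τ tree
      τ-four : FourPoint parent (position τ)
      τ-four = run⇒FourPoint τ parent run
      any-topological : ∀ {r} → Topological parent r → LTree parent r
      any-topological = LexDFS.topological⇒LTree parent (position-injective τ) τ-tree τ-first τ-four

    module _ {R pos B} (ord : IsOrder R) (loc : Located R pos B) (R0 : R 0 ≡ toℕ s) where
      rk : Ranked R pos (adjacentIn R)
      rk = located⇒ranked ord loc
      open Ranking rk using (ρ; vertexAt)
      open Found rk R0 parent loc

      P-R : ∀ i → i < n → P (R i) ≡ toℕ (parent (vertexAt i))
      P-R i i<n = trans (cong P (sym (toℕ-vertexOf (IsOrder.R< ord i<n)))) (P-toℕ (vertexAt i))

      matches⇒found : (∀ i → 1 ≤ i → i < n → (P (R i) ∸ R (B i ∸ 1)) + (R (B i ∸ 1) ∸ P (R i)) ≡ 0) →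
          ParentsFound
      matches⇒found z = matched⇒found parent~ (λ i l l′ → trans (sym (P-R i l′)) (distance≡0⇒ (z i l l′)))

      topological⇒matches : Answer → Topological parent ρ → ∀ i → 1 ≤ i → i < n →
          (P (R i) ∸ R (B i ∸ 1)) + (R (B i ∸ 1) ∸ P (R i)) ≡ 0
      topological⇒matches (_ , run , tree) top i l l′ = ⇒distance≡0 (trans (P-R i l′)
        (found⇒matched (LTree⇒found (Witness.any-topological run tree top)) i l l′))

    -- The constants are the sums of the costs of the stages; `arrange` collects them.
    decideTree-rule : ∀ {p b} →
        (∀ σ → BeginsWith G σ s → DecidesWithin p (orderInput G adj s σ) b (IsLexDFSOrder G s σ)) →
      Runs (decideTree p) (treeInput G adj s T pa) (41 + n * 64 + arcCount * 37 + b)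
          (λ st → vars st 2 ≡ 1 ⇔ Answer)
    decideTree-rule {p} {b} dec = runs-weaken (ℕ.≤-reflexive (arrange n arcCount b))
      (breadthFirst-rule parent-pointers (input-loaded xs) refl >> λ st₁ fr₁ to →
       let ld₁ = loaded-frame refl refl refl refl fr₁ (input-loaded xs)
           cl₁ = clean-frame refl (λ _ → refl) (λ _ → refl) fr₁ (input-clean xs)
           fs₁ = fresh-frame refl refl refl refl fr₁ (input-fresh xs)
           P₁ = array-eq fr₁ 2 refl
       in locate-rule (TreeOrder.isOrder to) ld₁ refl >> λ st₂ fr₂ loc →
       let ld₂ = loaded-frame refl refl refl refl fr₂ ld₁
           cl₂ = clean-frame refl (λ _ → refl) (λ _ → refl) fr₂ cl₁
           fs₂ = fresh-frame refl refl refl refl fr₂ fs₁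
           P₂ = trans (array-eq fr₂ 2 refl) P₁
           R₂ = array-eq fr₂ 3 refl
       in check-rule
           (λ i → (P (arrays st₁ 3 i) ∸ arrays st₁ 3 (arrays st₂ 5 i ∸ 1)) +
               (arrays st₁ 3 (arrays st₂ 5 i ∸ 1) ∸ P (arrays st₁ 3 i)))
            (Loaded.n≡ ld₂) 1≤n (λ i st _ _ fr e → mismatch-value P₂ R₂ refl fr e) >> λ st₃ fr₃ zero⇔ →
       let ld₃ = loaded-frame refl refl refl refl fr₃ ld₂
           cl₃ = clean-frame refl (λ _ → refl) (λ _ → refl) fr₃ cl₂
           fs₃ = fresh-frame refl refl refl refl fr₃ fs₂
       in runs-if
         (λ nz → runs-weaken z≤n (runs-skip (reject cl₃ (λ ans → nz (Equivalence.from zero⇔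
            (topological⇒matches (TreeOrder.isOrder to) loc (TreeOrder.R0 to) ans
                (first-topological to loc)))))))
         (λ z → second-half to loc
             (matches⇒found (TreeOrder.isOrder to) loc (TreeOrder.R0 to) (Equivalence.to zero⇔ z)) st₃ ld₃ cl₃
                 fs₃
            (trans (array-eq fr₃ 2 refl) P₂) (trans (array-eq fr₃ 3 refl) R₂) (array-eq fr₃ 4 refl)
                (array-eq fr₃ 5 refl)))
      where
      xs : List ℕ
      xs = tabulate (λ v → toℕ (parent v))
      arrange : ∀ n a b →
        4 + (n * 6 + 7 * a) + (4 + (n * 11 + 6 * a) + (3 + n * 3 + suc
          (14 + (n * 20 + 18 * a) +
              (3 + n * 4 + (2 + n * 3 + (4 + (n * 11 + 6 * a) + (3 + n * 3 + suc (2 + n * 3 + b))))))))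
        ≡ 41 + n * 64 + a * 37 + b
      arrange = solve-∀
      first-topological : ∀ {R pos B} (to : TreeOrder parent-pointers R) (loc : Located R pos B) →
                          Topological parent (Ranking.ρ (rk (TreeOrder.isOrder to) loc (TreeOrder.R0 to)))
      first-topological {R} {pos} to loc = record { injective = ρ-injective ; parent< = down }
        where
        open Ranking (rk (TreeOrder.isOrder to) loc (TreeOrder.R0 to))
        down : ∀ v → v ≢ s → ρ (parent v) < ρ v
        down v ne with TreeOrder.earlier to (ρ≢0 (TreeOrder.R0 to) ne) (ρ< v)
        ... | _ , j , j<ρv , e = subst (_< ρ v) (sym ρp≡j) j<ρv
          where
          ρp≡j : ρ (parent v) ≡ j
          ρp≡j = trans (cong pos (trans (sym (P-toℕ v)) (trans (cong P (sym (R-ρ v))) e)))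
                       (Located.pos-R loc (ℕ.<-trans j<ρv (ρ< v)))

      second-half : ∀ {R pos B} (to : TreeOrder parent-pointers R) (loc : Located R pos B) →
        Found.ParentsFound (rk (TreeOrder.isOrder to) loc (TreeOrder.R0 to)) (TreeOrder.R0 to) parent loc →
        ∀ st → Loaded st → Clean st → Fresh st → arrays st 2 ≡ P → arrays st 3 ≡ R → arrays st 4 ≡ pos →
            arrays st 5 ≡ B →
        Runs (sortTree ⨾ emit ⨾ fill 3 (var 3) (read 10 (var 3)) ⨾ locate ⨾ check treeMismatch ⨾ ifNonZero
            (var 12) skip
               (fill 22 (var 3) (read 3 (var 3)) ⨾ rename p)) st
          (14 + (n * 20 + 18 * arcCount) +
              (3 + n * 4 + (2 + n * 3 + (4 + (n * 11 + 6 * arcCount) + (3 + n * 3 + suc (2 + n * 3 + b))))))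
          (λ st → vars st 2 ≡ 1 ⇔ Answer)
      second-half {R} {pos} {B} to loc found st ld cl fs P≡ R≡ pos≡ B≡ =
        sortTree-rule rk₀ parentOf< parentOf-adjacent ld R≡ pos≡ (λ x → cong (λ F → F x ∸ 1) B≡)
          (Fresh.zero₆ fs) (Fresh.zero₇ fs) (Fresh.zero₈ fs) (Fresh.zero₉ fs) >> λ st₁ fr₁ I →
        let ld₁ = loaded-frame refl refl refl refl fr₁ ld
            cl₁ = clean-frame refl (λ _ → refl) (λ _ → refl) fr₁ cl
        in emit-rule (Loaded.n≡ ld₁) >> λ st₂ fr₂ out →
        let ld₂ = loaded-frame refl refl refl refl fr₂ ld₁
            cl₂ = clean-frame refl (λ _ → refl) (λ _ → refl) fr₂ cl₁
            R₁ = trans (array-eq fr₁ 3 refl) R≡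
        in fill-rule id (arrays st₂ 10) (Loaded.n≡ ld₂) (λ _ _ _ _ e → e)
             (λ i st′ _ fr e → e , cong₂ _$_ (array-eq fr 10 refl) e) >> λ st₃ fr₃ (copied , _) →
        let ld₃ = loaded-frame refl refl refl refl fr₃ ld₂
            cl₃ = clean-frame refl (λ _ → refl) (λ _ → refl) fr₃ cl₂
            P₃ = trans (array-eq fr₃ 2 refl) (trans (array-eq fr₂ 2 refl) (trans (array-eq fr₁ 2 refl) P≡))
            walked = λ j l → trans (copied j l) (trans (out j l) (cong (λ F → F (walk (arrays st₁ 9) 0 j)) R₁))
            ord′ = walk-order I walked
        in locate-rule ord′ ld₃ refl >> λ st₄ fr₄ loc′ →
        let ld₄ = loaded-frame refl refl refl refl fr₄ ld₃
            cl₄ = clean-frame refl (λ _ → refl) (λ _ → refl) fr₄ cl₃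
            P₄ = trans (array-eq fr₄ 2 refl) P₃
            R₄ = array-eq fr₄ 3 refl
            R0′ = trans (walked 0 1≤n) R0
        in check-rule
            (λ i → (P (arrays st₃ 3 i) ∸ arrays st₃ 3 (arrays st₄ 5 i ∸ 1)) +
                (arrays st₃ 3 (arrays st₄ 5 i ∸ 1) ∸ P (arrays st₃ 3 i)))
             (Loaded.n≡ ld₄) 1≤n (λ i st′ _ _ fr e → mismatch-value P₄ R₄ refl fr e) >> λ st₅ fr₅ zero⇔ →
        let ld₅ = loaded-frame refl refl refl refl fr₅ ld₄
            cl₅ = clean-frame refl (λ _ → refl) (λ _ → refl) fr₅ cl₄
            R₅ = trans (array-eq fr₅ 3 refl) R₄
        in runs-if
          (λ nz → runs-weaken z≤n (runs-skip (reject cl₅ (λ ans → nz (Equivalence.from zero⇔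
             (topological⇒matches ord′ loc′ R0′ ans (walk-topological I walked ord′ loc′ R0′)))))))
          (λ z → let open Ranking (rk ord′ loc′ R0′) in
             runs-map (λ _ _ ans⇔ →
                 mk⇔ (Equivalence.to
                     (verdict I walked ord′ loc′ R0′ (matches⇒found ord′ loc′ R0′ (Equivalence.to zero⇔ z))) ∘
                         Equivalence.to ans⇔)
                                      (Equivalence.from ans⇔ ∘
                                          Equivalence.from
                                              (verdict I walked ord′ loc′ R0′
                                                  (matches⇒found ord′ loc′ R0′ (Equivalence.to zero⇔ z)))))
               (embed (tabulate (λ i → toℕ (order ⟨$⟩ʳ i))) id (arrays st₃ 3)
                 (dec order (trans (position-order s) (ρs≡0 R0′))) ld₅ cl₅ (List.length-tabulate {n = n} _)
                     (λ _ l → l) (λ _ _ _ _ e → e)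
                 (λ i i<n → trans
                     (cong (contents (tabulate (λ i → toℕ (order ⟨$⟩ʳ i)))) (sym (Fin.toℕ-fromℕ< i<n)))
                    (trans (contents-tabulate (λ i → toℕ (order ⟨$⟩ʳ i)) (fromℕ< i<n))
                        (trans (toℕ-order (fromℕ< i<n)) (cong (arrays st₃ 3) (Fin.toℕ-fromℕ< i<n)))))
                 (λ i st′ _ fr e → e , cong₂ _$_ (trans (array-eq fr 3 refl) R₅) e)))
        where
        R0 : R 0 ≡ toℕ s
        R0 = TreeOrder.R0 to
        rk₀ : Ranked R pos (adjacentIn R)
        rk₀ = rk (TreeOrder.isOrder to) loc R0
        open IsOrder (TreeOrder.isOrder to)
        open Sorting rk₀ R0 parent loc found using
            (parentOf; parentOf<; parentOf-adjacent; q′; q′-top; q′-FourPoint)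
        open Insertion parentOf (nodeOrder rk₀) using (Inserted)
        module _ {succ R′ : ℕ → ℕ} (I : Inserted succ (IsVertex rk₀)) (walked : ∀ j → j < n → R′ j ≡ R (walk succ 0 j)) where
          open Insertion.Inserted I using (N; chain; members; q)
          suc-len : suc (length N) ≡ n
          suc-len = chain-length 1≤n chain members
          below : ∀ {j} → j < n → j ≤ length N
          below l = ℕ.≤-pred (subst (_ <_) (sym suc-len) l)
          walk< : ∀ {j} → j < n → walk succ 0 j < n
          walk< l with walk-∈ chain _ (below l)
          ... | here e  = subst (_< n) (sym e) 1≤n
          ... | there m = proj₂ (Equivalence.to (members _) m)
          walk-order : IsOrder R′
          walk-order = record
            { R<    = λ l → subst (_< n) (sym (walked _ l)) (R< (walk< l))
            ; R-inj = λ i j l l′ e → subst (λ k → InjectiveBelow k (walk succ 0)) suc-len (walk-injective chain)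
                i j l l′
                (R-inj _ _ (walk< l) (walk< l′) (trans (sym (walked i l)) (trans e (walked j l′)))) }
          module _ (ord′ : IsOrder R′) {pos′ B′} (loc′ : Located R′ pos′ B′) (R0′ : R′ 0 ≡ toℕ s) where
            open Ranking rk₀ using (ρ; ρ<; R-ρ)
            open Ranking (rk ord′ loc′ R0′) using (order; position-order; ρs≡0) renaming
                (ρ to ρ′; ρ< to ρ′<; R-ρ to R-ρ′; ρ-injective to ρ′-injective)
            walk-ρ′ : ∀ v → walk succ 0 (ρ′ v) ≡ ρ v
            walk-ρ′ v = R-inj _ _ (walk< (ρ′< v)) (ρ< v)
                (trans (sym (walked (ρ′ v) (ρ′< v))) (trans (R-ρ′ v) (sym (R-ρ v))))
            ρ′⇒q : ∀ u v → ρ′ u < ρ′ v → q′ I u < q′ I v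
            ρ′⇒q u v l = subst₂ (λ a b → q a < q b) (walk-ρ′ u) (walk-ρ′ v)
                (walk-increasing chain (ρ′ u) (ρ′ v) l (below (ρ′< v)))
            q⇒ρ′ : ∀ u v → q′ I u < q′ I v → ρ′ u < ρ′ v
            q⇒ρ′ u v l with ℕ.<-cmp (ρ′ u) (ρ′ v)
            ... | tri< l′ _ _ = l′
            ... | tri≈ _ e _  = contradiction (cong (q′ I) (ρ′-injective e)) (ℕ.<⇒≢ l)
            ... | tri> _ _ l′ = contradiction l (ℕ.<-asym (ρ′⇒q v u l′))
            walk-topological : Topological parent ρ′
            walk-topological =
                record { injective = ρ′-injective ; parent< = λ v ne →
                    q⇒ρ′ (parent v) v (Topological.parent< (q′-top I) v ne) }
            -- If `order` is a LexDFS order, it is itself the witness, as the second comparison has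
            -- shown its ℒ-tree to be `T`. Conversely, any witness forces the four-point condition
            -- on the sorted preorder, and this is `order`.
            verdict : Found.ParentsFound (rk ord′ loc′ R0′) R0′ parent loc′ → IsLexDFSOrder G s order ⇔ Answer
            verdict found′ = mk⇔
              (λ run → order , run , LTree⇒IsLTree pa order (trans (position-order s) (ρs≡0 R0′))
                 (LTree-cong (λ v → sym (position-order v))
                     (Found.found⇒LTree (rk ord′ loc′ R0′) R0′ parent loc′ found′)))
              (λ (τ , run , tree) → let open Witness run tree in
                 FourPoint⇒run order parent (trans (position-order s) (ρs≡0 R0′))
                   (FourPoint-cong {parent}
                       (λ u v l → subst₂ _<_ (sym (position-order u)) (sym (position-order v)) (q⇒ρ′ u v l))
                                   (λ u v l → ρ′⇒q u v (subst₂ _<_ (position-order u) (position-order v) l))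
                     (q′-FourPoint I (position-injective τ) τ-tree τ-first τ-four)))

  module OrderSide (σ : Order G) (σ-begins : BeginsWith G σ s) where

    σR : ℕ → ℕ
    σR = contents (tabulate (λ i → toℕ (σ ⟨$⟩ʳ i)))

    σR-position : ∀ v → σR (position σ v) ≡ toℕ v
    σR-position v = trans (contents-tabulate (λ i → toℕ (σ ⟨$⟩ʳ i)) (σ ⟨$⟩ˡ v)) (cong toℕ (inverseʳ σ))

    σR-index : ∀ {i} (l : i < n) → σR i ≡ toℕ (σ ⟨$⟩ʳ fromℕ< l)
    σR-index {i} l =
        trans (cong σR (sym (Fin.toℕ-fromℕ< l))) (contents-tabulate (λ i → toℕ (σ ⟨$⟩ʳ i)) (fromℕ< l))

    module Copied {R : ℕ → ℕ} (copied : ∀ i → i < n → R i ≡ σR i) where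

      copied-order : IsOrder R
      copied-order = record
        { R<    = λ {i} l → subst (_< n) (sym (trans (copied i l) (σR-index l))) (Fin.toℕ<n _)
        ; R-inj = λ i j l l′ e → trans (sym (Fin.toℕ-fromℕ< l)) (trans (trans (sym (position-at σ (fromℕ< l)))
            (trans (cong (position σ)
                (Fin.toℕ-injective
                    (trans (sym (trans (copied i l) (σR-index l)))
                        (trans e (trans (copied j l′) (σR-index l′))))))
                   (position-at σ (fromℕ< l′)))) (Fin.toℕ-fromℕ< l′)) }

      R0 : R 0 ≡ toℕ s
      R0 = trans (copied 0 1≤n) (trans (cong σR (sym σ-begins)) (σR-position s))

      module _ {pos B} (loc : Located R pos B) where

        rk : Ranked R pos (adjacentIn R)
        rk = located⇒ranked copied-order loc
        open Ranking rk
        open Located loc using (present; latest)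

        position-ρ : ∀ v → position σ v ≡ ρ v
        position-ρ v = IsOrder.R-inj copied-order _ _ (Fin.toℕ<n (σ ⟨$⟩ˡ v)) (ρ< v)
          (trans (copied _ (Fin.toℕ<n (σ ⟨$⟩ˡ v))) (trans (σR-position v) (sym (R-ρ v))))

        ρ-first : ∀ v → ρ s ≤ ρ v
        ρ-first v = subst (_≤ ρ v) (sym (ρs≡0 R0)) z≤n

        B0≡0 : B 0 ≡ 0
        B0≡0 with present 1≤n
        ... | inj₁ e = e
        ... | inj₂ (_ , _ , () , _)

        par : Vertex → Vertex
        par v = vertexAt (B (ρ v) ∸ 1)

        ρ-four : IsLexDFSOrder G s σ → FourPoint par ρ
        ρ-four run = FourPoint-cong {par} (λ u v → subst₂ _<_ (position-ρ u) (position-ρ v))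
          (λ u v → subst₂ _<_ (sym (position-ρ u)) (sym (position-ρ v))) (run⇒FourPoint σ par run)

        -- A vertex behind the root without earlier neighbours would leave the order without an
        -- ℒ-tree, so there would be no input for the tree algorithm. In a connected graph
        -- `earlier-neighbour` excludes this for LexDFS orders, hence such orders may be rejected.
        run⇒connected : IsLexDFSOrder G s σ → ∀ i → 1 ≤ i → i < n → 1 ∸ B i ≡ 0
        run⇒connected run i 1≤i i<n = [ no-zero ,
            (λ (k , _ , _ , B≡) → trans (cong (1 ∸_) B≡) (ℕ.0∸n≡0 (pos (InputNetwork.tgt G adj s k)))) ]′
                (present i<n)
          where
          b : Vertex
          b = vertexAt i
          ρb : ρ b ≡ i
          ρb = ρ-vertexAt i<n
          no-zero : B i ≡ 0 → 1 ∸ B i ≡ 0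
          no-zero B≡0 =
              contradiction no-earlier (earlier-neighbour par ρ-injective (ρ-four run) (Graph.connected G s b)
            (subst₂ _<_ (sym (ρs≡0 R0)) (sym ρb) 1≤i))
            where
            no-earlier : ∀ d → d ~ b → ¬ ρ d < ρ b
            no-earlier d d~b d<b = let k , arc , e = adjacent⇒arc d~b in
              ℕ.n≮0 {pos (InputNetwork.tgt G adj s k)}
                  (subst (suc (pos (InputNetwork.tgt G adj s k)) ≤_) (trans (cong B ρb) B≡0)
                (latest (ρ< b) arc (subst (_< ρ b) (sym (cong pos e)) d<b)))

        module Parents (nonzero : ∀ i → 1 ≤ i → i < n → 1 ∸ B i ≡ 0) where

          found : Found.ParentsFound rk R0 par loc
          found v v≢s with present (ρ< v)
          ... | inj₁ B≡0 = contradiction (trans (sym (cong (1 ∸_) B≡0)) (nonzero (ρ v) (ρ≢0 R0 v≢s) (ρ< v)))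
              (λ ())
          ... | inj₂ (k , arc , l , B≡) = trans B≡ (cong suc (trans (sym (ρ-vertexAt (ℕ.<-trans l (ρ< v))))
                  (cong (λ y → ρ (vertexAt (y ∸ 1))) (sym B≡))))

          ρ-tree : LTree par ρ
          ρ-tree = Found.found⇒LTree rk R0 par loc found

          -- Truncated subtraction sends the entry 0 of the root to position 0, so the root points
          -- to itself as `ParentArray` demands.
          par-s : par s ≡ s
          par-s = trans (cong (λ x → vertexAt (B x ∸ 1)) (ρs≡0 R0))
            (trans (cong (λ b → vertexAt (b ∸ 1)) B0≡0) (trans (cong vertexOf R0) (vertexOf-toℕ s)))

          infix 4 _~ₚ_
          _~ₚ_ : Vertex → Vertex → Set
          u ~ₚ v = (u ≢ s × par u ≡ v) ⊎ (v ≢ s × par v ≡ u)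

          ~ₚ-sym : ∀ {u v} → u ~ₚ v → v ~ₚ u
          ~ₚ-sym = [ inj₂ , inj₁ ]′

          par≢ : ∀ {v} → v ≢ s → par v ≢ v
          par≢ {v} ne e = ℕ.<⇒≢ (proj₁ (proj₂ (ρ-tree v ne))) (cong ρ e)

          treeGraph : SimpleGraph n
          treeGraph = record
            { _~_ = _~ₚ_
            ; _~?_ = λ u v → (¬? (u Fin.≟ s) ×-dec (par u Fin.≟ v)) ⊎-dec (¬? (v Fin.≟ s) ×-dec (par v Fin.≟ u))
            ; ~-sym = ~ₚ-sym
            ; ~-irrefl = [ (λ (ne , e) → par≢ ne e) , (λ (ne , e) → par≢ ne e) ]′ }

          larger-end : ∀ {u v} → u ~ₚ v → ρ v ≤ ρ u → par u ≡ v
          larger-end (inj₁ (_ , e)) _ = e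
          larger-end {u} {v} (inj₂ (ne , refl)) l = contradiction (proj₁ (proj₂ (ρ-tree v ne))) (ℕ.≤⇒≯ l)

          T : SpanningTree G
          T = record
            { tree = treeGraph
            ; ⊆G = λ { {u} (inj₁ (ne , refl)) → ~-sym (proj₁ (ρ-tree u ne)) ; {v = v} (inj₂ (ne , refl)) →
                proj₁ (ρ-tree v ne) }
            ; connected = λ u v → Star.reverse ~ₚ-sym (down (above u)) ◅◅ down (above v)
            -- The vertex of a cycle that comes last in the order would have two distinct neighbours
            -- on the cycle, and both would have to be its parent.
            ; acyclic = λ c → let i , max = argmax (ρ ∘ Cycle.at c) ; j , l , j≢l , e , e′ = cycle-neighbours c i
                              in j≢l (Cycle.distinct c
                                  (trans (sym (larger-end e (max j))) (larger-end e′ (max l)))) }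
            where
            above : ∀ v → _⊑_ par s v
            above = Topological.root⊑ par (LTree⇒Topological par ρ-injective ρ-tree)
            down : ∀ {v} → _⊑_ par s v → Star _~ₚ_ s v
            down here = ε
            down (up ne p) = down p ◅◅ (inj₂ (ne , refl) ◅ ε)

          pointers : ParentArray G s T
          pointers = record { parent = par ; root = par-s ; edges = λ _ _ → mk⇔ id id }

          open Sorting rk R0 par loc found using
              (parentOf; parentOf<; parentOf-adjacent; q′; q′-same-order; q′-FourPoint; member)
          open Insertion parentOf (nodeOrder rk) using (Inserted)

          module _ {succ} (I : Inserted succ (IsVertex rk)) where
            open Insertion.Inserted I using (N; chain; members; q)

            -- For a LexDFS order `q` grows with the position. The list has nothing between two
            -- consecutive values of `q`, so `i` is followed by `suc i`.
            run⇒sorted : IsLexDFSOrder G s σ → ∀ i → 1 ≤ i → i < n → (succ (i ∸ 1) ∸ i) + (i ∸ succ (i ∸ 1)) ≡ 0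
            run⇒sorted run (suc i) _ l =
                ⇒distance≡0 (next-is (chain-next chain (member I (ℕ.<-trans ℕ.≤-refl l)))
                    (chain-next≤ chain (member I (ℕ.<-trans ℕ.≤-refl l)) (member I l) (q-mono (ℕ.n<1+n i) l)))
              where
              q-mono : ∀ {x y} → x < y → y < n → q x < q y
              q-mono {x} {y} x<y y<n =
                  subst₂ (λ a b → q a < q b) (ρ-vertexAt (ℕ.<-trans x<y y<n)) (ρ-vertexAt y<n)
                (q′-same-order I ρ-first (ρ-four run) (vertexAt x) (vertexAt y)
                  (subst₂ _<_ (sym (ρ-vertexAt (ℕ.<-trans x<y y<n))) (sym (ρ-vertexAt y<n)) x<y))
              next-is : succ i ≡ 0 ⊎ (succ i ∈ N × q i < q (succ i)) → succ i ≢ 0 × q (succ i) ≤ q (suc i) →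
                  succ i ≡ suc i
              next-is (inj₁ e) (ne , _) = contradiction e ne
              next-is (inj₂ (m , i<)) (_ , ≤i+1) with ℕ.<-cmp (succ i) (suc i)
              ... | tri≈ _ e _ = e
              ... | tri> _ _ gt = contradiction (q-mono gt (proj₂ (Equivalence.to (members _) m))) (ℕ.≤⇒≯ ≤i+1)
              ... | tri< (s≤s lt) _ _ with ℕ.m≤n⇒m<n∨m≡n lt
              ...   | inj₁ lt′ = contradiction (q-mono lt′ (ℕ.<-trans (ℕ.n<1+n i) l)) (ℕ.<-asym i<)
              ...   | inj₂ e   = contradiction (cong q (sym e)) (ℕ.<⇒≢ i<)

            sorted⇒four : (∀ i → 1 ≤ i → i < n → (succ (i ∸ 1) ∸ i) + (i ∸ succ (i ∸ 1)) ≡ 0) →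
                FourPoint par (q′ I) → FourPoint par ρ
            sorted⇒four z = FourPoint-cong {par} from to
              where
              walk-id : ∀ j → j < n → walk succ 0 j ≡ j
              walk-id zero    _ = refl
              walk-id (suc j) l =
                  trans (cong succ (walk-id j (ℕ.<-trans ℕ.≤-refl l))) (distance≡0⇒ (z (suc j) (s≤s z≤n) l))
              to : ∀ u v → ρ u < ρ v → q′ I u < q′ I v
              to u v l = subst₂ (λ a b → q a < q b) (walk-id (ρ u) (ρ< u)) (walk-id (ρ v) (ρ< v))
                (walk-increasing chain (ρ u) (ρ v) l
                    (ℕ.≤-pred (subst (ρ v <_) (sym (chain-length 1≤n chain members)) (ρ< v))))
              from : ∀ u v → q′ I u < q′ I v → ρ u < ρ v
              from u v l with ℕ.<-cmp (ρ u) (ρ v)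
              ... | tri< l′ _ _ = l′
              ... | tri≈ _ e _  = contradiction (cong q e) (ℕ.<⇒≢ l)
              ... | tri> _ _ l′ = contradiction l (ℕ.<-asym (to v u l′))

            -- By construction `T` is the ℒ-tree of `σ`, so a LexDFS order `σ` is a witness for `T`.
            -- Conversely, any witness makes the sorted preorder satisfy the four-point condition,
            -- and the comparison `z` has identified this preorder with `σ`.
            verdict : (∀ i → 1 ≤ i → i < n → (succ (i ∸ 1) ∸ i) + (i ∸ succ (i ∸ 1)) ≡ 0) →
                IsLTreeOfLexDFS G s T ⇔ IsLexDFSOrder G s σ
            verdict z = mk⇔
              (λ (τ , run , tree) → FourPoint⇒run σ par σ-begins
                (FourPoint-cong {par} (λ u v → subst₂ _<_ (sym (position-ρ u)) (sym (position-ρ v)))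
                    (λ u v → subst₂ _<_ (position-ρ u) (position-ρ v))
                  (sorted⇒four z (q′-FourPoint I (position-injective τ) (IsLTree⇒LTree pointers τ tree)
                    (λ v → subst (_≤ position τ v) (sym (run⇒first τ run)) z≤n) (run⇒FourPoint τ par run)))))
              (λ run → σ , run ,
                  LTree⇒IsLTree pointers σ σ-begins (LTree-cong (λ v → sym (position-ρ v)) ρ-tree))

          sort-and-test : ∀ {p b} →
              (∀ T (pa : ParentArray G s T) →
                  DecidesWithin p (treeInput G adj s T pa) b (IsLTreeOfLexDFS G s T)) →
            ∀ {st} → Loaded st → Clean st → Fresh st → arrays st 3 ≡ R → arrays st 4 ≡ pos → arrays st 5 ≡ B →
            Runs (sortTree ⨾ check unsorted ⨾ ifNonZero (var 12) skip
                (fill 22 (read 3 (var 3)) (read 3 (read 5 (var 3) ⊖ lit 1)) ⨾ rename p)) st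
              (14 + (n * 20 + 18 * arcCount) + (3 + n * 3 + suc (2 + n * 3 + b)))
                  (λ st → vars st 2 ≡ 1 ⇔ IsLexDFSOrder G s σ)
          sort-and-test dec ld cl fs R≡ pos≡ B≡ =
            sortTree-rule rk parentOf< parentOf-adjacent ld R≡ pos≡ (λ x → cong (λ F → F x ∸ 1) B≡)
              (Fresh.zero₆ fs) (Fresh.zero₇ fs) (Fresh.zero₈ fs) (Fresh.zero₉ fs) >> λ st₁ fr₁ I →
            let ld₁ = loaded-frame refl refl refl refl fr₁ ld
                cl₁ = clean-frame refl (λ _ → refl) (λ _ → refl) fr₁ cl
                succ = arrays st₁ 9
            in check-rule (λ i → (succ (i ∸ 1) ∸ i) + (i ∸ succ (i ∸ 1))) (Loaded.n≡ ld₁) 1≤n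
                 (λ { _ st′ _ _ fr refl →
                     cong (λ F → (F (vars st′ 3 ∸ 1) ∸ vars st′ 3) + (vars st′ 3 ∸ F (vars st′ 3 ∸ 1)))
                         (array-eq fr 9 refl) })
                 >> λ st₂ fr₂ sorted⇔ →
            let ld₂ = loaded-frame refl refl refl refl fr₂ ld₁
                cl₂ = clean-frame refl (λ _ → refl) (λ _ → refl) fr₂ cl₁
                R₂ = trans (array-eq fr₂ 3 refl) (trans (array-eq fr₁ 3 refl) R≡)
                B₂ = trans (array-eq fr₂ 5 refl) (trans (array-eq fr₁ 5 refl) B≡)
            in runs-if
              (λ nz → runs-weaken z≤n
                  (runs-skip (reject cl₂ (λ run → nz (Equivalence.from sorted⇔ (run⇒sorted I run))))))
              (λ z → let v = verdict I (Equivalence.to sorted⇔ z) in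
                runs-map (λ _ _ ans⇔ →
                    mk⇔ (Equivalence.to v ∘ Equivalence.to ans⇔) (Equivalence.from ans⇔ ∘ Equivalence.from v))
                (embed (tabulate (λ v → toℕ (par v))) R (λ i → R (B i ∸ 1)) (dec T pointers) ld₂ cl₂
                    (List.length-tabulate {n = n} _)
                  (λ _ → IsOrder.R< copied-order) (IsOrder.R-inj copied-order) value
                  (λ i st′ _ fr e → cong₂ _$_ (trans (array-eq fr 3 refl) R₂) e ,
                     cong₂ _$_ (trans (array-eq fr 3 refl) R₂)
                         (cong (_∸ 1) (cong₂ _$_ (trans (array-eq fr 5 refl) B₂) e)))))
            where
            parent<n : ∀ i → i < n → B i ∸ 1 < n
            parent<n i i<n with present i<n
            ... | inj₁ e = subst (λ b → b ∸ 1 < n) (sym e) 1≤n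
            ... | inj₂ (_ , _ , l , e) = subst (λ b → b ∸ 1 < n) (sym e) (ℕ.<-trans l i<n)
            value : ∀ i → i < n → contents (tabulate (λ v → toℕ (par v))) (R i) ≡ R (B i ∸ 1)
            value i i<n =
                trans (cong (contents (tabulate (λ v → toℕ (par v))))
                    (sym (toℕ-vertexOf (IsOrder.R< copied-order i<n))))
              (trans (contents-tabulate (λ v → toℕ (par v)) (vertexAt i))
                (trans (cong (λ x → toℕ (vertexAt (B x ∸ 1))) (ρ-vertexAt i<n))
                    (toℕ-vertexOf (IsOrder.R< copied-order (parent<n i i<n)))))

    decideOrder-rule : ∀ {p b} →
        (∀ T (pa : ParentArray G s T) → DecidesWithin p (treeInput G adj s T pa) b (IsLTreeOfLexDFS G s T)) →
      Runs (decideOrder p) (orderInput G adj s σ) (30 + n * 43 + arcCount * 24 + b)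
          (λ st → vars st 2 ≡ 1 ⇔ IsLexDFSOrder G s σ)
    decideOrder-rule {p} {b} dec = runs-weaken (ℕ.≤-reflexive (arrange n arcCount b))
      (fill-rule id σR refl (λ _ _ _ _ e → e) (λ i st _ fr e → e , cong₂ _$_ (array-eq fr 2 refl) e) >> λ st₁
          fr₁ (copied , _) →
       let ld₁ = loaded-frame refl refl refl refl fr₁ (input-loaded xs)
           cl₁ = clean-frame refl (λ _ → refl) (λ _ → refl) fr₁ (input-clean xs)
           fs₁ = fresh-frame refl refl refl refl fr₁ (input-fresh xs)
       in locate-rule (Copied.copied-order copied) ld₁ refl >> λ st₂ fr₂ loc →
       let ld₂ = loaded-frame refl refl refl refl fr₂ ld₁
           cl₂ = clean-frame refl (λ _ → refl) (λ _ → refl) fr₂ cl₁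
           fs₂ = fresh-frame refl refl refl refl fr₂ fs₁
       in check-rule (λ i → 1 ∸ arrays st₂ 5 i) (Loaded.n≡ ld₂) 1≤n
            (λ i st _ _ fr e → cong (1 ∸_) (cong₂ _$_ (array-eq fr 5 refl) e)) >> λ st₃ fr₃ connected⇔ →
       let ld₃ = loaded-frame refl refl refl refl fr₃ ld₂
           cl₃ = clean-frame refl (λ _ → refl) (λ _ → refl) fr₃ cl₂
           fs₃ = fresh-frame refl refl refl refl fr₃ fs₂
       in runs-if
         (λ nz → runs-weaken z≤n
             (runs-skip (reject cl₃
                 (λ run → nz (Equivalence.from connected⇔ (Copied.run⇒connected copied loc run))))))
         (λ z → Copied.Parents.sort-and-test copied loc (Equivalence.to connected⇔ z) dec ld₃ cl₃ fs₃
           (trans (array-eq fr₃ 3 refl) (array-eq fr₂ 3 refl)) (array-eq fr₃ 4 refl) (array-eq fr₃ 5 refl)))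
      where
      xs : List ℕ
      xs = tabulate (λ i → toℕ (σ ⟨$⟩ʳ i))
      arrange : ∀ n a b →
          2 + n * 3 + (4 + (n * 11 + 6 * a) +
              (3 + n * 3 + suc (14 + (n * 20 + 18 * a) + (3 + n * 3 + suc (2 + n * 3 + b)))))
                ≡ 30 + n * 43 + a * 24 + b
      arrange = solve-∀

-- Running times

module _ {ℓ : Level} (𝒢 : GraphFamily ℓ) (M : ℕ → ℕ → ℕ) where

  +-∈O : ∀ (f g : ℕ → ℕ → ℕ) → f ∈O[ 𝒢 ] M → g ∈O[ 𝒢 ] M → (λ n m → f n m + g n m) ∈O[ 𝒢 ] M
  +-∈O f g (c , N , f≤) (d , N′ , g≤) = c + d , N ⊔ N′ , λ G G∈ l → let open Graph G in
    ℕ.≤-trans (ℕ.+-mono-≤ (f≤ G G∈ (ℕ.≤-trans (ℕ.m≤m⊔n N N′) l)) (g≤ G G∈ (ℕ.≤-trans (ℕ.m≤n⊔m N N′) l)))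
              (ℕ.≤-reflexive (sym (ℕ.*-distribʳ-+ (M n m) c d)))

  overhead : ℕ → ℕ → ℕ → ℕ → ℕ → ℕ
  overhead a b c n m = a + n * b + (m + m) * c

  overhead-∈O : ∀ a b c → overhead a b c ∈O[ 𝒢 ] (λ n m → n + m)
  -- From size 1 on, the constant `a` is at most `a * (n + m)`. The slack added in `split` turns the
  -- remaining inequality into an identity.
  overhead-∈O a b c = a + b + 2 * c , 1 , λ G _ 1≤ → bound (Graph.n G) (Graph.m G) 1≤
    where
    open ℕ.≤-Reasoning
    split : ∀ n m → a * (n + m) + n * b + (m + m) * c + (m * b + n * (2 * c)) ≡ (a + b + 2 * c) * (n + m)
    split n m = lemma a b c n m
      where
      lemma : ∀ a b c n m → a * (n + m) + n * b + (m + m) * c + (m * b + n * (2 * c)) ≡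
          (a + b + 2 * c) * (n + m)
      lemma = solve-∀
    bound : ∀ n m → 1 ≤ n + m → overhead a b c n m ≤ (a + b + 2 * c) * (n + m)
    bound n m 1≤ = begin
      a + n * b + (m + m) * c                                          ≡⟨
          cong (λ u → u + n * b + (m + m) * c) (sym (ℕ.*-identityʳ a)) ⟩
      a * 1 + n * b + (m + m) * c                                      ≤⟨ ℕ.+-monoˡ-≤ ((m + m) * c)
          (ℕ.+-monoˡ-≤ (n * b) (ℕ.*-monoʳ-≤ a 1≤)) ⟩
      a * (n + m) + n * b + (m + m) * c                                ≤⟨ ℕ.m≤m+n _ _ ⟩
      a * (n + m) + n * b + (m + m) * c + (m * b + n * (2 * c))        ≡⟨ split n m ⟩
      (a + b + 2 * c) * (n + m)                                        ∎

  decides : ∀ {p st b b′} {P : Set} → b ≤ b′ → Runs p st b (λ st → vars st 2 ≡ 1 ⇔ P) → DecidesWithin p st b′ P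
  decides l (runs d t q) = _ , _ , d , ℕ.≤-trans t l , q

  within : ∀ n m {A} a b c t → A ≤ m + m → a + n * b + A * c + t ≤ overhead a b c n m + t
  within n m a b c t l = ℕ.+-monoˡ-≤ t (ℕ.+-monoʳ-≤ (a + n * b) (ℕ.*-monoˡ-≤ c l))

theorem12 : ∀ {ℓ : Level} (𝒢 : GraphFamily ℓ) (M : ℕ → ℕ → ℕ) →
    (∀ (f : ℕ → ℕ → ℕ) → f ∈O[ 𝒢 ] (λ n m → n + m) → f ∈O[ 𝒢 ] M) →
    LexDFSOrderDecidableInTime 𝒢 M ⇔ LexDFSTreeDecidableInTime 𝒢 M
theorem12 𝒢 M linear = mk⇔
  (λ (p , time , time∈ , dec) → decideTree p , (λ n m → overhead 𝒢 M 41 64 37 n m + time n m) ,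
     +-∈O 𝒢 M (overhead 𝒢 M 41 64 37) time (linear (overhead 𝒢 M 41 64 37) (overhead-∈O 𝒢 M 41 64 37)) time∈ ,
     λ G G∈ adj s T pa →
         decides 𝒢 M (within 𝒢 M (Graph.n G) (Graph.m G) 41 64 37 (time (Graph.n G) (Graph.m G))
             (InputNetwork.arcCount≤ G adj s))
       (Decide.TreeSide.decideTree-rule G adj s T pa (λ σ begins → dec G G∈ adj s σ begins)))
  (λ (p , time , time∈ , dec) → decideOrder p , (λ n m → overhead 𝒢 M 30 43 24 n m + time n m) ,
     +-∈O 𝒢 M (overhead 𝒢 M 30 43 24) time (linear (overhead 𝒢 M 30 43 24) (overhead-∈O 𝒢 M 30 43 24)) time∈ ,
     λ G G∈ adj s σ begins →
         decides 𝒢 M (within 𝒢 M (Graph.n G) (Graph.m G) 30 43 24 (time (Graph.n G) (Graph.m G))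
             (InputNetwork.arcCount≤ G adj s))
       (Decide.OrderSide.decideOrder-rule G adj s σ begins (λ T pa → dec G G∈ adj s T pa)))
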